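{- Let $g_1,\dots,g_N$ be unit vectors in $\mathbb{R}^2$, no two of them parallel, and let $\gamma_1,\dots,\gamma_N\in\mathbb{R}$ be such that the $N$-grid they define is regular. Then the grid tiling associated with this grid has a growth form, and this growth form is the polygon whose vertices are the $2N$ points $$\pm\frac{\upsilon_i}{\Delta_i},\qquad i=1,\dots,N,$$ (i.e. the boundary of the convex hull of these points), where for $i\neq j$: $\alpha_{ij}=\arccos|(g_i,g_j)|$, $\delta_{ij}=1/\sin\alpha_{ij}$, $D_{ij}=\det\begin{pmatrix}g_{i1}&g_{i2}\\ g_{j1}&g_{j2}\end{pmatrix}$ (with $g_i=(g_{i1},g_{i2})$), $\epsilon_{ij}=1$ if $D_{ij}>0$ and $\epsilon_{ij}=-1$ if $D_{ij}<0$, and $$\Delta_i=\sum_{j\neq i}\frac{1}{\delta_{ij}},\qquad \upsilon_i=\sum_{j\neq i}\frac{\epsilon_{ij}\,g_j}{\delta_{ij}}.$$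
   Context: Grid construction (in $\mathbb{R}^d$, here $d=2$): given unit vectors $g_1,\dots,g_N$ and reals $\gamma_1,\dots,\gamma_N$, the $N$-grid is the union of the $N$ families of equidistant parallel hyperplanes (lines, for $d=2$) $\{x\in\mathbb{R}^d:(x,g_i)-\gamma_i\in\mathbb{Z}\}$, $1\le i\le N$, where $(\cdot,\cdot)$ is the standard scalar product. The grid is regular if no point of $\mathbb{R}^d$ lies on more than $d$ of these hyperplanes. The grid decomposes $\mathbb{R}^d$ into cells (closures of connected components of the complement). Define $K_i(x)=\min\{n\in\mathbb{Z}: n\ge (x,g_i)-\gamma_i\}$ and $K(x)=\sum_{i=1}^N K_i(x)g_i$; $K$ is constant on the interior of each cell, so it maps cells to a discrete set $\Lambda\subset\mathbb{R}^d$. The grid tiling is the tiling with vertex set $\Lambda$ in which two points of $\Lambda$ are joined by an edge iff the corresponding cells share a facet (an edge when $d=2$), and whose tiles are, for each intersection point of $d$ grid hyperplanes, the parallelotope (rhombus when $d=2$) whose vertices are the $K$-images of the $2^d$ cells containing that point. Growth form: two tiles of a tiling of $\mathbb{R}^d$ are neighbours if their intersection has positive $(d-1)$-dimensional volume. A chain is a finite sequence of tiles with consecutive tiles neighbours; its length is the number of tiles minus one; the distance between two tiles is the minimal length of a chain joining them. Given a finite nonempty set $P_0$ of tiles, the $n$-th coordination shell $P_n$ is the set of tiles at distance exactly $n$ from $P_0$. A closed $(d-1)$-dimensional surface $F\subset\mathbb{R}^d$ is a growth form of the tiling if there exist a point $x$ and a constant $C$ such that for all $n$ the shell $P_n$ lies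 in the $C$-neighbourhood of $x+nF$ (this does not depend on $P_0$). -}

module Defs where

open import Algebra.Bundles using (CommutativeRing; Semiring)
import Algebra.Definitions.RawSemiring as RawSemiringDefs
open import Axiom.ExcludedMiddle using (ExcludedMiddle)
open import Data.Bool.Base using (if_then_else_)
open import Data.Fin.Base using (Fin; toℕ)
import Data.Fin.Properties as Fin
open import Data.Integer.Base as ℤ using (ℤ; 0ℤ; +_; -[1+_])
open import Data.List.Membership.Propositional using () renaming (_∈_ to _∈ˡ_)
open import Data.List.NonEmpty.Base using (List⁺; toList)
open import Data.Nat.Base as ℕ using (ℕ; suc; _!)
open import Data.Product.Base using (Σ; ∃; _×_; _,_; proj₁; proj₂)
open import Data.Sign.Base using (Sign) renaming (+ to s+; - to s-)
open import Data.Sum.Base using (_⊎_; [_,_]′)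
open import Function.Base using (_∘_; const)
open import Level using (Level; 0ℓ; Lift; lift; lower) renaming (suc to lsuc)
open import Relation.Binary.Core using (Rel)
import Relation.Binary.Construct.NonStrictToStrict as ToStrict
open import Relation.Binary.PropositionalEquality.Core using (_≡_; _≢_)
open import Relation.Binary.Structures using (IsTotalOrder)
open import Relation.Nullary.Decidable.Core using (Dec; yes; no; does; map′)
open import Relation.Nullary.Negation.Core using (¬_)
open import Relation.Unary using (Pred; _∈_; _⊆_; _∪_; _∩_; _≬_; _≐_; ∁; Satisfiable)

-- Classically, a Dedekind-complete ordered field is the field of real numbers,
-- up to a unique isomorphism.
record CompleteOrderedField : Set₁ where
  infix 4 _≤_
  field
    commutativeRing : CommutativeRing 0ℓ 0ℓ

  open CommutativeRing commutativeRing public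

  field
    _≤_          : Rel Carrier 0ℓ
    isTotalOrder : IsTotalOrder _≈_ _≤_
    0≉1          : ¬ 0# ≈ 1#
    inverse      : ∀ x → ¬ x ≈ 0# → ∃ λ y → x * y ≈ 1#
    +-monoˡ-≤    : ∀ z {x y} → x ≤ y → x + z ≤ y + z
    *-nonNeg     : ∀ {x y} → 0# ≤ x → 0# ≤ y → 0# ≤ x * y

  IsUpperBound : Pred Carrier 0ℓ → Pred Carrier 0ℓ
  IsUpperBound P b = ∀ x → x ∈ P → x ≤ b

  field
    complete : (P : Pred Carrier 0ℓ) → Satisfiable P → Satisfiable (IsUpperBound P) →
               ∃ λ s → IsUpperBound P s × (∀ b → IsUpperBound P b → s ≤ b)

module GridTilings (em : ExcludedMiddle (lsuc 0ℓ)) (realField : CompleteOrderedField) where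

  open CompleteOrderedField realField public
    hiding (_≉_) renaming (Carrier to ℝ)
  open ToStrict _≈_ _≤_ public using (_<_)
  open RawSemiringDefs (Semiring.rawSemiring semiring) public
    using (sum; _^_) renaming (_×_ to _×ℕ_)

  decide : (P : Set) → Dec P
  decide P = map′ lower lift (em {Lift (lsuc 0ℓ) P})

  -- Some element satisfying P, or the default d when there is none.
  choose : {A : Set} → A → Pred A 0ℓ → A
  choose d P with decide (∃ P)
  ... | yes (x , _) = x
  ... | no _        = d

  infix 8 _⁻¹
  infix 4 _⟶_

  ∣_∣ : ℝ → ℝ
  ∣ x ∣ = [ const x , const (- x) ]′ (IsTotalOrder.total isTotalOrder 0# x)

  -- Division by zero yields zero.
  _⁻¹ : ℝ → ℝ
  x ⁻¹ = choose 0# (λ y → x * y ≈ 1#)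

  fromℕ : ℕ → ℝ
  fromℕ n = n ×ℕ 1#

  fromℤ : ℤ → ℝ
  fromℤ (+ n)      = fromℕ n
  fromℤ (-[1+ n ]) = - fromℕ (suc n)

  ⌈_⌉ : ℝ → ℤ
  ⌈ t ⌉ = choose 0ℤ (λ n → t ≤ fromℤ n × (∀ m → t ≤ fromℤ m → n ℤ.≤ m))

  _⟶_ : (ℕ → ℝ) → ℝ → Set
  s ⟶ l = ∀ ε → 0# < ε → ∃ λ M → ∀ n → M ℕ.≤ n → ∣ s n - l ∣ < ε

  ∑∞ : (ℕ → ℝ) → ℝ
  ∑∞ a = choose 0# (λ l → (λ n → sum {n} (a ∘ toℕ)) ⟶ l)

  sin : ℝ → ℝ
  sin x = ∑∞ (λ k → (- 1#) ^ k * x ^ suc (2 ℕ.* k) * (fromℕ (suc (2 ℕ.* k) !)) ⁻¹)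

  cos : ℝ → ℝ
  cos x = ∑∞ (λ k → (- 1#) ^ k * x ^ (2 ℕ.* k) * (fromℕ ((2 ℕ.* k) !)) ⁻¹)

  -- The least positive zero of sin.
  π : ℝ
  π = choose 0# (λ p → 0# < p × sin p ≈ 0# × (∀ x → 0# < x → sin x ≈ 0# → p ≤ x))

  arccos : ℝ → ℝ
  arccos c = choose 0# (λ α → 0# ≤ α × α ≤ π × cos α ≈ c)

  ℝ² : Set
  ℝ² = ℝ × ℝ

  infix  4 _≈²_
  infixl 6 _+²_ _-²_
  infixr 7 _∙_

  _≈²_ : Rel ℝ² 0ℓ
  (x₁ , x₂) ≈² (y₁ , y₂) = x₁ ≈ y₁ × x₂ ≈ y₂

  0² : ℝ²
  0² = 0# , 0#

  _+²_ _-²_ : ℝ² → ℝ² → ℝ²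
  (x₁ , x₂) +² (y₁ , y₂) = x₁ + y₁ , x₂ + y₂
  (x₁ , x₂) -² (y₁ , y₂) = x₁ - y₁ , x₂ - y₂

  -²_ : ℝ² → ℝ²
  -² (x₁ , x₂) = - x₁ , - x₂

  _∙_ : ℝ → ℝ² → ℝ²
  t ∙ (x₁ , x₂) = t * x₁ , t * x₂

  ⟨_,_⟩ : ℝ² → ℝ² → ℝ
  ⟨ (x₁ , x₂) , (y₁ , y₂) ⟩ = x₁ * y₁ + x₂ * y₂

  det : ℝ² → ℝ² → ℝ
  det (x₁ , x₂) (y₁ , y₂) = x₁ * y₂ - x₂ * y₁

  sum² : ∀ {n} → (Fin n → ℝ²) → ℝ²
  sum² v = sum (proj₁ ∘ v) , sum (proj₂ ∘ v)

  IsUnit : Pred ℝ² 0ℓ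
  IsUnit u = ⟨ u , u ⟩ ≈ 1#

  -- For nonzero vectors.
  Parallel : Rel ℝ² 0ℓ
  Parallel u v = ∃ λ t → u ≈² t ∙ v

  distSq : ℝ² → ℝ² → ℝ
  distSq x y = ⟨ x -² y , x -² y ⟩

  Ball : ℝ² → ℝ → Pred ℝ² 0ℓ
  Ball c r y = 0# ≤ r × distSq y c < r * r

  ClosedBall : ℝ² → ℝ → Pred ℝ² 0ℓ
  ClosedBall c r y = 0# ≤ r × distSq y c ≤ r * r

  private variable
    ℓ : Level

  Closure : Pred ℝ² ℓ → Pred ℝ² ℓ
  Closure S x = ∀ r → 0# < r → Ball x r ≬ S

  ∂ : Pred ℝ² ℓ → Pred ℝ² ℓ
  ∂ S = Closure S ∩ Closure (∁ S)

  Open : Pred ℝ² 0ℓ → Set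
  Open S = ∀ x → x ∈ S → ∃ λ r → 0# < r × Ball x r ⊆ S

  Connected : Pred ℝ² 0ℓ → Set₁
  Connected S = (A B : Pred ℝ² 0ℓ) → Open A → Open B →
                S ⊆ A ∪ B → S ≬ A → S ≬ B → S ≬ (A ∩ B)

  -- The connected component of x in U: the union of the connected subsets
  -- of U containing x.
  Component : Pred ℝ² 0ℓ → ℝ² → Pred ℝ² (lsuc 0ℓ)
  Component U x y = Σ (Pred ℝ² 0ℓ) λ S → S ⊆ U × Connected S × x ∈ S × y ∈ S

  convexHull : Pred ℝ² ℓ → Pred ℝ² ℓ
  convexHull S z =
    ∃ λ n → Σ (Fin n → ℝ) λ w → Σ (Fin n → ℝ²) λ p →
      (∀ k → 0# ≤ w k) × sum w ≈ 1# × (∀ k → p k ∈ S) × z ≈² sum² (λ k → w k ∙ p k)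

  -- Vanishing one-dimensional Hausdorff measure: there are countable covers
  -- of arbitrarily small total radius.
  LengthZero : Pred ℝ² ℓ → Set ℓ
  LengthZero S =
    ∀ ε → 0# < ε →
      Σ (ℕ → ℝ²) λ c → Σ (ℕ → ℝ) λ r →
        (∀ n → 0# ≤ r n) × (∀ z → z ∈ S → ∃ λ n → z ∈ Ball (c n) (r n)) ×
        (∀ m → sum {m} (r ∘ toℕ) ≤ ε)

  ContinuousOn : Pred ℝ² 0ℓ → (ℝ² → ℝ²) → Set
  ContinuousOn S f =
    ∀ x → x ∈ S → ∀ ε → 0# < ε →
      ∃ λ δ → 0# < δ × (∀ y → y ∈ S → y ∈ Ball x δ → f y ∈ Ball (f x) ε)

  -- A closed 1-dimensional surface in the plane: an injective continuous
  -- image of the unit circle (a homeomorphic one, by compactness).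
  ClosedCurve : Pred ℝ² 0ℓ → Set
  ClosedCurve F =
    Σ (ℝ² → ℝ²) λ f →
      ContinuousOn IsUnit f ×
      (∀ u v → u ∈ IsUnit → v ∈ IsUnit → f u ≈² f v → u ≈² v) ×
      F ≐ (λ z → ∃ λ u → u ∈ IsUnit × z ≈² f u)

  Extreme : Pred ℝ² 0ℓ → Pred ℝ² 0ℓ
  Extreme S v =
    v ∈ S × (∀ a b t → a ∈ S → b ∈ S → 0# < t → t < 1# →
             v ≈² (1# - t) ∙ a +² t ∙ b → a ≈² v × b ≈² v)

  -- F is the convex polygon (as a curve) whose vertices are the points v a,
  -- distinct for distinct labels.
  record IsPolygonWithVertices {I : Set} (F : Pred ℝ² 0ℓ) (v : I → ℝ²) : Set where
    hull : Pred ℝ² 0ℓ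
    hull = convexHull (λ z → ∃ λ a → z ≈² v a)
    field
      distinct : ∀ a b → v a ≈² v b → a ≡ b
      extreme  : ∀ a → v a ∈ Extreme hull
      boundary : F ≐ ∂ hull

  record TileFamily : Set₂ where
    field
      Index : Set
      tile  : Index → Pred ℝ² (lsuc 0ℓ)

  module _ (𝒯 : TileFamily) where
    open TileFamily 𝒯

    Neighbours : Rel Index (lsuc 0ℓ)
    Neighbours a b = ¬ LengthZero (tile a ∩ tile b)

    -- Chain a b n: a chain of length n from tile a to tile b.  Tiles are
    -- compared as sets, so that two indices of one tile are at distance 0.
    data Chain : Index → Index → ℕ → Set₁ where
      here : ∀ {a b} → tile a ≐ tile b → Chain a b 0
      step : ∀ {a b c n} → Neighbours a b → Chain b c n → Chain a c (suc n)

    Shell : List⁺ Index → ℕ → Pred Index (lsuc 0ℓ)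
    Shell P₀ n b =
      (∃ λ a → a ∈ˡ toList P₀ × Chain a b n) ×
      (∀ a m → a ∈ˡ toList P₀ → Chain a b m → n ℕ.≤ m)

    record IsGrowthForm (F : Pred ℝ² 0ℓ) : Set₁ where
      field
        closedCurve : ClosedCurve F
        growth :
          ∀ P₀ → ∃ λ x → ∃ λ C →
            ∀ n b → b ∈ Shell P₀ n → ∀ z → z ∈ tile b →
              ∃ λ f → f ∈ F × z ∈ ClosedBall (x +² fromℕ n ∙ f) C

  module _ {N : ℕ} (g : Fin N → ℝ²) (γ : Fin N → ℝ) where

    -- (i , m) labels the line (x , gᵢ) - γᵢ = m.  When no two of the gᵢ are
    -- parallel, distinct labels give distinct lines.
    Line : Set
    Line = Fin N × ℤ

    _liesOn_ : ℝ² → Line → Set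
    x liesOn (i , m) = ⟨ x , g i ⟩ - γ i ≈ fromℤ m

    Regular : Set
    Regular = ∀ x h₁ h₂ h₃ → x liesOn h₁ → x liesOn h₂ → x liesOn h₃ →
              h₁ ≡ h₂ ⊎ h₁ ≡ h₃ ⊎ h₂ ≡ h₃

    OffGrid : Pred ℝ² 0ℓ
    OffGrid x = ∀ h → ¬ x liesOn h

    Crossing : Set
    Crossing = Σ ℝ² λ p → ∃ λ h₁ → ∃ λ h₂ → h₁ ≢ h₂ × p liesOn h₁ × p liesOn h₂

    -- A point y off the grid stands for the cell having y in its interior.
    Cell : ℝ² → Pred ℝ² (lsuc 0ℓ)
    Cell y = Closure (Component OffGrid y)

    K : ℝ² → ℝ²
    K x = sum² (λ i → fromℤ ⌈ ⟨ x , g i ⟩ - γ i ⌉ ∙ g i)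

    tileVertices : ℝ² → Pred ℝ² (lsuc 0ℓ)
    tileVertices p v = ∃ λ y → y ∈ OffGrid × p ∈ Cell y × v ≈² K y

    gridTiling : TileFamily
    gridTiling = record
      { Index = Crossing
      ; tile  = λ (p , _) → convexHull (tileVertices p)
      }

  module _ {N : ℕ} (g : Fin N → ℝ²) where

    α δ D ε : Fin N → Fin N → ℝ
    α i j = arccos ∣ ⟨ g i , g j ⟩ ∣
    δ i j = sin (α i j) ⁻¹
    D i j = det (g i) (g j)
    ε i j = if does (decide (0# < D i j)) then 1# else
            if does (decide (D i j < 0#)) then - 1# else 0#

    Δ : Fin N → ℝ
    Δ i = sum (λ j → if does (j Fin.≟ i) then 0# else δ i j ⁻¹)

    υ : Fin N → ℝ²
    υ i = sum² (λ j → if does (j Fin.≟ i) then 0² else (ε i j * δ i j ⁻¹) ∙ g j)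

    -- The points ± υᵢ / Δᵢ.
    growthVertex : Sign × Fin N → ℝ²
    growthVertex (s+ , i) = Δ i ⁻¹ ∙ υ i
    growthVertex (s- , i) = -² (Δ i ⁻¹ ∙ υ i)

{-# OPTIONS --safe #-}
module Submission where

open import Defs
open import Axiom.ExcludedMiddle using (ExcludedMiddle)
open import Data.Fin.Base using (Fin)
open import Data.Nat.Base as ℕ using (ℕ)
open import Data.Product.Base using (Σ; _×_)
open import Level using (0ℓ) renaming (suc to lsuc)
open import Relation.Binary.PropositionalEquality.Core using (_≢_)
open import Relation.Nullary.Negation.Core using (¬_)
open import Relation.Unary using (Pred)

open import Algebra.Bundles using (CommutativeRing)
import Algebra.Properties.AbelianGroup as AbelianGroupProperties
import Algebra.Properties.CommutativeMonoid.Sum as CommutativeMonoidSum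
import Algebra.Properties.Monoid.Mult as MonoidMult
import Algebra.Properties.Ring as RingProperties
import Algebra.Properties.Semiring.Mult as SemiringMult
import Algebra.Properties.Semiring.Sum as SemiringSum
open import Data.Bool.Base using (Bool; true; false; T; if_then_else_)
open import Data.Empty using (⊥; ⊥-elim)
open import Data.Fin.Base using (zero; suc; toℕ)
import Data.Fin.Properties as Fin using (_≟_)
open import Data.Integer.Base as ℤ using (ℤ; 0ℤ; 1ℤ; +_; -[1+_])
import Data.Integer.Properties as ℤₚ using (*-zeroˡ; [1+m]⊖[1+n]≡m⊖n; i<j⇒suc[i]≤j; i≤j⇒0≤j-i; neg-distribˡ-*; suc-*; ≤-antisym; _≤?_; ≰⇒>)
open import Data.List.Base using (List; []; _∷_)
open import Data.List.Membership.Propositional using () renaming (_∈_ to _∈ˡ_)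
open import Data.List.NonEmpty.Base using () renaming (_∷_ to _∷⁺_)
open import Data.List.Relation.Unary.Any using (here; there)
open import Data.Maybe.Base using (nothing)
open import Data.Nat.Base using (zero; suc; _!)
import Data.Nat.Properties as ℕₚ using (+-comm; +-suc; m≤m⊔n; m≤n+m; m≤n⇒m≤1+n; m≤n⊔m; ≤-refl; ≤-trans; ≤⇒≤′)
open import Data.Product.Base using (∃; _,_; proj₁; proj₂)
open import Data.Sign.Base using (Sign) renaming (+ to s+; - to s-)
open import Data.Sum.Base using (_⊎_; inj₁; inj₂; [_,_]′)
open import Data.Vec.Base using (Vec; []; _∷_; lookup)
open import Function.Base using (_∘_; const; case_of_)
import Relation.Binary.PropositionalEquality as ≡ using (cong; refl; subst; sym; trans)
open import Relation.Binary.PropositionalEquality.Core using (_≡_)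
import Relation.Binary.Reasoning.Setoid as SetoidReasoning
open import Relation.Binary.Structures using (IsTotalOrder)
open import Relation.Nullary.Decidable.Core using (Dec; yes; no; does)
open import Relation.Unary using (_∈_; _⊆_; _∪_; _∩_; _≬_; _≐_; ∁)
open import Tactic.RingSolver.Core.AlmostCommutativeRing using (fromCommutativeRing)
import Tactic.RingSolver.Core.Polynomial.Base as PolynomialBase
import Tactic.RingSolver.Core.Polynomial.Homomorphism as PolynomialHomomorphism
open import Tactic.RingSolver.Core.Polynomial.Parameters using (RawCoeff; Homomorphism)
import Tactic.RingSolver.Core.Polynomial.Semantics as PolynomialSemantics

-- Placing K(x) over every point of the plane turns the tiling inside out: two tiles
-- are neighbours exactly when their crossings are consecutive on a grid line.  Hence
-- the distance of two tiles is, up to a bounded error, the number of grid lines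
-- separating their crossings, that is, Z(x) = Σⱼ |(x , gⱼ)| for the difference x of
-- the crossings.  For the lower bound, a step of a chain passes at most one line, if
-- lines through an end of the step count one half; for the upper bound, x is a nonnegative
-- combination of two line directions between which no (x , gⱼ) changes its sign, and
-- one walks along one line of each of the two families.
--
-- Since K(x) = A x + O(1) with A x = Σⱼ (x , gⱼ) gⱼ, the growth form is the unit
-- sphere of the norm Z ∘ A⁻¹.  On the cones above Z is linear, so this sphere is a
-- polygon with its vertices on the images under A of the line directions eᵢ; as
-- sin (arccos |(gᵢ , gⱼ)|) = |Dᵢⱼ|, these vertices A (eᵢ / Z(eᵢ)) are ± υᵢ / Δᵢ.

-- The obstacle is that a tile is a convex hull of values of K on closures of connected components.
-- A point of the tile at p is therefore recorded by weights `κ` alone: it is the sum of the κ_j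
-- g_j, with κ_j between the one-sided limits of the ceiling at the level of p. The map from x to
-- such sums is monotone, being the subdifferential of a convex function with gradient K; so a point
-- common to two tiles has equal weights in every family in which the crossings differ in level. All
-- restrictions on neighbours come from this. The count one half reflects that crossings themselves
-- lie on two lines: a step along one line leaves a second line and reaches a third, passing half of
-- each. With everything doubled such a step costs exactly 2, which is also the bound for any two
-- neighbours; hence the two estimates agree to first order. The trigonometry serves the one
-- identity sin (arccos c) = sqrt (1 - c²). As `π` and `arccos` are choices with a default, the
-- objects they choose must first be produced from the power series: the least positive zero of the
-- sine, and the values of the cosine.

module Proof (em : ExcludedMiddle (lsuc 0ℓ)) (realField : CompleteOrderedField) where

  open GridTilings em realField using
    ( ℝ; 0#; 1#; _+_; _*_; -_; _-_; _≈_; _≤_; _<_; refl; sym; trans; reflexive; setoid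
    ; +-cong; +-congˡ; +-congʳ; +-comm; +-assoc; +-identityˡ; +-identityʳ; *-cong; *-congˡ; *-congʳ; *-comm; *-assoc
    ; *-identityˡ; *-identityʳ; distribˡ; distribʳ; zeroˡ; zeroʳ; -‿cong; -‿inverseˡ; -‿inverseʳ
    ; commutativeRing; ring; semiring; +-monoid; +-abelianGroup; +-commutativeMonoid; isTotalOrder
    ; 0≉1; inverse; +-monoˡ-≤; *-nonNeg; IsUpperBound; complete
    ; sum; _^_; decide; choose; ∣_∣; _⁻¹; fromℕ; fromℤ; ⌈_⌉; _⟶_; ∑∞; sin; cos; π; arccos
    ; ℝ²; _≈²_; 0²; _+²_; _-²_; _∙_; ⟨_,_⟩; det; sum²; IsUnit; Parallel; distSq; Ball; ClosedBall
    ; Closure; ∂; Open; Connected; Component; convexHull; LengthZero; ContinuousOn; ClosedCurve; Extreme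
    ; IsPolygonWithVertices; Neighbours; Chain; here; Shell; IsGrowthForm; Line; _liesOn_; Regular; OffGrid
    ; Crossing; Cell; tileVertices; gridTiling; growthVertex )
    renaming (step to advance)

  -- The integers inside the field.

  module IntegerEmbedding where
    open AbelianGroupProperties +-abelianGroup using (⁻¹-involutive; ⁻¹-∙-comm; ε⁻¹≈ε)
    open RingProperties ring using (-‿distribˡ-*)
    open SetoidReasoning setoid

    fromℕ-+ : ∀ m n → fromℕ (m ℕ.+ n) ≈ fromℕ m + fromℕ n
    fromℕ-+ m n = MonoidMult.×-homo-+ +-monoid 1# m n

    fromℤ-neg : ∀ i → fromℤ (ℤ.- i) ≈ - fromℤ i
    fromℤ-neg (+ zero)   = sym ε⁻¹≈ε
    fromℤ-neg (+ suc n)  = refl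
    fromℤ-neg (-[1+ n ]) = sym (⁻¹-involutive _)

    fromℤ-⊖ : ∀ m n → fromℤ (m ℤ.⊖ n) ≈ fromℕ m - fromℕ n
    fromℤ-⊖ m zero = sym (trans (+-congˡ ε⁻¹≈ε) (+-identityʳ _))
    fromℤ-⊖ zero (suc n) = sym (+-identityˡ _)
    fromℤ-⊖ (suc m) (suc n) = begin
      fromℤ (suc m ℤ.⊖ suc n)                ≡⟨ ≡.cong fromℤ (ℤₚ.[1+m]⊖[1+n]≡m⊖n m n) ⟩
      fromℤ (m ℤ.⊖ n)                        ≈⟨ fromℤ-⊖ m n ⟩
      fromℕ m - fromℕ n                      ≈⟨ +-congʳ (+-identityʳ _) ⟨
      fromℕ m + 0# - fromℕ n                 ≈⟨ +-congʳ (+-congˡ (-‿inverseʳ 1#)) ⟨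
      fromℕ m + (1# - 1#) - fromℕ n          ≈⟨ +-congʳ (+-assoc _ _ _) ⟨
      fromℕ m + 1# - 1# - fromℕ n            ≈⟨ +-assoc _ _ _ ⟩
      fromℕ m + 1# + (- 1# - fromℕ n)        ≈⟨ +-cong (+-comm _ _) (⁻¹-∙-comm _ _) ⟩
      fromℕ (suc m) - fromℕ (suc n)          ∎

    fromℤ-+ : ∀ i j → fromℤ (i ℤ.+ j) ≈ fromℤ i + fromℤ j
    fromℤ-+ (+ m)      (+ n)      = fromℕ-+ m n
    fromℤ-+ (+ m)      (-[1+ n ]) = fromℤ-⊖ m (suc n)
    fromℤ-+ (-[1+ m ]) (+ n)      = trans (fromℤ-⊖ n (suc m)) (+-comm _ _)
    fromℤ-+ (-[1+ m ]) (-[1+ n ]) = begin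
      - fromℕ (suc (suc (m ℕ.+ n)))          ≡⟨ ≡.cong (λ k → - fromℕ k) (ℕₚ.+-suc (suc m) n) ⟨
      - fromℕ (suc m ℕ.+ suc n)              ≈⟨ -‿cong (fromℕ-+ (suc m) (suc n)) ⟩
      - (fromℕ (suc m) + fromℕ (suc n))      ≈⟨ ⁻¹-∙-comm _ _ ⟨
      - fromℕ (suc m) - fromℕ (suc n)        ∎

    fromℤ-*⁺ : ∀ m j → fromℤ (+ m ℤ.* j) ≈ fromℕ m * fromℤ j
    fromℤ-*⁺ zero    j = trans (reflexive (≡.cong fromℤ (ℤₚ.*-zeroˡ j))) (sym (zeroˡ _))
    fromℤ-*⁺ (suc m) j = begin
      fromℤ (+ suc m ℤ.* j)                  ≡⟨ ≡.cong fromℤ (ℤₚ.suc-* (+ m) j) ⟩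
      fromℤ (j ℤ.+ + m ℤ.* j)                ≈⟨ fromℤ-+ j (+ m ℤ.* j) ⟩
      fromℤ j + fromℤ (+ m ℤ.* j)            ≈⟨ +-cong (sym (*-identityˡ _)) (fromℤ-*⁺ m j) ⟩
      1# * fromℤ j + fromℕ m * fromℤ j       ≈⟨ distribʳ _ _ _ ⟨
      fromℕ (suc m) * fromℤ j                ∎

    fromℤ-* : ∀ i j → fromℤ (i ℤ.* j) ≈ fromℤ i * fromℤ j
    fromℤ-* (+ m)      j = fromℤ-*⁺ m j
    fromℤ-* (-[1+ m ]) j = begin
      fromℤ (-[1+ m ] ℤ.* j)                 ≡⟨ ≡.cong fromℤ (ℤₚ.neg-distribˡ-* (+ suc m) j) ⟨
      fromℤ (ℤ.- (+ suc m ℤ.* j))            ≈⟨ fromℤ-neg (+ suc m ℤ.* j) ⟩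
      - fromℤ (+ suc m ℤ.* j)                ≈⟨ -‿cong (fromℤ-*⁺ (suc m) j) ⟩
      - (fromℕ (suc m) * fromℤ j)            ≈⟨ -‿distribˡ-* _ _ ⟩
      - fromℕ (suc m) * fromℤ j              ∎

  open IntegerEmbedding

  open RingProperties ring using (-‿distribˡ-*; -‿distribʳ-*)
  open AbelianGroupProperties +-abelianGroup using () renaming (⁻¹-involutive to -‿involutive)
  open IsTotalOrder isTotalOrder public
    using (total; antisym) renaming (refl to ≤-refl; trans to ≤-trans; reflexive to ≤-reflexive)

  -- Basic order arithmetic.

  ≤-resp : ∀ {a b c d} → a ≈ c → b ≈ d → a ≤ b → c ≤ d
  ≤-resp a≈c b≈d a≤b = ≤-trans (≤-reflexive (sym a≈c)) (≤-trans a≤b (≤-reflexive b≈d))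

  ≤⇒0≤- : ∀ {a b} → a ≤ b → 0# ≤ b - a
  ≤⇒0≤- {a} a≤b = ≤-resp (-‿inverseʳ a) refl (+-monoˡ-≤ (- a) a≤b)

  0≤-⇒≤ : ∀ {a b} → 0# ≤ b - a → a ≤ b
  0≤-⇒≤ {a} {b} p = ≤-resp (+-identityˡ a)
    (trans (+-assoc _ _ _) (trans (+-congˡ (-‿inverseˡ a)) (+-identityʳ b))) (+-monoˡ-≤ a p)

  -≈0⇒≈ : ∀ {a b} → b - a ≈ 0# → a ≈ b
  -≈0⇒≈ {a} {b} p = sym (trans (sym (trans (+-assoc _ _ _) (trans (+-congˡ (-‿inverseˡ a)) (+-identityʳ b))))
    (trans (+-congʳ p) (+-identityˡ a)))

  ≈⇒-≈0 : ∀ {a b} → a ≈ b → b - a ≈ 0#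
  ≈⇒-≈0 {a} a≈b = trans (+-congʳ (sym a≈b)) (-‿inverseʳ a)

  <⇒0<- : ∀ {a b} → a < b → 0# < b - a
  <⇒0<- (a≤b , a≉b) = ≤⇒0≤- a≤b , λ 0≈b-a → a≉b (-≈0⇒≈ (sym 0≈b-a))

  0<-⇒< : ∀ {a b} → 0# < b - a → a < b
  0<-⇒< (p , q) = 0≤-⇒≤ p , λ a≈b → q (sym (≈⇒-≈0 a≈b))

  +-nonNeg : ∀ {a b} → 0# ≤ a → 0# ≤ b → 0# ≤ a + b
  +-nonNeg {a} {b} p q = ≤-trans q (≤-resp (+-identityˡ b) refl (+-monoˡ-≤ b p))

  +-pos-nonNeg : ∀ {a b} → 0# < a → 0# ≤ b → 0# < a + b
  +-pos-nonNeg {a} {b} (p , ¬p) q = +-nonNeg p q , λ 0≈a+b →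
    ¬p (antisym p (≤-resp (+-identityʳ a) (sym 0≈a+b) (≤-resp (+-comm _ _) (+-comm _ _) (+-monoˡ-≤ a q))))

  *-pos : ∀ {a b} → 0# < a → 0# < b → 0# < a * b
  *-pos {a} {b} (p , ¬p) (q , ¬q) = *-nonNeg p q , λ 0≈ab → ¬q (
    let c , ac≈1 = inverse a (¬p ∘ sym) in
    trans (sym (zeroʳ c)) (trans (*-congˡ 0≈ab) (trans (sym (*-assoc c a b))
      (trans (*-congʳ (trans (*-comm c a) ac≈1)) (*-identityˡ b)))))

  0≤x*x : ∀ x → 0# ≤ x * x
  0≤x*x x with total 0# x
  ... | inj₁ 0≤x = *-nonNeg 0≤x 0≤x
  ... | inj₂ x≤0 = ≤-resp refl
    (trans (sym (-‿distribˡ-* x (- x))) (trans (-‿cong (sym (-‿distribʳ-* x x))) (-‿involutive _)))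
    (*-nonNeg 0≤-x 0≤-x)
    where
    0≤-x : 0# ≤ - x
    0≤-x = ≤-resp refl (+-identityˡ _) (≤⇒0≤- x≤0)

  0<1 : 0# < 1#
  0<1 = ≤-resp refl (*-identityˡ 1#) (0≤x*x 1#) , 0≉1

  fromℕ-nonNeg : ∀ n → 0# ≤ fromℕ n
  fromℕ-nonNeg zero    = ≤-refl
  fromℕ-nonNeg (suc n) = +-nonNeg (proj₁ 0<1) (fromℕ-nonNeg n)

  fromℕ-pos : ∀ n → 0# < fromℕ (suc n)
  fromℕ-pos n = +-pos-nonNeg 0<1 (fromℕ-nonNeg n)

  -- Certificates for polynomial equations and inequalities.

  -- Terms are reified by instance search, with one local instance for each atom
  -- listed in ρ.
  module LinearArithmetic where
    open RingProperties ring using (-‿distribˡ-*)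

    ℤ-coefficients : RawCoeff 0ℓ 0ℓ
    ℤ-coefficients = record { rawRing = ℤ.+-*-rawRing ; isZero = λ { (+ 0) → true ; _ → false } }

    isZero-sound : ∀ i → T (RawCoeff.isZero ℤ-coefficients i) → 0# ≈ fromℤ i
    isZero-sound (+ 0) _ = refl

    evaluation : Homomorphism 0ℓ 0ℓ 0ℓ 0ℓ
    evaluation = record
      { from     = ℤ-coefficients
      ; to       = fromCommutativeRing commutativeRing (λ _ → nothing)
      ; morphism = record
        { ⟦_⟧ = fromℤ ; +-homo = fromℤ-+ ; *-homo = fromℤ-* ; -‿homo = fromℤ-neg
        ; 0-homo = refl ; 1-homo = +-identityʳ 1# }
      ; Zero-C⟶Zero-R = isZero-sound
      }

    open PolynomialBase ℤ-coefficients using (Poly; _⊐_; κ; ι; _⊞_; _⊠_; ⊟_) renaming (Κ to constant; ⅀ to nonconstant)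
    open PolynomialSemantics evaluation renaming (⟦_⟧ to ⟦_⟧ₚ)
    open PolynomialHomomorphism evaluation

    infixl 6 _:+_
    infixl 7 _:*_
    infix  8 :-_

    data Expr (n : ℕ) : Set where
      con           : ℤ → Expr n
      var           : Fin n → Expr n
      _:+_ _:*_     : Expr n → Expr n → Expr n
      :-_           : Expr n → Expr n

    private variable
      n : ℕ
      a b : ℝ
      ρ : Vec ℝ n

    ⟦_⟧ : Expr n → Vec ℝ n → ℝ
    ⟦ con c  ⟧ ρ = fromℤ c
    ⟦ var i  ⟧ ρ = lookup ρ i
    ⟦ e :+ f ⟧ ρ = ⟦ e ⟧ ρ + ⟦ f ⟧ ρ
    ⟦ e :* f ⟧ ρ = ⟦ e ⟧ ρ * ⟦ f ⟧ ρ
    ⟦ :- e   ⟧ ρ = - ⟦ e ⟧ ρ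

    normalForm : Expr n → Poly n
    normalForm (con c)  = κ c
    normalForm (var i)  = ι i
    normalForm (e :+ f) = normalForm e ⊞ normalForm f
    normalForm (e :* f) = normalForm e ⊠ normalForm f
    normalForm (:- e)   = ⊟ normalForm e

    normalForm-correct : ∀ (e : Expr n) ρ → ⟦ normalForm e ⟧ₚ ρ ≈ ⟦ e ⟧ ρ
    normalForm-correct (con c)  ρ = κ-hom c ρ
    normalForm-correct (var i)  ρ = ι-hom i ρ
    normalForm-correct (e :+ f) ρ = trans (⊞-hom (normalForm e) (normalForm f) ρ)
      (+-cong (normalForm-correct e ρ) (normalForm-correct f ρ))
    normalForm-correct (e :* f) ρ = trans (⊠-hom (normalForm e) (normalForm f) ρ)
      (*-cong (normalForm-correct e ρ) (normalForm-correct f ρ))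
    normalForm-correct (:- e)   ρ = trans (⊟-hom (normalForm e) ρ) (-‿cong (normalForm-correct e ρ))

    record Reify (ρ : Vec ℝ n) (t : ℝ) : Set where
      constructor reify
      field
        expr  : Expr n
        value : ⟦ expr ⟧ ρ ≈ t
    open Reify

    instance
      reify-+ : ⦃ Reify ρ a ⦄ → ⦃ Reify ρ b ⦄ → Reify ρ (a + b)
      reify-+ ⦃ reify e p ⦄ ⦃ reify f q ⦄ = reify (e :+ f) (+-cong p q)
      reify-* : ⦃ Reify ρ a ⦄ → ⦃ Reify ρ b ⦄ → Reify ρ (a * b)
      reify-* ⦃ reify e p ⦄ ⦃ reify f q ⦄ = reify (e :* f) (*-cong p q)
      reify-neg : ⦃ Reify ρ a ⦄ → Reify ρ (- a)
      reify-neg ⦃ reify e p ⦄ = reify (:- e) (-‿cong p)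
      reify-0 : Reify ρ 0#
      reify-0 = reify (con 0ℤ) refl
      reify-1 : Reify ρ 1#
      reify-1 = reify (con 1ℤ) (+-identityʳ 1#)

    WithAtoms : ∀ {m n} → Vec ℝ n → Vec ℝ m → Set → Set
    WithAtoms σ []       P = P
    WithAtoms σ (x ∷ xs) P = ⦃ Reify σ x ⦄ → WithAtoms σ xs P

    always : ∀ {m n} {σ : Vec ℝ n} (xs : Vec ℝ m) {P} → P → WithAtoms σ xs P
    always []       p = p
    always (x ∷ xs) p = always xs p

    -- The valuation `σ` is universally quantified, so that a reified term reaches its atoms only
    -- through the local instances; `instantiate` then puts `ρ` for `σ` and the i-th variable for
    -- the i-th atom.
    Reified : Vec ℝ n → (Vec ℝ n → Set) → Set
    Reified {n} ρ P = ∀ {σ : Vec ℝ n} → WithAtoms σ ρ (P σ)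

    instantiate : ∀ (ρ : Vec ℝ n) {P} → Reified ρ P → P ρ
    instantiate ρ f = supply ρ (λ i → reify (var i) refl) f
      where
      supply : ∀ {m} (xs : Vec ℝ m) → (∀ i → Reify ρ (lookup xs i)) → ∀ {P} → WithAtoms ρ xs P → P
      supply []       atoms p = p
      supply (x ∷ xs) atoms p = supply xs (atoms ∘ suc) (p ⦃ atoms zero ⦄)

    data Kind : Set where
      ≈0 ≥0 >0 : Kind

    Holds : Kind → ℝ → Set
    Holds ≈0 v = 0# ≈ v
    Holds ≥0 v = 0# ≤ v
    Holds >0 v = 0# < v

    Holds-resp : ∀ k → a ≈ b → Holds k a → Holds k b
    Holds-resp ≈0 a≈b p = trans p a≈b
    Holds-resp ≥0 a≈b p = ≤-resp refl a≈b p
    Holds-resp >0 a≈b (p , q) = ≤-resp refl a≈b p , λ 0≈b → q (trans 0≈b (sym a≈b))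

    infixl 5 _⊔ᵏ_ _⊕_
    infixl 6 _⊓ᵏ_ _⊗_
    infixr 7 _·_

    _⊔ᵏ_ _⊓ᵏ_ : Kind → Kind → Kind
    ≈0 ⊔ᵏ k = k
    ≥0 ⊔ᵏ >0 = >0
    ≥0 ⊔ᵏ k = ≥0
    >0 ⊔ᵏ k = >0
    ≈0 ⊓ᵏ k = ≈0
    ≥0 ⊓ᵏ ≈0 = ≈0
    ≥0 ⊓ᵏ k = ≥0
    >0 ⊓ᵏ k = k

    Holds-+ : ∀ k l → Holds k a → Holds l b → Holds (k ⊔ᵏ l) (a + b)
    Holds-+ ≈0 l p q = Holds-resp l (trans (sym (+-identityˡ _)) (+-congʳ p)) q
    Holds-+ ≥0 ≈0 p q = +-nonNeg p (≤-reflexive q)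
    Holds-+ ≥0 ≥0 p q = +-nonNeg p q
    Holds-+ ≥0 >0 p q = Holds-resp >0 (+-comm _ _) (+-pos-nonNeg q p)
    Holds-+ >0 ≈0 p q = +-pos-nonNeg p (≤-reflexive q)
    Holds-+ >0 ≥0 p q = +-pos-nonNeg p q
    Holds-+ >0 >0 p q = +-pos-nonNeg p (proj₁ q)

    Holds-* : ∀ k l → Holds k a → Holds l b → Holds (k ⊓ᵏ l) (a * b)
    Holds-* ≈0 l p q = trans (sym (zeroˡ _)) (*-congʳ p)
    Holds-* ≥0 ≈0 p q = trans (sym (zeroʳ _)) (*-congˡ q)
    Holds-* ≥0 ≥0 p q = *-nonNeg p q
    Holds-* ≥0 >0 p q = *-nonNeg p (proj₁ q)
    Holds-* >0 ≈0 p q = trans (sym (zeroʳ _)) (*-congˡ q)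
    Holds-* >0 ≥0 p q = *-nonNeg (proj₁ p) q
    Holds-* >0 >0 p q = *-pos p q

    -- Facts are closed under sums and products, as in a Positivstellensatz certificate. Keeping the
    -- expression beside the proof lets a combination be compared with the goal by normalising
    -- polynomials.
    record Fact (ρ : Vec ℝ n) (k : Kind) : Set where
      constructor fact
      field
        term  : Expr n
        holds : Holds k (⟦ term ⟧ ρ)

    _⊕_ : ∀ {k l} → Fact ρ k → Fact ρ l → Fact ρ (k ⊔ᵏ l)
    _⊕_ {k = k} {l} (fact e p) (fact f q) = fact (e :+ f) (Holds-+ k l p q)

    _⊗_ : ∀ {k l} → Fact ρ k → Fact ρ l → Fact ρ (k ⊓ᵏ l)
    _⊗_ {k = k} {l} (fact e p) (fact f q) = fact (e :* f) (Holds-* k l p q)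

    _·_ : ∀ t → ⦃ Reify ρ t ⦄ → Fact ρ ≈0 → Fact ρ ≈0
    _·_ t ⦃ reify f _ ⦄ (fact e p) = fact (f :* e) (trans (sym (zeroʳ _)) (*-congˡ p))

    eq : ⦃ Reify ρ a ⦄ → ⦃ Reify ρ b ⦄ → a ≈ b → Fact ρ ≈0
    eq ⦃ reify e p ⦄ ⦃ reify f q ⦄ a≈b = fact (f :+ :- e) (sym (≈⇒-≈0 (trans p (trans a≈b (sym q)))))

    le : ⦃ Reify ρ a ⦄ → ⦃ Reify ρ b ⦄ → a ≤ b → Fact ρ ≥0
    le ⦃ reify e p ⦄ ⦃ reify f q ⦄ a≤b = fact (f :+ :- e) (≤⇒0≤- (≤-resp (sym p) (sym q) a≤b))

    lt : ⦃ Reify ρ a ⦄ → ⦃ Reify ρ b ⦄ → a < b → Fact ρ >0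
    lt ⦃ reify e p ⦄ ⦃ reify f q ⦄ a<b =
      fact (f :+ :- e) (Holds-resp >0 (+-cong (sym q) (-‿cong (sym p))) (<⇒0<- a<b))

    sq : ∀ t → ⦃ Reify ρ t ⦄ → Fact ρ ≥0
    sq t ⦃ reify e p ⦄ = fact (e :* e) (0≤x*x _)

    none : Fact ρ ≈0
    none = fact (con 0ℤ) refl

    1+ : Fact ρ >0
    1+ = fact (con 1ℤ) (Holds-resp >0 (sym (+-identityʳ 1#)) 0<1)

    -- The integer is what remains of the goal after the combination of facts has been subtracted. A
    -- strict goal draws its strictness from a positive remainder or from a strict combination.
    admissible : Kind → Kind → ℤ → Bool
    admissible ≈0 ≈0 (+ 0) = true
    admissible ≈0 _ _ = false
    admissible ≥0 _ (+ _) = true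
    admissible ≥0 _ _ = false
    admissible >0 _ (+ suc _) = true
    admissible >0 >0 (+ 0) = true
    admissible >0 _ _ = false

    admissible-sound : ∀ goal k c → T (admissible goal k c) → Holds k a → Holds goal (fromℤ c + a)
    admissible-sound ≈0 ≈0 (+ 0) _ p = trans p (sym (+-identityˡ _))
    admissible-sound ≥0 ≈0 (+ m) _ p = +-nonNeg (fromℕ-nonNeg m) (≤-reflexive p)
    admissible-sound ≥0 ≥0 (+ m) _ p = +-nonNeg (fromℕ-nonNeg m) p
    admissible-sound ≥0 >0 (+ m) _ p = +-nonNeg (fromℕ-nonNeg m) (proj₁ p)
    admissible-sound >0 ≈0 (+ suc m) _ p = +-pos-nonNeg (fromℕ-pos m) (≤-reflexive p)
    admissible-sound >0 ≥0 (+ suc m) _ p = +-pos-nonNeg (fromℕ-pos m) p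
    admissible-sound >0 >0 (+ suc m) _ p = +-pos-nonNeg (fromℕ-pos m) (proj₁ p)
    admissible-sound >0 >0 (+ 0) _ p = Holds-resp >0 (sym (+-identityˡ _)) p

    certified : Kind → Kind → Poly n → Bool
    certified goal k (constant c ⊐ _)    = admissible goal k c
    certified goal k (nonconstant _ ⊐ _) = false

    certified-sound : ∀ goal k (p : Poly n) ρ → T (certified goal k p) → Holds k a → Holds goal (⟦ p ⟧ₚ ρ + a)
    certified-sound goal k (constant c ⊐ _) ρ t h = admissible-sound goal k c t h

    Certified : Kind → ∀ {k} (ρ : Vec ℝ n) → Reified ρ (λ σ → Fact σ k) →
                Reified ρ (λ σ → Reify σ a) → Reified ρ (λ σ → Reify σ b) → Set
    Certified goal {k} ρ h r s =
      T (certified goal k (normalForm ((expr (instantiate ρ s) :+ :- expr (instantiate ρ r)) :+ :- Fact.term (instantiate ρ h))))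

    prove : ∀ goal {k} (ρ : Vec ℝ n) (h : Reified ρ (λ σ → Fact σ k)) (r : Reified ρ (λ σ → Reify σ a)) (s : Reified ρ (λ σ → Reify σ b)) →
            Certified goal ρ h r s → Holds goal (b - a)
    prove goal {k} ρ h r s t = go (instantiate ρ h) (instantiate ρ r) (instantiate ρ s) t
      where
      go : (h : Fact ρ k) (r : Reify ρ a) (s : Reify ρ b) →
           T (certified goal k (normalForm ((expr s :+ :- expr r) :+ :- Fact.term h))) → Holds goal (b - a)
      go (fact e h) (reify f p) (reify g q) t = Holds-resp goal
        (trans (+-congʳ (normalForm-correct ((g :+ :- f) :+ :- e) ρ))
          (trans (+-assoc _ _ _) (trans (+-congˡ (-‿inverseˡ _)) (trans (+-identityʳ _) (+-cong q (-‿cong p))))))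
        (certified-sound goal k (normalForm ((g :+ :- f) :+ :- e)) ρ t h)

    -- The goal a R b follows from the fact h when b - a - h normalises to a
    -- suitable constant; the implicit certificate t is then solved as tt.
    module _ (ρ : Vec ℝ n) ⦃ r : Reified ρ (λ σ → Reify σ a) ⦄ ⦃ s : Reified ρ (λ σ → Reify σ b) ⦄ where

      ring≈ : {t : Certified ≈0 ρ (λ {σ} → always ρ (none {ρ = σ})) r s} → a ≈ b
      ring≈ {t} = -≈0⇒≈ (sym (prove ≈0 ρ (λ {σ} → always ρ (none {ρ = σ})) r s t))

      lin≈ : (h : Reified ρ (λ σ → Fact σ ≈0)) {t : Certified ≈0 ρ h r s} → a ≈ b
      lin≈ h {t} = -≈0⇒≈ (sym (prove ≈0 ρ h r s t))

      lin≤ : ∀ {k} (h : Reified ρ (λ σ → Fact σ k)) {t : Certified ≥0 ρ h r s} → a ≤ b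
      lin≤ h {t} = 0≤-⇒≤ (prove ≥0 ρ h r s t)

      lin< : ∀ {k} (h : Reified ρ (λ σ → Fact σ k)) {t : Certified >0 ρ h r s} → a < b
      lin< h {t} = 0<-⇒< (prove >0 ρ h r s t)

    -- The facts combine to a constant whose sign contradicts their kind; subtracting the
    -- combination from itself then yields 0 < 0.
    refute : ∀ (ρ : Vec ℝ n) {k} (h : Reified ρ (λ σ → Fact σ k)) →
             {t : T (certified >0 k (normalForm (:- Fact.term (instantiate ρ h))))} → ∀ {ℓ} {A : Set ℓ} → A
    refute ρ {k} h {t} = go (instantiate ρ h) t
      where
      go : (h : Fact ρ k) → T (certified >0 k (normalForm (:- Fact.term h))) → ∀ {ℓ} {A : Set ℓ} → A
      go (fact e h) t = ⊥-elim (proj₂ (Holds-resp >0 (trans (+-congʳ (normalForm-correct (:- e) ρ)) (-‿inverseˡ _))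
        (certified-sound >0 k (normalForm (:- e)) ρ t h)) refl)

  open LinearArithmetic

  -- Classical order, inverses, absolute values and minima.

  choose-spec : ∀ {A : Set} (d : A) (P : A → Set) → ∃ P → P (choose d P)
  choose-spec d P e with decide (∃ P)
  ... | yes (_ , p) = p
  ... | no ¬e       = ⊥-elim (¬e e)

  ≤-or-> : ∀ a b → a ≤ b ⊎ b < a
  ≤-or-> a b with total a b
  ... | inj₁ a≤b = inj₁ a≤b
  ... | inj₂ b≤a with decide (b ≈ a)
  ...   | yes b≈a = inj₁ (≤-reflexive (sym b≈a))
  ...   | no b≉a  = inj₂ (b≤a , b≉a)

  data Trichotomy (a b : ℝ) : Set where
    less    : a < b → Trichotomy a b
    equal   : a ≈ b → Trichotomy a b
    greater : b < a → Trichotomy a b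

  trichotomy : ∀ a b → Trichotomy a b
  trichotomy a b with ≤-or-> a b
  ... | inj₂ b<a = greater b<a
  ... | inj₁ a≤b with decide (a ≈ b)
  ...   | yes a≈b = equal a≈b
  ...   | no a≉b  = less (a≤b , a≉b)

  ≮⇒≥ : ∀ {a b} → ¬ a < b → b ≤ a
  ≮⇒≥ {a} {b} a≮b with ≤-or-> b a
  ... | inj₁ b≤a = b≤a
  ... | inj₂ a<b = ⊥-elim (a≮b a<b)

  ≰⇒> : ∀ {a b} → ¬ a ≤ b → b < a
  ≰⇒> {a} {b} a≰b with ≤-or-> a b
  ... | inj₁ a≤b = ⊥-elim (a≰b a≤b)
  ... | inj₂ b<a = b<a

  <⇒≤ : ∀ {a b} → a < b → a ≤ b
  <⇒≤ = proj₁

  <⇒≱ : ∀ {a b} → a < b → ¬ b ≤ a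
  <⇒≱ {a} {b} a<b b≤a = refute (a ∷ b ∷ []) (lt a<b ⊕ le b≤a)

  <-resp : ∀ {a b c d} → a ≈ c → b ≈ d → a < b → c < d
  <-resp {a} {b} {c} {d} p q r = lin< (a ∷ b ∷ c ∷ d ∷ []) (eq (sym p) ⊕ eq q ⊕ lt r)

  ≤-<-trans : ∀ {a b c} → a ≤ b → b < c → a < c
  ≤-<-trans {a} {b} {c} p q = lin< (a ∷ b ∷ c ∷ []) (le p ⊕ lt q)

  <-≤-trans : ∀ {a b c} → a < b → b ≤ c → a < c
  <-≤-trans {a} {b} {c} p q = lin< (a ∷ b ∷ c ∷ []) (lt p ⊕ le q)

  <⇒≉ : ∀ {a b} → a < b → ¬ b ≈ a
  <⇒≉ a<b b≈a = proj₂ a<b (sym b≈a)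

  ⁻¹-inverse : ∀ {x} → ¬ x ≈ 0# → x * x ⁻¹ ≈ 1#
  ⁻¹-inverse {x} x≉0 = choose-spec 0# (λ y → x * y ≈ 1#) (inverse x x≉0)

  ⁻¹-zero : ∀ {x} → x ≈ 0# → x ⁻¹ ≈ 0#
  ⁻¹-zero {x} x≈0 with decide (∃ λ y → x * y ≈ 1#)
  ... | yes (y , xy≈1) = ⊥-elim (0≉1 (lin≈ (x ∷ y ∷ []) (eq xy≈1 ⊕ y · eq (sym x≈0))))
  ... | no _           = refl

  ⁻¹-unique : ∀ {x y} → x * y ≈ 1# → x ⁻¹ ≈ y
  ⁻¹-unique {x} {y} xy≈1 = lin≈ (x ∷ x ⁻¹ ∷ y ∷ []) (y · eq xx⁻¹≈1 ⊕ x ⁻¹ · eq (sym xy≈1))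
    where
    xx⁻¹≈1 : x * x ⁻¹ ≈ 1#
    xx⁻¹≈1 = choose-spec 0# (λ z → x * z ≈ 1#) (y , xy≈1)

  -- A choice need not respect `≈`; uniqueness of inverses, and the common default at zero, make
  -- this one do so.
  ⁻¹-cong : ∀ {x y} → x ≈ y → x ⁻¹ ≈ y ⁻¹
  ⁻¹-cong {x} {y} x≈y with decide (x ≈ 0#)
  ... | yes x≈0 = trans (⁻¹-zero x≈0) (sym (⁻¹-zero (trans (sym x≈y) x≈0)))
  ... | no x≉0  = ⁻¹-unique (trans (*-congʳ x≈y) (⁻¹-inverse (x≉0 ∘ trans x≈y)))

  -- The default value makes this true at zero as well, so that 1 / δ can be read as a sine with no
  -- case distinction.
  ⁻¹-involutive : ∀ x → x ⁻¹ ⁻¹ ≈ x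
  ⁻¹-involutive x with decide (x ≈ 0#)
  ... | yes x≈0 = trans (⁻¹-zero (⁻¹-zero x≈0)) (sym x≈0)
  ... | no x≉0  = ⁻¹-unique (trans (*-comm _ _) (⁻¹-inverse x≉0))

  ⁻¹-pos : ∀ {x} → 0# < x → 0# < x ⁻¹
  ⁻¹-pos {x} 0<x with ≤-or-> (x ⁻¹) 0#
  ... | inj₂ p = p
  ... | inj₁ p = refute (x ∷ x ⁻¹ ∷ []) (lt 0<x ⊗ le p ⊕ eq (sym (⁻¹-inverse (<⇒≉ 0<x))))

  *-cancel-≈ : ∀ {x y z} → ¬ x ≈ 0# → x * y ≈ x * z → y ≈ z
  *-cancel-≈ {x} {y} {z} x≉0 p = lin≈ (x ∷ y ∷ z ∷ x ⁻¹ ∷ [])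
    (x ⁻¹ · eq p ⊕ z · eq (⁻¹-inverse x≉0) ⊕ y · eq (sym (⁻¹-inverse x≉0)))

  *-cancel-≤ : ∀ {x y z} → 0# < x → x * y ≤ x * z → y ≤ z
  *-cancel-≤ {x} {y} {z} 0<x p with ≤-or-> y z
  ... | inj₁ y≤z = y≤z
  ... | inj₂ z<y = refute (x ∷ y ∷ z ∷ []) (lt 0<x ⊗ lt z<y ⊕ le p)

  *-≉0 : ∀ {x y} → ¬ x ≈ 0# → ¬ y ≈ 0# → ¬ x * y ≈ 0#
  *-≉0 x≉0 y≉0 p = y≉0 (*-cancel-≈ x≉0 (trans p (sym (zeroʳ _))))

  x*x≈0⇒x≈0 : ∀ {x} → x * x ≈ 0# → x ≈ 0#
  x*x≈0⇒x≈0 {x} p with decide (x ≈ 0#)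
  ... | yes x≈0 = x≈0
  ... | no x≉0  = ⊥-elim (*-≉0 x≉0 x≉0 p)

  square-cancel-≤ : ∀ {x y} → 0# ≤ y → x * x ≤ y * y → x ≤ y
  square-cancel-≤ {x} {y} 0≤y p with ≤-or-> x y
  ... | inj₁ x≤y = x≤y
  ... | inj₂ y<x = refute (x ∷ y ∷ []) (le p ⊕ (lt y<x ⊕ le 0≤y) ⊗ lt y<x ⊕ le 0≤y ⊗ lt y<x)

  half : ℝ
  half = (1# + 1#) ⁻¹

  half+half : half + half ≈ 1#
  half+half = lin≈ (half ∷ []) (eq (⁻¹-inverse {1# + 1#} (<⇒≉ 0<2)))
    where
    0<2 : 0# < 1# + 1#
    0<2 = lin< [] 1+

  0<half : 0# < half
  0<half = ⁻¹-pos (lin< [] 1+)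

  half-pos : ∀ {x} → 0# < x → 0# < x * half
  half-pos {x} 0<x = lin< (x ∷ half ∷ []) (lt 0<x ⊗ lt 0<half)

  half-< : ∀ {x} → 0# < x → x * half < x
  half-< {x} 0<x = lin< (x ∷ half ∷ []) (lt 0<x ⊗ lt 0<half ⊕ x · eq half+half)

  +-half-< : ∀ x {y} → 0# < y → x + y * half < x + y
  +-half-< x {y} 0<y = lin< (x ∷ y ∷ half ∷ []) (lt (half-< 0<y))

  <-+-half : ∀ x {y} → 0# < y → x < x + y * half
  <-+-half x {y} 0<y = lin< (x ∷ y ∷ half ∷ []) (lt (half-pos 0<y))

  data AbsCases (x : ℝ) : Set where
    nonNegative : 0# ≤ x → ∣ x ∣ ≈ x → AbsCases x
    nonPositive : x ≤ 0# → ∣ x ∣ ≈ - x → AbsCases x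

  absCases : ∀ x → AbsCases x
  absCases x with total 0# x in p
  ... | inj₁ q = nonNegative q (reflexive (≡.cong [ const x , const (- x) ]′ p))
  ... | inj₂ q = nonPositive q (reflexive (≡.cong [ const x , const (- x) ]′ p))

  0≤∣_∣ : ∀ x → 0# ≤ ∣ x ∣
  0≤∣ x ∣ with absCases x
  ... | nonNegative p q = lin≤ (x ∷ ∣ x ∣ ∷ []) (le p ⊕ eq (sym q))
  ... | nonPositive p q = lin≤ (x ∷ ∣ x ∣ ∷ []) (le p ⊕ eq (sym q))

  x≤∣x∣ : ∀ x → x ≤ ∣ x ∣
  x≤∣x∣ x with absCases x
  ... | nonNegative p q = ≤-reflexive (sym q)
  ... | nonPositive p q = lin≤ (x ∷ ∣ x ∣ ∷ []) (le p ⊕ le p ⊕ eq (sym q))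

  -x≤∣x∣ : ∀ x → - x ≤ ∣ x ∣
  -x≤∣x∣ x with absCases x
  ... | nonNegative p q = lin≤ (x ∷ ∣ x ∣ ∷ []) (le p ⊕ le p ⊕ eq (sym q))
  ... | nonPositive p q = ≤-reflexive (sym q)

  ∣∣-≤ : ∀ {x c} → x ≤ c → - x ≤ c → ∣ x ∣ ≤ c
  ∣∣-≤ {x} p q with absCases x
  ... | nonNegative _ r = ≤-resp (sym r) refl p
  ... | nonPositive _ r = ≤-resp (sym r) refl q

  ∣∣-< : ∀ {x c} → x < c → - x < c → ∣ x ∣ < c
  ∣∣-< {x} p q with absCases x
  ... | nonNegative _ r = <-resp (sym r) refl p
  ... | nonPositive _ r = <-resp (sym r) refl q

  -- The case split inside `∣_∣` may go differently for equal arguments, hence the detour through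
  -- inequalities.
  ∣∣-cong : ∀ {x y} → x ≈ y → ∣ x ∣ ≈ ∣ y ∣
  ∣∣-cong {x} {y} p = antisym (half-way p) (half-way (sym p))
    where
    half-way : ∀ {x y} → x ≈ y → ∣ x ∣ ≤ ∣ y ∣
    half-way {x} {y} p = ∣∣-≤ (≤-resp (sym p) refl (x≤∣x∣ y)) (≤-resp (-‿cong (sym p)) refl (-x≤∣x∣ y))

  0≤⇒∣x∣≈x : ∀ {x} → 0# ≤ x → ∣ x ∣ ≈ x
  0≤⇒∣x∣≈x {x} p = antisym (∣∣-≤ ≤-refl (lin≤ (x ∷ []) (le p ⊕ le p))) (x≤∣x∣ x)

  ≤0⇒∣x∣≈-x : ∀ {x} → x ≤ 0# → ∣ x ∣ ≈ - x
  ≤0⇒∣x∣≈-x {x} p = antisym (∣∣-≤ (lin≤ (x ∷ []) (le p ⊕ le p)) ≤-refl) (-x≤∣x∣ x)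

  ∣-x∣≈∣x∣ : ∀ x → ∣ - x ∣ ≈ ∣ x ∣
  ∣-x∣≈∣x∣ x = antisym (∣∣-≤ (-x≤∣x∣ x) (lin≤ (x ∷ ∣ x ∣ ∷ []) (le (x≤∣x∣ x))))
    (∣∣-≤ (lin≤ (x ∷ ∣ - x ∣ ∷ []) (le (-x≤∣x∣ (- x)))) (x≤∣x∣ (- x)))

  ∣x-y∣≈∣y-x∣ : ∀ x y → ∣ x - y ∣ ≈ ∣ y - x ∣
  ∣x-y∣≈∣y-x∣ x y = trans (∣∣-cong (ring≈ (x ∷ y ∷ []))) (∣-x∣≈∣x∣ (y - x))

  ∣∣-triangle : ∀ x y → ∣ x + y ∣ ≤ ∣ x ∣ + ∣ y ∣
  ∣∣-triangle x y = ∣∣-≤ (lin≤ (x ∷ y ∷ ∣ x ∣ ∷ ∣ y ∣ ∷ []) (le (x≤∣x∣ x) ⊕ le (x≤∣x∣ y)))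
    (lin≤ (x ∷ y ∷ ∣ x ∣ ∷ ∣ y ∣ ∷ []) (le (-x≤∣x∣ x) ⊕ le (-x≤∣x∣ y)))

  ∣∣-* : ∀ x y → ∣ x * y ∣ ≈ ∣ x ∣ * ∣ y ∣
  ∣∣-* x y with absCases x | absCases y
  ... | nonNegative p q | nonNegative r s = trans (0≤⇒∣x∣≈x (*-nonNeg p r)) (*-cong (sym q) (sym s))
  ... | nonNegative p q | nonPositive r s = trans (≤0⇒∣x∣≈-x (lin≤ (x ∷ y ∷ []) (le p ⊗ le r)))
    (trans (ring≈ (x ∷ y ∷ [])) (*-cong (sym q) (sym s)))
  ... | nonPositive p q | nonNegative r s = trans (≤0⇒∣x∣≈-x (lin≤ (x ∷ y ∷ []) (le p ⊗ le r)))
    (trans (ring≈ (x ∷ y ∷ [])) (*-cong (sym q) (sym s)))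
  ... | nonPositive p q | nonPositive r s = trans (0≤⇒∣x∣≈x (lin≤ (x ∷ y ∷ []) (le p ⊗ le r)))
    (trans (ring≈ (x ∷ y ∷ [])) (*-cong (sym q) (sym s)))

  ∣x∣≤0⇒x≈0 : ∀ {x} → ∣ x ∣ ≤ 0# → x ≈ 0#
  ∣x∣≤0⇒x≈0 {x} p = antisym (≤-trans (x≤∣x∣ x) p) (lin≤ (x ∷ ∣ x ∣ ∷ []) (le (-x≤∣x∣ x) ⊕ le p))

  ∣x∣*∣x∣ : ∀ x → ∣ x ∣ * ∣ x ∣ ≈ x * x
  ∣x∣*∣x∣ x = trans (sym (∣∣-* x x)) (0≤⇒∣x∣≈x (0≤x*x x))

  ≉0⇒0<∣x∣ : ∀ {x} → ¬ x ≈ 0# → 0# < ∣ x ∣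
  ≉0⇒0<∣x∣ {x} x≉0 = ≰⇒> λ p → x≉0 (∣x∣≤0⇒x≈0 p)

  -- Compare squares: the mixed terms agree because |a| |b| = a b when this product is nonnegative.
  ∣∣-additive : ∀ {a b} → 0# ≤ a * b → ∣ a + b ∣ ≈ ∣ a ∣ + ∣ b ∣
  ∣∣-additive {a} {b} 0≤ab = antisym (∣∣-triangle a b) (square-cancel-≤ 0≤∣ a + b ∣
    (lin≤ (a ∷ b ∷ ∣ a ∣ ∷ ∣ b ∣ ∷ ∣ a + b ∣ ∷ [])
      (eq (∣x∣*∣x∣ a) ⊕ eq (∣x∣*∣x∣ b) ⊕ eq (sym (∣x∣*∣x∣ (a + b)))
        ⊕ eq (trans (sym (∣∣-* a b)) (0≤⇒∣x∣≈x 0≤ab)) ⊕ eq (trans (sym (∣∣-* a b)) (0≤⇒∣x∣≈x 0≤ab)))))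

  min : ℝ → ℝ → ℝ
  min a b with ≤-or-> a b
  ... | inj₁ _ = a
  ... | inj₂ _ = b

  min-≤ˡ : ∀ a b → min a b ≤ a
  min-≤ˡ a b with ≤-or-> a b
  ... | inj₁ _ = ≤-refl
  ... | inj₂ p = <⇒≤ p

  min-≤ʳ : ∀ a b → min a b ≤ b
  min-≤ʳ a b with ≤-or-> a b
  ... | inj₁ p = p
  ... | inj₂ _ = ≤-refl

  min-glb-< : ∀ {a b c} → c < a → c < b → c < min a b
  min-glb-< {a} {b} p q with ≤-or-> a b
  ... | inj₁ _ = p
  ... | inj₂ _ = q

  min-glb : ∀ {a b c} → c ≤ a → c ≤ b → c ≤ min a b
  min-glb {a} {b} p q with ≤-or-> a b
  ... | inj₁ _ = p
  ... | inj₂ _ = q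

  positiveLowerBound : ∀ {n} (f : Fin n → ℝ) → (∀ i → 0# < f i) → ∃ λ η → 0# < η × (∀ i → η ≤ f i)
  positiveLowerBound {zero}  f p = 1# , 0<1 , λ ()
  positiveLowerBound {suc n} f p =
    let η , 0<η , q = positiveLowerBound (f ∘ suc) (p ∘ suc) in
    min (f zero) η , min-glb-< (p zero) 0<η ,
    λ { zero → min-≤ˡ (f zero) η ; (suc i) → ≤-trans (min-≤ʳ (f zero) η) (q i) }

  argmax : ∀ {n} (f : Fin (suc n) → ℝ) → ∃ λ i → ∀ j → f j ≤ f i
  argmax {zero}  f = zero , λ { zero → ≤-refl }
  argmax {suc n} f with argmax (f ∘ suc)
  ... | i , p with ≤-or-> (f (suc i)) (f zero)
  ...   | inj₁ q = zero  , λ { zero → ≤-refl ; (suc j) → ≤-trans (p j) q }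
  ...   | inj₂ q = suc i , λ { zero → <⇒≤ q  ; (suc j) → p j }

  -- Integers, the Archimedean property and rounding.

  fromℤ-mono-≤ : ∀ {i j} → i ℤ.≤ j → fromℤ i ≤ fromℤ j
  fromℤ-mono-≤ {i} {j} i≤j = 0≤-⇒≤ (≤-resp refl
    (trans (fromℤ-+ j (ℤ.- i)) (+-congˡ (fromℤ-neg i))) (go (ℤₚ.i≤j⇒0≤j-i i≤j)))
    where
    go : ∀ {k} → 0ℤ ℤ.≤ k → 0# ≤ fromℤ k
    go (ℤ.+≤+ {n = n} _) = fromℕ-nonNeg n

  fromℤ-cancel-≤ : ∀ {i j} → fromℤ i ≤ fromℤ j → i ℤ.≤ j
  fromℤ-cancel-≤ {i} {j} p with i ℤₚ.≤? j
  ... | yes i≤j = i≤j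
  ... | no i≰j  = refute (fromℤ i ∷ fromℤ j ∷ []) (le p ⊕ le 1+j≤i ⊕ 1+)
    where
    1+j≤i : 1# + fromℤ j ≤ fromℤ i
    1+j≤i = ≤-resp (trans (fromℤ-+ 1ℤ j) (+-congʳ (+-identityʳ 1#))) refl
      (fromℤ-mono-≤ {ℤ.suc j} {i} (ℤₚ.i<j⇒suc[i]≤j (ℤₚ.≰⇒> i≰j)))

  fromℤ-injective : ∀ {i j} → fromℤ i ≈ fromℤ j → i ≡ j
  fromℤ-injective p = ℤₚ.≤-antisym (fromℤ-cancel-≤ (≤-reflexive p)) (fromℤ-cancel-≤ (≤-reflexive (sym p)))

  IsInteger : ℝ → Set
  IsInteger x = ∃ λ i → x ≈ fromℤ i

  isInteger-resp : ∀ {x y} → x ≈ y → IsInteger x → IsInteger y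
  isInteger-resp x≈y (i , p) = i , trans (sym x≈y) p

  isInteger-neg : ∀ {x} → IsInteger x → IsInteger (- x)
  isInteger-neg (i , p) = ℤ.- i , trans (-‿cong p) (sym (fromℤ-neg i))

  isInteger-+ : ∀ {x y} → IsInteger x → IsInteger y → IsInteger (x + y)
  isInteger-+ (i , p) (j , q) = i ℤ.+ j , trans (+-cong p q) (sym (fromℤ-+ i j))

  isInteger-1 : IsInteger 1#
  isInteger-1 = 1ℤ , sym (+-identityʳ 1#)

  integer-< : ∀ {x y} → IsInteger x → IsInteger y → x < y → x + 1# ≤ y
  integer-< {x} {y} (i , p) (j , q) x<y = ≤-resp
    (trans (trans (fromℤ-+ 1ℤ i) (+-cong (+-identityʳ 1#) (sym p))) (+-comm 1# x)) (sym q)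
    (fromℤ-mono-≤ {ℤ.suc i} {j} (ℤₚ.i<j⇒suc[i]≤j (ℤₚ.≰⇒> λ j≤i →
      <⇒≱ x<y (≤-resp (sym q) (sym p) (fromℤ-mono-≤ {j} {i} j≤i)))))

  integer-<+1 : ∀ {x y} → IsInteger x → IsInteger y → x < y + 1# → x ≤ y
  integer-<+1 {x} {y} p q r = lin≤ (x ∷ y ∷ []) (le (integer-< p (isInteger-+ q isInteger-1) r))

  -- If x bounded the naturals they would have a supremum s; but n + 1 ≤ s for all n makes s - 1 an
  -- upper bound too.
  archimedean : ∀ x → ∃ λ n → x ≤ fromℕ n
  archimedean x with decide (∃ λ n → x ≤ fromℕ n)
  ... | yes p = p
  ... | no ¬p =
    let s , ub , least = complete (λ y → ∃ λ n → y ≈ fromℕ n) (0# , 0 , refl)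
          (x , λ { y (n , y≈n) → ≤-resp (sym y≈n) refl (<⇒≤ (≰⇒> λ x≤n → ¬p (n , x≤n))) })
    in refute (s ∷ []) (le (least (s - 1#) λ { y (n , y≈n) →
         lin≤ (s ∷ y ∷ fromℕ n ∷ []) (eq y≈n ⊕ le (ub (fromℕ (suc n)) (suc n , refl))) }) ⊕ 1+)

  -- The search goes down from i + k until the next lower integer falls below t; it ends at the
  -- latest at i + 1, since i < t.
  ceiling-search : ∀ t i → fromℤ i < t → ∀ k → t ≤ fromℤ i + fromℕ k → ∃ λ j → t ≤ fromℤ j × fromℤ j < t + 1#
  ceiling-search t i i<t zero    p = refute (t ∷ fromℤ i ∷ []) (le p ⊕ lt i<t)
  ceiling-search t i i<t (suc k) p with ≤-or-> t (fromℤ i + fromℕ k)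
  ... | inj₁ q = ceiling-search t i i<t k q
  ... | inj₂ q = i ℤ.+ + suc k ,
    ≤-resp refl (sym (fromℤ-+ i (+ suc k))) p ,
    <-resp (sym (fromℤ-+ i (+ suc k))) refl (lin< (t ∷ fromℤ i ∷ fromℕ k ∷ []) (lt q))

  ceiling-exists : ∀ t → ∃ λ i → t ≤ fromℤ i × fromℤ i < t + 1#
  ceiling-exists t =
    let m , p = archimedean (- t)
        k , q = archimedean (t - fromℤ -[1+ m ])
    in ceiling-search t -[1+ m ] (below m p) k (above -[1+ m ] k q)
    where
    below : ∀ m → - t ≤ fromℕ m → fromℤ -[1+ m ] < t
    below m p = lin< (t ∷ fromℕ m ∷ []) (le p ⊕ 1+)
    above : ∀ i k → t - fromℤ i ≤ fromℕ k → t ≤ fromℤ i + fromℕ k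
    above i k q = lin≤ (t ∷ fromℤ i ∷ fromℕ k ∷ []) (le q)

  up : ℝ → ℝ
  up t = fromℤ ⌈ t ⌉

  up-spec : ∀ t → t ≤ up t × up t < t + 1#
  up-spec t = proj₁ spec , ≤-<-trans (fromℤ-mono-≤ (proj₂ spec i t≤i)) i<t+1
    where
    i : ℤ
    i     = proj₁ (ceiling-exists t)
    t≤i : t ≤ fromℤ i
    t≤i   = proj₁ (proj₂ (ceiling-exists t))
    i<t+1 : fromℤ i < t + 1#
    i<t+1 = proj₂ (proj₂ (ceiling-exists t))
    spec : t ≤ fromℤ ⌈ t ⌉ × (∀ m → t ≤ fromℤ m → ⌈ t ⌉ ℤ.≤ m)
    spec  = choose-spec 0ℤ (λ n → t ≤ fromℤ n × (∀ m → t ≤ fromℤ m → n ℤ.≤ m))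
      (i , t≤i , λ m t≤m → fromℤ-cancel-≤ (integer-<+1 (i , refl) (m , refl)
        (lin< (fromℤ i ∷ fromℤ m ∷ t ∷ []) (lt i<t+1 ⊕ le t≤m))))

  up-isInteger : ∀ t → IsInteger (up t)
  up-isInteger t = ⌈ t ⌉ , refl

  t≤up : ∀ t → t ≤ up t
  t≤up t = proj₁ (up-spec t)

  up<t+1 : ∀ t → up t < t + 1#
  up<t+1 t = proj₂ (up-spec t)

  abstract
    -- The floor, obtained from the ceiling by reflection.
    dn : ℝ → ℝ
    dn t = - fromℤ ⌈ - t ⌉

    dn-isInteger : ∀ t → IsInteger (dn t)
    dn-isInteger t = isInteger-neg (up-isInteger (- t))

    dn≤t : ∀ t → dn t ≤ t
    dn≤t t = lin≤ (t ∷ fromℤ ⌈ - t ⌉ ∷ []) (le (t≤up (- t)))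

    t<dn+1 : ∀ t → t < dn t + 1#
    t<dn+1 t = lin< (t ∷ fromℤ ⌈ - t ⌉ ∷ []) (lt (up<t+1 (- t)))

  up-least : ∀ {t n} → IsInteger n → t ≤ n → up t ≤ n
  up-least {t} {n} int t≤n = integer-<+1 (up-isInteger t) int
    (lin< (up t ∷ t ∷ n ∷ []) (lt (up<t+1 t) ⊕ le t≤n))

  dn-greatest : ∀ {t n} → IsInteger n → n ≤ t → n ≤ dn t
  dn-greatest {t} {n} int n≤t = integer-<+1 int (dn-isInteger t)
    (lin< (dn t ∷ t ∷ n ∷ []) (lt (t<dn+1 t) ⊕ le n≤t))

  up-unique : ∀ {t n} → IsInteger n → t ≤ n → n < t + 1# → up t ≈ n
  up-unique {t} {n} int p q = antisym (up-least int p)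
    (integer-<+1 int (up-isInteger t) (lin< (up t ∷ t ∷ n ∷ []) (lt q ⊕ le (t≤up t))))

  -- Finite sums.

  open CommutativeMonoidSum +-commutativeMonoid public using (sum-cong-≋; ∑-distrib-+; ∑-comm)
  open SemiringSum semiring public using (*-distribˡ-sum; *-distribʳ-sum)

  sum-zero : ∀ {n} {f : Fin n → ℝ} → (∀ i → f i ≈ 0#) → sum f ≈ 0#
  sum-zero {zero}  p = refl
  sum-zero {suc n} p = trans (+-cong (p zero) (sum-zero (p ∘ suc))) (+-identityʳ 0#)

  sum-mono : ∀ {n} {f g : Fin n → ℝ} → (∀ i → f i ≤ g i) → sum f ≤ sum g
  sum-mono {zero}          p = ≤-refl
  sum-mono {suc n} {f} {g} p = lin≤ (f zero ∷ g zero ∷ sum (f ∘ suc) ∷ sum (g ∘ suc) ∷ [])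
    (le (p zero) ⊕ le (sum-mono (p ∘ suc)))

  sum-nonNeg : ∀ {n} {f : Fin n → ℝ} → (∀ i → 0# ≤ f i) → 0# ≤ sum f
  sum-nonNeg {zero}      p = ≤-refl
  sum-nonNeg {suc n} {f} p = +-nonNeg (p zero) (sum-nonNeg (p ∘ suc))

  term≤sum : ∀ {n} {f : Fin n → ℝ} → (∀ i → 0# ≤ f i) → ∀ i → f i ≤ sum f
  term≤sum {suc n} {f} p zero    = lin≤ (f zero ∷ sum (f ∘ suc) ∷ []) (le (sum-nonNeg (p ∘ suc)))
  term≤sum {suc n} {f} p (suc i) = lin≤ (f zero ∷ f (suc i) ∷ sum (f ∘ suc) ∷ [])
    (le (p zero) ⊕ le (term≤sum (p ∘ suc) i))

  sum-neg : ∀ {n} (f : Fin n → ℝ) → sum (λ i → - f i) ≈ - sum f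
  sum-neg {zero}  f = ring≈ []
  sum-neg {suc n} f = lin≈ (f zero ∷ sum (f ∘ suc) ∷ sum (λ i → - f (suc i)) ∷ []) (eq (sum-neg (f ∘ suc)))

  sum-sub : ∀ {n} (f g : Fin n → ℝ) → sum (λ i → f i - g i) ≈ sum f - sum g
  sum-sub f g = trans (∑-distrib-+ f (λ i → - g i)) (+-congˡ (sum-neg g))

  ∣sum∣≤sum∣∣ : ∀ {n} (f : Fin n → ℝ) → ∣ sum f ∣ ≤ sum (λ i → ∣ f i ∣)
  ∣sum∣≤sum∣∣ {zero}  f = ∣∣-≤ ≤-refl (lin≤ [] none)
  ∣sum∣≤sum∣∣ {suc n} f = ≤-trans (∣∣-triangle (f zero) (sum (f ∘ suc)))
    (lin≤ (∣ f zero ∣ ∷ ∣ sum (f ∘ suc) ∣ ∷ sum (λ i → ∣ f (suc i) ∣) ∷ []) (le (∣sum∣≤sum∣∣ (f ∘ suc))))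

  sum-const : ∀ n c → sum {n} (λ _ → c) ≈ fromℕ n * c
  sum-const zero    c = sym (zeroˡ c)
  sum-const (suc n) c = lin≈ (c ∷ fromℕ n ∷ sum {n} (λ _ → c) ∷ []) (eq (sum-const n c))

  indicator : ∀ {n} → Fin n → Fin n → ℝ
  indicator a j = if does (a Fin.≟ j) then 1# else 0#

  sum-indicator : ∀ {n} (a : Fin n) → sum (indicator a) ≈ 1#
  sum-indicator {suc n} zero    = trans (+-congˡ (sum-zero {n} (λ i → refl))) (+-identityʳ 1#)
  sum-indicator {suc n} (suc a) = trans (+-identityˡ _) (sum-indicator a)

  indicator-nonNeg : ∀ {n} (a j : Fin n) → 0# ≤ indicator a j
  indicator-nonNeg a j with does (a Fin.≟ j)
  ... | true  = <⇒≤ 0<1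
  ... | false = ≤-refl

  indicator-refl : ∀ {n} (a : Fin n) → indicator a a ≈ 1#
  indicator-refl a with a Fin.≟ a
  ... | yes _  = refl
  ... | no a≢a = ⊥-elim (a≢a ≡.refl)

  indicator-≢ : ∀ {n} {a j : Fin n} → a ≢ j → indicator a j ≈ 0#
  indicator-≢ {a = a} {j} a≢j with a Fin.≟ j
  ... | yes a≡j = ⊥-elim (a≢j a≡j)
  ... | no _    = refl

  -- Passage from local to global on an interval.

  module _ (a b : ℝ) (a≤b : a ≤ b) (R : ℝ → ℝ → Set) (R-trans : ∀ {s t u} → R s t → R t u → R s u)
           (local : ∀ t → a ≤ t → t ≤ b → ∃ λ δ → 0# < δ ×
             (∀ s → a ≤ s → s ≤ b → (t - δ < s → s ≤ t → R s t) × (t ≤ s → s < t + δ → R t s))) where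

    -- A transitive relation holding between all close enough points of
    -- [a, b] holds between a and b: take the supremum of the points
    -- related to a.
    local⇒global : R a b
    local⇒global =
      let σ , ub , least = complete Reached (a , a-reached) (b , λ t r → proj₂ (proj₁ r))
          a≤σ = ub a a-reached
          σ≤b = least b (λ t r → proj₂ (proj₁ r))
          δ , 0<δ , near = local σ a≤σ σ≤b
      in conclude σ δ ub least 0<δ a≤σ σ≤b near
      where
      Reached : ℝ → Set
      Reached t = (a ≤ t × t ≤ b) × R a t

      a-reached : Reached a
      a-reached = (≤-refl , a≤b) , near-a (local a ≤-refl a≤b)
        where
        near-a : _ → R a a
        near-a (δ , 0<δ , near) = proj₁ (near a ≤-refl a≤b) (lin< (a ∷ δ ∷ []) (lt 0<δ)) ≤-refl

      near-supremum : ∀ σ δ → (∀ c → IsUpperBound Reached c → σ ≤ c) → 0# < δ → ∃ λ t → Reached t × σ - δ < t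
      near-supremum σ δ least 0<δ with decide (∃ λ t → Reached t × σ - δ < t)
      ... | yes r = r
      ... | no ¬r = refute (σ ∷ δ ∷ []) (lt 0<δ ⊕ le (least (σ - δ) (λ t r → ≮⇒≥ (λ p → ¬r (t , r , p)))))

      conclude : ∀ σ δ → IsUpperBound Reached σ → (∀ c → IsUpperBound Reached c → σ ≤ c) → 0# < δ →
                 a ≤ σ → σ ≤ b →
                 (∀ s → a ≤ s → s ≤ b → (σ - δ < s → s ≤ σ → R s σ) × (σ ≤ s → s < σ + δ → R σ s)) → R a b
      conclude σ δ ub least 0<δ a≤σ σ≤b near = finish (≤-or-> b σ) (near-supremum σ δ least 0<δ)
        where
        finish : b ≤ σ ⊎ σ < b → (∃ λ t → Reached t × σ - δ < t) → R a b
        finish b≤σ⊎σ<b (t , r@((a≤t , t≤b) , R-at) , σ-δ<t) = extend b≤σ⊎σ<b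
          where
          R-aσ : R a σ
          R-aσ = R-trans R-at (proj₁ (near t a≤t t≤b) σ-δ<t (ub t r))
          extend : b ≤ σ ⊎ σ < b → R a b
          extend (inj₁ b≤σ) =
            R-trans R-aσ (proj₂ (near b a≤b ≤-refl) σ≤b (lin< (b ∷ σ ∷ δ ∷ []) (le b≤σ ⊕ lt 0<δ)))
          extend (inj₂ σ<b) = ⊥-elim (<⇒≱ σ<s (ub s ((a≤s , min-≤ˡ _ _) ,
            R-trans R-aσ (proj₂ (near s a≤s (min-≤ˡ _ _)) (<⇒≤ σ<s)
              (≤-<-trans (min-≤ʳ b _) (+-half-< σ 0<δ))))))
            where
            s = min b (σ + δ * half)
            σ<s : σ < s
            σ<s = min-glb-< σ<b (<-+-half σ 0<δ)
            a≤s : a ≤ s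
            a≤s = ≤-trans a≤σ (<⇒≤ σ<s)

  ∣∣-+-≤ : ∀ {x y a b} → ∣ x ∣ ≤ a → ∣ y ∣ ≤ b → ∣ x + y ∣ ≤ a + b
  ∣∣-+-≤ {x} {y} {a} {b} p q = ≤-trans (∣∣-triangle x y) (lin≤ (∣ x ∣ ∷ ∣ y ∣ ∷ a ∷ b ∷ []) (le p ⊕ le q))

  ∣∣-*-≤ : ∀ {x y a b} → ∣ x ∣ ≤ a → ∣ y ∣ ≤ b → ∣ x * y ∣ ≤ a * b
  ∣∣-*-≤ {x} {y} {a} {b} p q = ≤-trans (≤-reflexive (∣∣-* x y)) (lin≤ (∣ x ∣ ∷ ∣ y ∣ ∷ a ∷ b ∷ [])
    (le p ⊗ (le 0≤∣ y ∣ ⊕ le q) ⊕ le 0≤∣ x ∣ ⊗ le q))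

  ∣∣-≤ˡ : ∀ {x c} → ∣ x ∣ ≤ c → x ≤ c
  ∣∣-≤ˡ {x} = ≤-trans (x≤∣x∣ x)

  ∣∣-≤ʳ : ∀ {x c} → ∣ x ∣ ≤ c → - x ≤ c
  ∣∣-≤ʳ {x} = ≤-trans (-x≤∣x∣ x)

  ∣∣-<ˡ : ∀ {x c} → ∣ x ∣ < c → x < c
  ∣∣-<ˡ {x} = ≤-<-trans (x≤∣x∣ x)

  ∣∣-<ʳ : ∀ {x c} → ∣ x ∣ < c → - x < c
  ∣∣-<ʳ {x} = ≤-<-trans (-x≤∣x∣ x)

  -- Limits and series.

  ≤-by-ε : ∀ {x y} → (∀ e → 0# < e → x ≤ y + e) → x ≤ y
  ≤-by-ε {x} {y} p with ≤-or-> x y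
  ... | inj₁ x≤y = x≤y
  ... | inj₂ y<x = refute (x ∷ y ∷ half ∷ []) (le (p ((x - y) * half) (half-pos 0<x-y))
                     ⊕ lt 0<x-y ⊗ lt 0<half ⊕ (x - y) · eq half+half)
    where
    0<x-y : 0# < x - y
    0<x-y = <⇒0<- y<x

  ⟶-cong : ∀ {s t l} → (∀ n → s n ≈ t n) → s ⟶ l → t ⟶ l
  ⟶-cong {s} {t} {l} p s⟶l e 0<e = let M , q = s⟶l e 0<e in M , λ n M≤n → <-resp (∣∣-cong (+-congʳ (p n))) refl (q n M≤n)

  ⟶-≤ : ∀ {s l c} → (∀ n → s n ≤ c) → s ⟶ l → l ≤ c
  ⟶-≤ {s} {l} {c} p s⟶l = ≤-by-ε λ e 0<e →
    let M , q = s⟶l e 0<e in lin≤ (s M ∷ l ∷ c ∷ e ∷ []) (le (p M) ⊕ lt (∣∣-<ʳ (q M ℕₚ.≤-refl)))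

  ⟶-neg : ∀ {s l} → s ⟶ l → (λ n → - s n) ⟶ (- l)
  ⟶-neg {s} {l} s⟶l e 0<e = let M , q = s⟶l e 0<e in M , λ n M≤n → <-resp (trans (sym (∣-x∣≈∣x∣ _)) (∣∣-cong (ring≈ (s n ∷ l ∷ [])))) refl (q n M≤n)

  ⟶-+ : ∀ {s t l m} → s ⟶ l → t ⟶ m → (λ n → s n + t n) ⟶ (l + m)
  ⟶-+ {s} {t} {l} {m} s⟶l t⟶m e 0<e =
    let M , p = s⟶l (e * half) (half-pos 0<e)
        M′ , q = t⟶m (e * half) (half-pos 0<e)
    in M ℕ.⊔ M′ , λ n M≤n → close n (p n (ℕₚ.≤-trans (ℕₚ.m≤m⊔n M M′) M≤n)) (q n (ℕₚ.≤-trans (ℕₚ.m≤n⊔m M M′) M≤n))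
    where
    close : ∀ n → ∣ s n - l ∣ < e * half → ∣ t n - m ∣ < e * half → ∣ (s n + t n) - (l + m) ∣ < e
    close n p q = <-resp (∣∣-cong (ring≈ (s n ∷ t n ∷ l ∷ m ∷ []))) refl
      (≤-<-trans (∣∣-triangle (s n - l) (t n - m)) (halves p q))
      where
      halves : ∀ {x y} → x < e * half → y < e * half → x + y < e
      halves {x} {y} p q = lin< (x ∷ y ∷ e ∷ half ∷ []) (lt p ⊕ lt q ⊕ e · eq half+half)

  ⟶-scale : ∀ {s l} c → s ⟶ l → (λ n → c * s n) ⟶ (c * l)
  ⟶-scale {s} {l} c s⟶l e 0<e =
    let M , q = s⟶l (e * k) (lin< (e ∷ k ∷ []) (lt 0<e ⊗ lt 0<k)) in M , λ n M≤n → close n (q n M≤n)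
    where
    0<1+∣c∣ : 0# < 1# + ∣ c ∣
    0<1+∣c∣ = lin< (∣ c ∣ ∷ []) (le 0≤∣ c ∣ ⊕ 1+)
    k : ℝ
    k = (1# + ∣ c ∣) ⁻¹
    0<k : 0# < k
    0<k = ⁻¹-pos 0<1+∣c∣
    close : ∀ n → ∣ s n - l ∣ < e * k → ∣ c * s n - c * l ∣ < e
    close n p = ≤-<-trans (≤-reflexive (trans (∣∣-cong (ring≈ (c ∷ s n ∷ l ∷ []))) (∣∣-* c (s n - l))))
      (lin< (∣ c ∣ ∷ ∣ s n - l ∣ ∷ e ∷ k ∷ [])
        (le 0≤∣ c ∣ ⊗ lt p ⊕ lt 0<e ⊗ lt 0<k ⊕ e · eq (⁻¹-inverse (<⇒≉ 0<1+∣c∣))))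

  ⟶-shift : ∀ {s l} → s ⟶ l → (s ∘ suc) ⟶ l
  ⟶-shift s⟶l e 0<e = let M , q = s⟶l e 0<e in M , λ n M≤n → q (suc n) (ℕₚ.m≤n⇒m≤1+n M≤n)

  ⟶-unique : ∀ {s l m} → s ⟶ l → s ⟶ m → l ≈ m
  ⟶-unique s⟶l s⟶m = antisym (half-way s⟶l s⟶m) (half-way s⟶m s⟶l)
    where
    half-way : ∀ {s l m} → s ⟶ l → s ⟶ m → l ≤ m
    half-way {s} {l} {m} s⟶l s⟶m = lin≤ (l ∷ m ∷ [])
      (le (⟶-≤ {c = 0#} (λ n → lin≤ (s n ∷ []) none) (⟶-+ s⟶l (⟶-neg s⟶m))))

  nondecreasing : ∀ {s : ℕ → ℝ} → (∀ n → s n ≤ s (suc n)) → ∀ m n → m ℕ.≤ n → s m ≤ s n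
  nondecreasing {s} p m n m≤n = go (ℕₚ.≤⇒≤′ m≤n)
    where
    go : ∀ {n} → m ℕ.≤′ n → s m ≤ s n
    go ℕ.≤′-refl     = ≤-refl
    go (ℕ.≤′-step q) = ≤-trans (go q) (p _)

  monotone-convergence : ∀ (s : ℕ → ℝ) c → (∀ n → s n ≤ s (suc n)) → (∀ n → s n ≤ c) → ∃ λ l → s ⟶ l
  monotone-convergence s c mono bounded = finish (complete (λ x → ∃ λ n → x ≈ s n) (s 0 , 0 , refl)
    (c , λ { x (n , x≈) → ≤-resp (sym x≈) refl (bounded n) }))
    where
    finish : (∃ λ l → IsUpperBound (λ x → ∃ λ n → x ≈ s n) l ×
               (∀ b → IsUpperBound (λ x → ∃ λ n → x ≈ s n) b → l ≤ b)) → ∃ λ l → s ⟶ l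
    finish (l , ub , least) = l , converges
      where
      converges : s ⟶ l
      converges e 0<e with decide (∃ λ n → l - e < s n)
      ... | yes (M , p) = M , λ n M≤n → ∣∣-<
        (lin< (s n ∷ l ∷ e ∷ []) (le (ub (s n) (n , refl)) ⊕ lt 0<e))
        (lin< (s n ∷ l ∷ e ∷ s M ∷ []) (lt p ⊕ le (nondecreasing mono M n M≤n)))
      ... | no ¬p = refute (l ∷ e ∷ []) (lt 0<e ⊕
        le (least (l - e) λ { x (n , x≈) → ≤-resp (sym x≈) refl (≮⇒≥ λ q → ¬p (n , q)) }))

  -- `sum` splits off the first term; here the last one is split off, so that consecutive partial
  -- sums differ by a visible term.
  partial : (ℕ → ℝ) → ℕ → ℝ
  partial a zero    = 0#
  partial a (suc n) = partial a n + a n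

  partial-suc : ∀ a n → partial a (suc n) ≈ a 0 + partial (a ∘ suc) n
  partial-suc a zero    = ring≈ (a 0 ∷ [])
  partial-suc a (suc n) = trans (+-congʳ (partial-suc a n)) (+-assoc _ _ _)

  sum≈partial : ∀ n a → sum {n} (a ∘ toℕ) ≈ partial a n
  sum≈partial zero    a = refl
  sum≈partial (suc n) a = trans (+-congˡ (sum≈partial n (a ∘ suc))) (sym (partial-suc a n))

  partial-cong : ∀ {a b} → (∀ n → a n ≈ b n) → ∀ n → partial a n ≈ partial b n
  partial-cong p zero    = refl
  partial-cong p (suc n) = +-cong (partial-cong p n) (p n)

  ∑∞-limit : ∀ {a b l} → (∀ n → a n ≈ b n) → partial b ⟶ l → ∑∞ a ≈ l
  ∑∞-limit {a} {b} {l} p b⟶l = ⟶-unique (choose-spec 0# (λ m → (λ n → sum {n} (a ∘ toℕ)) ⟶ m) (l , a⟶l)) a⟶l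
    where
    a⟶l : (λ n → sum {n} (a ∘ toℕ)) ⟶ l
    a⟶l = ⟶-cong (λ n → sym (trans (sum≈partial n a) (partial-cong p n))) b⟶l

  ∣partial∣≤ : ∀ {a b} → (∀ k → ∣ a k ∣ ≤ b k) → ∀ n → ∣ partial a n ∣ ≤ partial b n
  ∣partial∣≤ p zero    = ∣∣-≤ ≤-refl (lin≤ [] none)
  ∣partial∣≤ p (suc n) = ∣∣-+-≤ (∣partial∣≤ p n) (p n)

  -- As |a| ≤ b, both b and a + b have nonnegative terms and bounded partial sums; the two monotone
  -- limits are subtracted.
  absolute-convergence : ∀ a b c → (∀ k → ∣ a k ∣ ≤ b k) → (∀ n → partial b n ≤ c) → ∃ λ l → partial a ⟶ l
  absolute-convergence a b c p q =
    let l , b⟶l = monotone-convergence (partial b) c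
          (λ n → lin≤ (partial b n ∷ b n ∷ []) (le (≤-trans 0≤∣ a n ∣ (p n)))) q
        m , a+b⟶m = monotone-convergence (λ n → partial a n + partial b n) (c + c)
          (λ n → lin≤ (partial a n ∷ partial b n ∷ a n ∷ b n ∷ []) (le (∣∣-≤ʳ (p n))))
          (λ n → lin≤ (partial a n ∷ partial b n ∷ c ∷ [])
            (le (∣∣-≤ˡ (∣partial∣≤ p n)) ⊕ le (q n) ⊕ le (q n)))
    in m - l , ⟶-cong (λ n → ring≈ (partial a n ∷ partial b n ∷ [])) (⟶-+ a+b⟶m (⟶-neg b⟶l))

  -- The power series of sine and cosine.

  fromℕ-* : ∀ m n → fromℕ (m ℕ.* n) ≈ fromℕ m * fromℕ n
  fromℕ-* m n = SemiringMult.×1-homo-* semiring m n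

  fromℕ-! : ∀ n → 0# < fromℕ (n !)
  fromℕ-! zero    = fromℕ-pos 0
  fromℕ-! (suc n) = <-resp refl (sym (fromℕ-* (suc n) (n !)))
    (*-pos (fromℕ-pos n) (fromℕ-! n))

  abstract
    expTerm : ℝ → ℕ → ℝ
    expTerm x n = x ^ n * fromℕ (n !) ⁻¹

    expTerm-def : ∀ x n → expTerm x n ≈ x ^ n * fromℕ (n !) ⁻¹
    expTerm-def x n = refl

    expTerm-zero : ∀ x → expTerm x 0 ≈ 1#
    expTerm-zero x = trans (*-identityˡ _) (⁻¹-unique (lin≈ [] none))

    -- The recursion through which powers and factorials enter the estimates, free of division.
    expTerm-suc : ∀ x n → fromℕ (suc n) * expTerm x (suc n) ≈ x * expTerm x n
    expTerm-suc x n = go (fromℕ (suc n)) (fromℕ (n !)) (x ^ n) (fromℕ (n !) ⁻¹) (fromℕ ((suc n) !) ⁻¹)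
      (⁻¹-inverse (<⇒≉ (fromℕ-! n)))
      (trans (*-congʳ (sym (fromℕ-* (suc n) (n !)))) (⁻¹-inverse (<⇒≉ (fromℕ-! (suc n)))))
      where
      go : ∀ c f p v u → f * v ≈ 1# → (c * f) * u ≈ 1# → c * ((x * p) * u) ≈ x * (p * v)
      go c f p v u fv≈1 cfu≈1 = lin≈ (c ∷ f ∷ p ∷ v ∷ u ∷ x ∷ [])
        ((x * p * v) · eq (cfu≈1) ⊕ (c * x * p * u) · eq (sym fv≈1))

  expTerm-nonNeg : ∀ {x} → 0# ≤ x → ∀ n → 0# ≤ expTerm x n
  expTerm-nonNeg 0≤x zero    = ≤-resp refl (sym (expTerm-zero _)) (<⇒≤ 0<1)
  expTerm-nonNeg {x} 0≤x (suc n) = *-cancel-≤ (fromℕ-pos n) (≤-resp (sym (zeroʳ _)) (sym (expTerm-suc x n))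
    (*-nonNeg 0≤x (expTerm-nonNeg 0≤x n)))

  expTerm-mono : ∀ {x y} → 0# ≤ x → x ≤ y → ∀ n → expTerm x n ≤ expTerm y n
  expTerm-mono 0≤x x≤y zero    = ≤-reflexive (trans (expTerm-zero _) (sym (expTerm-zero _)))
  expTerm-mono {x} {y} 0≤x x≤y (suc n) = *-cancel-≤ (fromℕ-pos n)
    (≤-resp (sym (expTerm-suc x n)) (sym (expTerm-suc y n))
      (lin≤ (x ∷ y ∷ expTerm x n ∷ expTerm y n ∷ [])
        (le x≤y ⊗ (le (expTerm-nonNeg 0≤x n) ⊕ le (expTerm-mono 0≤x x≤y n)) ⊕ le 0≤x ⊗ le (expTerm-mono 0≤x x≤y n))))

  -- Once n ≥ 2 R the terms at least halve, so that
  -- partial (expTerm R) n + 2 expTerm R n no longer increases.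
  expTerm-summable : ∀ R → 0# ≤ R → ∃ λ M → ∀ n → partial (expTerm R) n ≤ M
  expTerm-summable R 0≤R = u n₀ , λ n → ≤-trans (grow n) (≤-trans
    (≤-resp refl (reflexive (≡.cong u (ℕₚ.+-comm n₀ n))) (e≤u (n₀ ℕ.+ n))) (bound n))
    where
    a e u : ℕ → ℝ
    a = expTerm R
    e = partial a
    u n = e n + (a n + a n)
    n₀ : ℕ
    n₀ = proj₁ (archimedean (R + R))
    2R≤n₀ : R + R ≤ fromℕ n₀
    2R≤n₀ = proj₂ (archimedean (R + R))
    0≤a : ∀ n → 0# ≤ a n
    0≤a = expTerm-nonNeg 0≤R
    e≤u : ∀ n → e n ≤ u n
    e≤u n = lin≤ (e n ∷ a n ∷ []) (le (0≤a n) ⊕ le (0≤a n))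
    grow : ∀ n → e n ≤ e (n₀ ℕ.+ n)
    grow n = nondecreasing {e} (λ m → lin≤ (e m ∷ a m ∷ []) (le (0≤a m))) n (n₀ ℕ.+ n) (ℕₚ.m≤n+m n n₀)
    halves : ∀ n → fromℕ n₀ ≤ fromℕ (suc n) → a (suc n) + a (suc n) ≤ a n
    halves n p = *-cancel-≤ (fromℕ-pos n) (lin≤ (fromℕ n ∷ a (suc n) ∷ a n ∷ R ∷ fromℕ n₀ ∷ [])
      (eq (expTerm-suc R n) ⊕ eq (expTerm-suc R n) ⊕ (le p ⊕ le 2R≤n₀) ⊗ le (0≤a n)))
    bound : ∀ k → u (k ℕ.+ n₀) ≤ u n₀
    bound zero    = ≤-refl
    bound (suc k) = ≤-trans (lin≤ (e (k ℕ.+ n₀) ∷ a (k ℕ.+ n₀) ∷ a (suc (k ℕ.+ n₀)) ∷ [])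
      (le (halves (k ℕ.+ n₀) n₀≤))) (bound k)
      where
      n₀≤ : fromℕ n₀ ≤ fromℕ (suc (k ℕ.+ n₀))
      n₀≤ = ≤-resp refl (sym (fromℕ-+ (suc k) n₀)) (lin≤ (fromℕ n₀ ∷ fromℕ k ∷ []) (le (fromℕ-nonNeg k) ⊕ 1+))

  sign : ℕ → ℝ
  sign k = (- 1#) ^ k

  ∣sign*∣ : ∀ k x → ∣ sign k * x ∣ ≈ ∣ x ∣
  ∣sign*∣ zero    x = ∣∣-cong (*-identityˡ x)
  ∣sign*∣ (suc k) x = trans (∣∣-cong (ring≈ (sign k ∷ x ∷ []))) (trans (∣-x∣≈∣x∣ _) (∣sign*∣ k x))

  -- Unlike `2 ℕ.* k` this unfolds by two successors at once, so that even and odd indices match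
  -- definitionally.
  double : ℕ → ℕ
  double zero    = zero
  double (suc k) = suc (suc (double k))

  2*≡double : ∀ k → 2 ℕ.* k ≡ double k
  2*≡double zero    = ≡.refl
  2*≡double (suc k) = ≡.cong suc (≡.trans (ℕₚ.+-suc k (k ℕ.+ 0)) (≡.cong suc (2*≡double k)))

  sinTerm cosTerm : ℝ → ℕ → ℝ
  sinTerm x k = sign k * expTerm x (suc (double k))
  cosTerm x k = sign k * expTerm x (double k)

  partial-odd : ∀ R → 0# ≤ R → ∀ n → partial (λ k → expTerm R (suc (double k))) n ≤ partial (expTerm R) (double n)
  partial-odd R 0≤R zero    = ≤-refl
  partial-odd R 0≤R (suc n) = lin≤ (o ∷ partial a (double n) ∷ a (double n) ∷ a (suc (double n)) ∷ [])
    (le (partial-odd R 0≤R n) ⊕ le (expTerm-nonNeg 0≤R (double n)))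
    where
    a = expTerm R
    o = partial (λ k → a (suc (double k))) n

  partial-even : ∀ R → 0# ≤ R → ∀ n → partial (λ k → expTerm R (double k)) n ≤ partial (expTerm R) (double n)
  partial-even R 0≤R zero    = ≤-refl
  partial-even R 0≤R (suc n) = lin≤ (o ∷ partial a (double n) ∷ a (double n) ∷ a (suc (double n)) ∷ [])
    (le (partial-even R 0≤R n) ⊕ le (expTerm-nonNeg 0≤R (suc (double n))))
    where
    a = expTerm R
    o = partial (λ k → a (double k)) n

  -- Second-order bounds for the Taylor remainder.

  module _ (R : ℝ) {x y : ℝ} (0≤x : 0# ≤ x) (x≤R : x ≤ R) (0≤y : 0# ≤ y) (y≤R : y ≤ R) where

    private
      0≤R : 0# ≤ R
      0≤R = ≤-trans 0≤x x≤R
      h² : ℝ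
      h² = (y - x) * (y - x)

    -- The error of linearising the term of degree n + 1 at x; the derivative of that term is the
    -- term of degree n.
    remainder : ℕ → ℝ
    remainder n = (expTerm y (suc n) - expTerm x (suc n)) - (y - x) * expTerm x n

    remainder-suc : ∀ n → fromℕ (suc (suc n)) * remainder (suc n) ≈ y * remainder n + (y - x) * (y - x) * expTerm x n
    remainder-suc n = lin≈ (fromℕ n ∷ expTerm y (suc (suc n)) ∷ expTerm x (suc (suc n)) ∷
      expTerm y (suc n) ∷ expTerm x (suc n) ∷ expTerm x n ∷ x ∷ y ∷ [])
      (eq (expTerm-suc y (suc n)) ⊕ eq (sym (expTerm-suc x (suc n))) ⊕ (y - x) · eq (sym (expTerm-suc x n)))

    remainder-zero : remainder zero ≈ 0#
    remainder-zero = lin≈ (expTerm y 1 ∷ expTerm x 1 ∷ expTerm x 0 ∷ x ∷ y ∷ [])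
      (eq (linear y) ⊕ eq (sym (linear x)) ⊕ (y - x) · eq (sym (expTerm-zero x)))
      where
      linear : ∀ z → expTerm z 1 ≈ z
      linear z = lin≈ (expTerm z 1 ∷ z ∷ expTerm z 0 ∷ []) (eq (expTerm-suc z 0) ⊕ z · eq (expTerm-zero z))

    -- Mutual induction along `remainder-suc`. There y |r_n| ≤ R |r_n| is at most n e_n h² by the
    -- first bound, and adding e_n h² gives (n + 1) e_n h², which division by n + 2 brings below e_n
    -- h². The first bound follows from the second because R e_n = (n + 1) e_(n+1) for the terms e_n
    -- at R.
    R∣remainder∣≤ : ∀ n → R * ∣ remainder n ∣ ≤ fromℕ n * expTerm R n * h²
    ∣remainder∣≤ : ∀ n → ∣ remainder (suc n) ∣ ≤ expTerm R n * h²
    R∣remainder∣≤ zero = ≤-reflexive (trans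
      (*-congˡ (trans (∣∣-cong remainder-zero) (0≤⇒∣x∣≈x ≤-refl)))
      (ring≈ (R ∷ expTerm R 0 ∷ x ∷ y ∷ [])))
    R∣remainder∣≤ (suc n) = lin≤ (R ∷ ∣ remainder (suc n) ∣ ∷ expTerm R n ∷ expTerm R (suc n) ∷ fromℕ n ∷ x ∷ y ∷ [])
      (le 0≤R ⊗ le (∣remainder∣≤ n) ⊕ h² · eq (sym (expTerm-suc R n)))
    ∣remainder∣≤ n = *-cancel-≤ (fromℕ-pos (suc n)) (≤-trans (≤-reflexive (trans
      (*-congʳ (sym (0≤⇒∣x∣≈x (fromℕ-nonNeg (suc (suc n)))))) (trans (sym (∣∣-* _ _)) (∣∣-cong (remainder-suc n)))))
      (≤-trans (∣∣-+-≤
        (≤-reflexive (trans (∣∣-* y (remainder n)) (*-congʳ (0≤⇒∣x∣≈x 0≤y))))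
        (≤-reflexive (0≤⇒∣x∣≈x (*-nonNeg (0≤x*x (y - x)) (expTerm-nonNeg 0≤x n)))))
        (lin≤ (y ∷ R ∷ ∣ remainder n ∣ ∷ x ∷ expTerm x n ∷ expTerm R n ∷ fromℕ n ∷ [])
          (le y≤R ⊗ le 0≤∣ remainder n ∣ ⊕ le (R∣remainder∣≤ n) ⊕ sq (y - x) ⊗ le (expTerm-mono 0≤x x≤R n)
            ⊕ sq (y - x) ⊗ le (expTerm-nonNeg 0≤R n)))))

    -- The constant term of the cosine drops out, so that n + 1 of its terms face n terms of the
    -- sine and every remainder on the right has a positive index, as `∣remainder∣≤` demands.
    cos-remainder : ∀ n →
      (partial (cosTerm y) (suc n) - partial (cosTerm x) (suc n)) + (y - x) * partial (sinTerm x) n ≈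
      partial (λ k → sign (suc k) * remainder (suc (double k))) n
    cos-remainder zero    = lin≈ (expTerm y 0 ∷ expTerm x 0 ∷ y ∷ x ∷ [])
      (eq (expTerm-zero y) ⊕ eq (sym (expTerm-zero x)))
    cos-remainder (suc n) = rearrange _ _ _ _ _ _ _ _ _ (cos-remainder n)
      where
      rearrange : ∀ p q r s t u v w z → (p - q) + r * s ≈ t →
             ((p + (- 1# * u) * v) - (q + (- 1# * u) * w)) + r * (s + u * z) ≈ t + (- 1# * u) * ((v - w) - r * z)
      rearrange p q r s t u v w z h = lin≈ (p ∷ q ∷ r ∷ s ∷ t ∷ u ∷ v ∷ w ∷ z ∷ []) (eq h)

    -- Here the remainder of the linear term would come first, and it vanishes; the right side
    -- therefore starts one term later.
    sin-remainder : ∀ n →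
      (partial (sinTerm y) (suc n) - partial (sinTerm x) (suc n)) - (y - x) * partial (cosTerm x) (suc n) ≈
      partial (λ k → sign (suc k) * remainder (suc (suc (double k)))) n
    sin-remainder zero    = lin≈ (expTerm y 1 ∷ expTerm x 1 ∷ expTerm x 0 ∷ x ∷ y ∷ []) (eq remainder-zero)
    sin-remainder (suc n) = rearrange _ _ _ _ _ _ _ _ _ (sin-remainder n)
      where
      rearrange : ∀ p q r s t u v w z → (p - q) - r * s ≈ t →
             ((p + u * v) - (q + u * w)) - r * (s + u * z) ≈ t + u * ((v - w) - r * z)
      rearrange p q r s t u v w z h = lin≈ (p ∷ q ∷ r ∷ s ∷ t ∷ u ∷ v ∷ w ∷ z ∷ []) (eq h)

    ∣partial-remainder∣≤ : ∀ M → (∀ n → partial (expTerm R) n ≤ M) → ∀ (i : ℕ → ℕ) →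
      (∀ n → partial (expTerm R ∘ i) n ≤ partial (expTerm R) (double n)) → ∀ n →
      ∣ partial (λ k → sign (suc k) * remainder (suc (i k))) n ∣ ≤ M * h²
    ∣partial-remainder∣≤ M bounded i sub n = ≤-trans
      (∣partial∣≤ {b = λ k → expTerm R (i k) * h²}
        (λ k → ≤-trans (≤-reflexive (∣sign*∣ (suc k) _)) (∣remainder∣≤ (i k))) n)
      (≤-trans (≤-reflexive (partial-*ʳ n)) (lin≤ (partial (expTerm R ∘ i) n ∷ M ∷ x ∷ y ∷ [])
        (sq (y - x) ⊗ le (≤-trans (sub n) (bounded (double n))))))
      where
      partial-*ʳ : ∀ n → partial (λ k → expTerm R (i k) * h²) n ≈ partial (expTerm R ∘ i) n * h²
      partial-*ʳ zero    = sym (zeroˡ _)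
      partial-*ʳ (suc n) = trans (+-congʳ (partial-*ʳ n)) (sym (distribʳ _ _ _))

  ⟶-resp : ∀ {s l m} → l ≈ m → s ⟶ l → s ⟶ m
  ⟶-resp l≈m s⟶l e 0<e = let M , p = s⟶l e 0<e in M , λ n M≤n → <-resp (∣∣-cong (+-congˡ (-‿cong l≈m))) refl (p n M≤n)

  sign-expTerm : ∀ k x m n → m ≡ n → sign k * x ^ m * fromℕ (m !) ⁻¹ ≈ sign k * expTerm x n
  sign-expTerm k x m .m ≡.refl = trans (*-assoc _ _ _) (*-congˡ (sym (expTerm-def x m)))

  ∣sinTerm∣≤ : ∀ {x} → 0# ≤ x → ∀ k → ∣ sinTerm x k ∣ ≤ expTerm x (suc (double k))
  ∣sinTerm∣≤ 0≤x k = ≤-reflexive (trans (∣sign*∣ k _) (0≤⇒∣x∣≈x (expTerm-nonNeg 0≤x _)))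

  ∣cosTerm∣≤ : ∀ {x} → 0# ≤ x → ∀ k → ∣ cosTerm x k ∣ ≤ expTerm x (double k)
  ∣cosTerm∣≤ 0≤x k = ≤-reflexive (trans (∣sign*∣ k _) (0≤⇒∣x∣≈x (expTerm-nonNeg 0≤x _)))

  sin-sum : ∀ x {l} → partial (sinTerm x) ⟶ l → sin x ≈ l
  sin-sum x = ∑∞-limit {b = sinTerm x} (λ k → sign-expTerm k x (suc (2 ℕ.* k)) (suc (double k)) (≡.cong suc (2*≡double k)))

  cos-sum : ∀ x {l} → partial (cosTerm x) ⟶ l → cos x ≈ l
  cos-sum x = ∑∞-limit {b = cosTerm x} (λ k → sign-expTerm k x (2 ℕ.* k) (double k) (2*≡double k))

  sin-limit : ∀ {x} → 0# ≤ x → partial (sinTerm x) ⟶ sin x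
  sin-limit {x} 0≤x =
    let M , bounded = expTerm-summable x 0≤x
        l , s⟶l = absolute-convergence (sinTerm x) (λ k → expTerm x (suc (double k))) M (∣sinTerm∣≤ 0≤x)
          (λ n → ≤-trans (partial-odd x 0≤x n) (bounded (double n)))
    in ⟶-resp {partial (sinTerm x)} {l} {sin x} (sym (sin-sum x s⟶l)) s⟶l

  cos-limit : ∀ {x} → 0# ≤ x → partial (cosTerm x) ⟶ cos x
  cos-limit {x} 0≤x =
    let M , bounded = expTerm-summable x 0≤x
        l , s⟶l = absolute-convergence (cosTerm x) (λ k → expTerm x (double k)) M (∣cosTerm∣≤ 0≤x)
          (λ n → ≤-trans (partial-even x 0≤x n) (bounded (double n)))
    in ⟶-resp {partial (cosTerm x)} {l} {cos x} (sym (cos-sum x s⟶l)) s⟶l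

  ∣⟶∣-≤ : ∀ {s l c} → (∀ n → ∣ s n ∣ ≤ c) → s ⟶ l → ∣ l ∣ ≤ c
  ∣⟶∣-≤ p s⟶l = ∣∣-≤ (⟶-≤ (λ n → ∣∣-≤ˡ (p n)) s⟶l) (⟶-≤ (λ n → ∣∣-≤ʳ (p n)) (⟶-neg s⟶l))

  sin-zero : sin 0# ≈ 0#
  sin-zero = ⟶-unique (sin-limit ≤-refl) (⟶-cong (λ n → sym (vanishes n)) λ e 0<e → 0 , λ n _ →
    <-resp (sym (trans (∣∣-cong (-‿inverseʳ 0#)) (0≤⇒∣x∣≈x ≤-refl))) refl 0<e)
    where
    expTerm-0 : ∀ n → expTerm 0# (suc n) ≈ 0#
    expTerm-0 n = *-cancel-≈ (<⇒≉ (fromℕ-pos n)) (trans (expTerm-suc 0# n) (trans (zeroˡ _) (sym (zeroʳ _))))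
    vanishes : ∀ n → partial (sinTerm 0#) n ≈ 0#
    vanishes zero    = refl
    vanishes (suc n) = trans (+-cong (vanishes n) (trans (*-congˡ (expTerm-0 (double n))) (zeroʳ _))) (+-identityʳ 0#)

  cos-zero : cos 0# ≈ 1#
  cos-zero = ⟶-unique (⟶-shift (cos-limit ≤-refl)) (⟶-cong (λ n → sym (vanishes n)) λ e 0<e → 0 , λ n _ →
    <-resp (sym (trans (∣∣-cong (-‿inverseʳ 1#)) (0≤⇒∣x∣≈x ≤-refl))) refl 0<e)
    where
    expTerm-0 : ∀ n → expTerm 0# (suc n) ≈ 0#
    expTerm-0 n = *-cancel-≈ (<⇒≉ (fromℕ-pos n)) (trans (expTerm-suc 0# n) (trans (zeroˡ _) (sym (zeroʳ _))))
    vanishes : ∀ n → partial (cosTerm 0#) (suc n) ≈ 1#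
    vanishes zero    = lin≈ (expTerm 0# 0 ∷ []) (eq (expTerm-zero 0#))
    vanishes (suc n) = trans (+-cong (vanishes n) (trans (*-congˡ (expTerm-0 (suc (double n)))) (zeroʳ _))) (+-identityʳ 1#)

  -- The differential equations s′ = c and c′ = -s, stated as a quadratic error of linearisation
  -- that is uniform on [0, R]. Together with the values at 0 these bounds carry all later arguments
  -- about zeros.
  record LocalBounds (s c : ℝ → ℝ) (R M : ℝ) : Set where
    field
      0≤M : 0# ≤ M
      s-bound : ∀ x → 0# ≤ x → x ≤ R → ∣ s x ∣ ≤ M
      c-bound : ∀ x → 0# ≤ x → x ≤ R → ∣ c x ∣ ≤ M
      s-diff  : ∀ x y → 0# ≤ x → x ≤ R → 0# ≤ y → y ≤ R → ∣ (s y - s x) - (y - x) * c x ∣ ≤ M * ((y - x) * (y - x))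
      c-diff  : ∀ x y → 0# ≤ x → x ≤ R → 0# ≤ y → y ≤ R → ∣ (c y - c x) + (y - x) * s x ∣ ≤ M * ((y - x) * (y - x))

  localBounds : ∀ R → 0# ≤ R → ∃ (LocalBounds sin cos R)
  localBounds R 0≤R = let M , bounded = expTerm-summable R 0≤R in M , bounds M bounded
    where
    bounds : ∀ M → (∀ n → partial (expTerm R) n ≤ M) → LocalBounds sin cos R M
    bounds M bounded = record
      { 0≤M = bounded 0
      ; s-bound = λ x 0≤x x≤R → ∣⟶∣-≤ (λ n → ≤-trans
          (∣partial∣≤ (λ k → ≤-trans (∣sinTerm∣≤ 0≤x k) (expTerm-mono 0≤x x≤R _)) n)
          (≤-trans (partial-odd R 0≤R n) (bounded (double n)))) (sin-limit 0≤x)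
      ; c-bound = λ x 0≤x x≤R → ∣⟶∣-≤ (λ n → ≤-trans
          (∣partial∣≤ (λ k → ≤-trans (∣cosTerm∣≤ 0≤x k) (expTerm-mono 0≤x x≤R _)) n)
          (≤-trans (partial-even R 0≤R n) (bounded (double n)))) (cos-limit 0≤x)
      ; s-diff = λ x y 0≤x x≤R 0≤y y≤R → ∣⟶∣-≤ (λ n → ≤-resp
          (∣∣-cong (sym (sin-remainder R 0≤x x≤R 0≤y y≤R n))) refl
          (∣partial-remainder∣≤ R 0≤x x≤R 0≤y y≤R M bounded (λ k → suc (double k)) (partial-odd R 0≤R) n))
          (⟶-+ (⟶-+ (⟶-shift (sin-limit 0≤y)) (⟶-neg (⟶-shift (sin-limit 0≤x))))
            (⟶-neg (⟶-scale (y - x) (⟶-shift (cos-limit 0≤x)))))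
      ; c-diff = λ x y 0≤x x≤R 0≤y y≤R → ∣⟶∣-≤ (λ n → ≤-resp
          (∣∣-cong (sym (cos-remainder R 0≤x x≤R 0≤y y≤R n))) refl
          (∣partial-remainder∣≤ R 0≤x x≤R 0≤y y≤R M bounded double (partial-even R 0≤R) n))
          (⟶-+ (⟶-+ (⟶-shift (cos-limit 0≤y)) (⟶-neg (⟶-shift (cos-limit 0≤x))))
            (⟶-scale (y - x) (sin-limit 0≤x)))
      }

  -- Mean value inequality and intermediate values.

  module _ {a b : ℝ} (a≤b : a ≤ b) (f : ℝ → ℝ) (K : ℝ) (0≤K : 0# ≤ K) where

    private
      1+K>0 : 0# < 1# + K
      1+K>0 = lin< (K ∷ []) (le 0≤K ⊕ 1+)
      radius : ℝ → ℝ
      radius e = e * (1# + K) ⁻¹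
      radius-pos : ∀ {e} → 0# < e → 0# < radius e
      radius-pos 0<e = *-pos 0<e (⁻¹-pos 1+K>0)
      K*radius : ∀ {e h} → 0# ≤ h → h < radius e → K * h ≤ e
      K*radius {e} {h} 0≤h h<r = lin≤ (e ∷ h ∷ K ∷ (1# + K) ⁻¹ ∷ [])
        (le (*-nonNeg (<⇒≤ 1+K>0) (<⇒≤ (<⇒0<- h<r))) ⊕ le 0≤h ⊕ e · eq (⁻¹-inverse (<⇒≉ 1+K>0)))

    -- With slope m - e in place of m, the error K h² is absorbed for steps h below e / (1 + K).
    -- Steepness is transitive, so it spreads from short steps to the whole interval, and e is
    -- arbitrary.
    increment-bound : ∀ (f′ : ℝ → ℝ) m →
      (∀ x y → a ≤ x → x ≤ y → y ≤ b → (y - x) * f′ x - K * ((y - x) * (y - x)) ≤ f y - f x) →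
      (∀ x → a ≤ x → x ≤ b → m ≤ f′ x) → m * (b - a) ≤ f b - f a
    increment-bound f′ m taylor m≤f′ = ≤-by-ε λ e 0<e → scaled e 0<e
      where
      1+L>0 : 0# < 1# + (b - a)
      1+L>0 = lin< (a ∷ b ∷ []) (le a≤b ⊕ 1+)
      Steep : ℝ → ℝ → ℝ → Set
      Steep e x y = (m - e) * (y - x) ≤ f y - f x
      step′ : ∀ e → 0# < e → ∀ x y → a ≤ x → x ≤ y → y ≤ b → y - x < radius e → Steep e x y
      step′ e 0<e x y a≤x x≤y y≤b near = lin≤ (m ∷ e ∷ x ∷ y ∷ f x ∷ f y ∷ f′ x ∷ K ∷ [])
        (le (taylor x y a≤x x≤y y≤b) ⊕ le x≤y ⊗ le (m≤f′ x a≤x (≤-trans x≤y y≤b))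
          ⊕ le x≤y ⊗ le (K*radius {e} (≤⇒0≤- x≤y) near))
      steep : ∀ e → 0# < e → Steep e a b
      steep e 0<e = local⇒global a b a≤b (Steep e)
        (λ {x} {y} {z} p q → lin≤ (m ∷ e ∷ x ∷ y ∷ z ∷ f x ∷ f y ∷ f z ∷ []) (le p ⊕ le q))
        (λ t a≤t t≤b → radius e , radius-pos 0<e , λ u a≤u u≤b →
          (λ t-r<u u≤t → step′ e 0<e u t a≤u u≤t t≤b (below t u (radius e) t-r<u)) ,
          (λ t≤u u<t+r → step′ e 0<e t u a≤t t≤u u≤b (above t u (radius e) u<t+r)))
        where
        below : ∀ t u r → t - r < u → t - u < r
        below t u r p = lin< (t ∷ u ∷ r ∷ []) (lt p)
        above : ∀ t u r → u < t + r → u - t < r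
        above t u r p = lin< (t ∷ u ∷ r ∷ []) (lt p)
      scaled : ∀ e → 0# < e → m * (b - a) ≤ (f b - f a) + e
      -- The slope error e / (1 + (b - a)) costs at most e over the length b - a.
      scaled e 0<e = lin≤ (m ∷ e ∷ a ∷ b ∷ f a ∷ f b ∷ (1# + (b - a)) ⁻¹ ∷ [])
        (le (steep (e * (1# + (b - a)) ⁻¹) (*-pos 0<e (⁻¹-pos 1+L>0)))
          ⊕ lt 0<e ⊗ lt (⁻¹-pos 1+L>0) ⊕ e · eq (⁻¹-inverse (<⇒≉ 1+L>0)))

    -- The transitive relation is the implication from positivity at x to positivity at y. It holds
    -- locally: within the radius chosen at t, f differs from f t by at most |f t|, so it cannot
    -- change sign without vanishing.
    intermediate-value : (∀ x y → a ≤ x → x ≤ y → y ≤ b → ∣ f y - f x ∣ ≤ K * (y - x)) →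
      (∀ x → a ≤ x → x ≤ b → ¬ f x ≈ 0#) → 0# < f a → 0# < f b
    intermediate-value lipschitz nonzero = local⇒global a b a≤b (λ x y → 0# < f x → 0# < f y)
      (λ p q → q ∘ p)
      (λ t a≤t t≤b → radius ∣ f t ∣ , radius-pos (≉0⇒0<∣x∣ (nonzero t a≤t t≤b)) , λ u a≤u u≤b →
        (λ t-r<u u≤t 0<fu → left t u (nonzero t a≤t t≤b) (lipschitz u t a≤u u≤t t≤b)
          (K*radius {∣ f t ∣} (≤⇒0≤- u≤t) (below t u (radius ∣ f t ∣) t-r<u)) 0<fu) ,
        (λ t≤u u<t+r 0<ft → right t u (nonzero u a≤u u≤b) (lipschitz t u a≤t t≤u u≤b)
          (K*radius {∣ f t ∣} (≤⇒0≤- t≤u) (above t u (radius ∣ f t ∣) u<t+r)) 0<ft))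
      where
      below : ∀ t u r → t - r < u → t - u < r
      below t u r p = lin< (t ∷ u ∷ r ∷ []) (lt p)
      above : ∀ t u r → u < t + r → u - t < r
      above t u r p = lin< (t ∷ u ∷ r ∷ []) (lt p)
      left : ∀ t u → ¬ f t ≈ 0# → ∣ f t - f u ∣ ≤ K * (t - u) → K * (t - u) ≤ ∣ f t ∣ → 0# < f u → 0# < f t
      left t u ft≉0 p q 0<fu with ≤-or-> (f t) 0#
      ... | inj₂ 0<ft = 0<ft
      ... | inj₁ ft≤0 = refute (f t ∷ f u ∷ ∣ f t ∣ ∷ K ∷ t ∷ u ∷ [])
        (le (∣∣-≤ʳ p) ⊕ le q ⊕ eq (≤0⇒∣x∣≈-x ft≤0) ⊕ lt 0<fu)
      right : ∀ t u → ¬ f u ≈ 0# → ∣ f u - f t ∣ ≤ K * (u - t) → K * (u - t) ≤ ∣ f t ∣ → 0# < f t → 0# < f u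
      right t u fu≉0 p q 0<ft = 0≤fu , λ 0≈fu → fu≉0 (sym 0≈fu)
        where
        0≤fu : 0# ≤ f u
        0≤fu = lin≤ (f t ∷ f u ∷ ∣ f t ∣ ∷ K ∷ t ∷ u ∷ [])
          (le (∣∣-≤ʳ p) ⊕ le q ⊕ eq (0≤⇒∣x∣≈x (<⇒≤ 0<ft)))

  -- Zeros and values of sine and cosine.

  module _ (s c : ℝ → ℝ) (s-zero : s 0# ≈ 0#) (c-zero : c 0# ≈ 1#)
           (localBound : ∀ R → 0# ≤ R → ∃ (LocalBounds s c R)) where

    private

      module Bounds {R M : ℝ} (B : LocalBounds s c R M) where
        open LocalBounds B public
        s-increment : ∀ x y → 0# ≤ x → x ≤ y → y ≤ R → (y - x) * c x - M * ((y - x) * (y - x)) ≤ s y - s x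
        s-increment x y 0≤x x≤y y≤R = lin≤ (x ∷ y ∷ s x ∷ s y ∷ c x ∷ M ∷ [])
          (le (∣∣-≤ʳ (s-diff x y 0≤x (≤-trans x≤y y≤R) (≤-trans 0≤x x≤y) y≤R)))
        s-decrement : ∀ x y → 0# ≤ x → x ≤ y → y ≤ R → (y - x) * (- c x) - M * ((y - x) * (y - x)) ≤ - s y - (- s x)
        s-decrement x y 0≤x x≤y y≤R = lin≤ (x ∷ y ∷ s x ∷ s y ∷ c x ∷ M ∷ [])
          (le (∣∣-≤ˡ (s-diff x y 0≤x (≤-trans x≤y y≤R) (≤-trans 0≤x x≤y) y≤R)))
        c-decrement : ∀ x y → 0# ≤ x → x ≤ y → y ≤ R → (y - x) * s x - M * ((y - x) * (y - x)) ≤ - c y - (- c x)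
        c-decrement x y 0≤x x≤y y≤R = lin≤ (x ∷ y ∷ s x ∷ c x ∷ c y ∷ M ∷ [])
          (le (∣∣-≤ˡ (c-diff x y 0≤x (≤-trans x≤y y≤R) (≤-trans 0≤x x≤y) y≤R)))

        -- A Lipschitz constant on [0, R]: the derivative contributes M h, and the quadratic error M
        -- h² is at most M R h.
        K : ℝ
        K = M + M * R
        0≤K : 0# ≤ R → 0# ≤ K
        0≤K 0≤R = lin≤ (M ∷ R ∷ []) (le 0≤M ⊕ le 0≤M ⊗ le 0≤R)
        lipschitz : ∀ {f f′ : ℝ → ℝ} →
          (∀ x y → 0# ≤ x → x ≤ y → y ≤ R → ∣ (f y - f x) - (y - x) * f′ x ∣ ≤ M * ((y - x) * (y - x))) →
          (∀ x → 0# ≤ x → x ≤ R → ∣ f′ x ∣ ≤ M) →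
          ∀ x y → 0# ≤ x → x ≤ y → y ≤ R → ∣ f y - f x ∣ ≤ K * (y - x)
        lipschitz {f} {f′} diff bound x y 0≤x x≤y y≤R = ≤-trans (≤-reflexive (∣∣-cong (ring≈ (f x ∷ f y ∷ f′ x ∷ x ∷ y ∷ []))))
          (≤-trans (∣∣-+-≤ {(f y - f x) - (y - x) * f′ x} {(y - x) * f′ x} (diff x y 0≤x x≤y y≤R)
            (∣∣-*-≤ (≤-reflexive (0≤⇒∣x∣≈x (≤⇒0≤- x≤y))) (bound x 0≤x (≤-trans x≤y y≤R))))
            (lin≤ (x ∷ y ∷ M ∷ R ∷ []) (le 0≤M ⊗ le x≤y ⊗ (le 0≤x ⊕ le y≤R))))
        s-lipschitz : ∀ x y → 0# ≤ x → x ≤ y → y ≤ R → ∣ s y - s x ∣ ≤ K * (y - x)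
        s-lipschitz = lipschitz (λ x y 0≤x x≤y y≤R → s-diff x y 0≤x (≤-trans x≤y y≤R) (≤-trans 0≤x x≤y) y≤R) c-bound
        c-lipschitz : ∀ x y → 0# ≤ x → x ≤ y → y ≤ R → ∣ c y - c x ∣ ≤ K * (y - x)
        c-lipschitz = lipschitz
          (λ x y 0≤x x≤y y≤R → ≤-resp (∣∣-cong (ring≈ (c x ∷ c y ∷ s x ∷ x ∷ y ∷ []))) refl
            (c-diff x y 0≤x (≤-trans x≤y y≤R) (≤-trans 0≤x x≤y) y≤R))
          (λ x 0≤x x≤R → ≤-resp (sym (∣-x∣≈∣x∣ (s x))) refl (s-bound x 0≤x x≤R))

    s-monotone : ∀ {a b} → 0# ≤ a → a ≤ b → ∀ m → (∀ x → a ≤ x → x ≤ b → m ≤ c x) → m * (b - a) ≤ s b - s a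
    s-monotone {a} {b} 0≤a a≤b m p with localBound b (≤-trans 0≤a a≤b)
    ... | M , B = increment-bound a≤b s M 0≤M c m (λ x y a≤x → s-increment x y (≤-trans 0≤a a≤x)) p
      where open Bounds B

    s-antitone : ∀ {a b} → 0# ≤ a → a ≤ b → ∀ m → (∀ x → a ≤ x → x ≤ b → m ≤ - c x) → m * (b - a) ≤ - s b - (- s a)
    s-antitone {a} {b} 0≤a a≤b m p with localBound b (≤-trans 0≤a a≤b)
    ... | M , B = increment-bound a≤b (λ x → - s x) M 0≤M (λ x → - c x) m (λ x y a≤x → s-decrement x y (≤-trans 0≤a a≤x)) p
      where open Bounds B

    c-antitone : ∀ {a b} → 0# ≤ a → a ≤ b → ∀ m → (∀ x → a ≤ x → x ≤ b → m ≤ s x) → m * (b - a) ≤ - c b - (- c a)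
    c-antitone {a} {b} 0≤a a≤b m p with localBound b (≤-trans 0≤a a≤b)
    ... | M , B = increment-bound a≤b (λ x → - c x) M 0≤M s m (λ x y a≤x → c-decrement x y (≤-trans 0≤a a≤x)) p
      where open Bounds B

    -- The mean of the two first-order expansions, at x and at y, cancels the
    -- first-order terms of the increment of s² + c² exactly.
    pythagoras : ∀ {b} → 0# ≤ b → s b * s b + c b * c b ≈ 1#
    pythagoras {b} 0≤b with localBound b 0≤b
    ... | M , B = trans (antisym q-upper q-lower) (lin≈ (s 0# ∷ c 0# ∷ []) (s 0# · eq s-zero ⊕ (1# + c 0#) · eq c-zero))
      where
      open Bounds B hiding (K; 0≤K)
      q : ℝ → ℝ
      q x = s x * s x + c x * c x
      K : ℝ
      K = (M + M) * (M + M)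
      0≤K : 0# ≤ K
      0≤K = lin≤ (M ∷ []) ((le 0≤M ⊕ le 0≤M) ⊗ (le 0≤M ⊕ le 0≤M))
      q-increment : ∀ x y → 0# ≤ x → x ≤ y → y ≤ b → ∣ q y - q x ∣ ≤ K * ((y - x) * (y - x))
      q-increment x y 0≤x x≤y y≤b = halve (≤-trans (≤-reflexive (∣∣-cong (expand (s x) (s y) (c x) (c y) (y - x) (x - y) (ring≈ (x ∷ y ∷ [])))))
        (≤-trans (∣∣-+-≤ (∣∣-*-≤ (∣∣-+-≤ xy (≤-resp (sym (∣-x∣≈∣x∣ _)) refl yx)) (∣∣-+-≤ sy sx))
                         (∣∣-*-≤ (∣∣-+-≤ xy′ (≤-resp (sym (∣-x∣≈∣x∣ _)) refl yx′)) (∣∣-+-≤ cy cx)))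
          (lin≤ (x ∷ y ∷ M ∷ []) none)))
        where
        0≤y = ≤-trans 0≤x x≤y
        x≤b = ≤-trans x≤y y≤b
        xy  = s-diff x y 0≤x x≤b 0≤y y≤b
        yx  = s-diff y x 0≤y y≤b 0≤x x≤b
        xy′ = c-diff x y 0≤x x≤b 0≤y y≤b
        yx′ = c-diff y x 0≤y y≤b 0≤x x≤b
        sx  = s-bound x 0≤x x≤b
        sy  = s-bound y 0≤y y≤b
        cx  = c-bound x 0≤x x≤b
        cy  = c-bound y 0≤y y≤b
        expand : ∀ sx sy cx cy h k → k ≈ - h → (1# + 1#) * ((sy * sy + cy * cy) - (sx * sx + cx * cx)) ≈
          (((sy - sx) - h * cx) + - ((sx - sy) - k * cy)) * (sy + sx) +
          (((cy - cx) + h * sx) + - ((cx - cy) + k * sy)) * (cy + cx)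
        expand sx sy cx cy h k p = lin≈ (sx ∷ sy ∷ cx ∷ cy ∷ h ∷ k ∷ [])
          ((sy * (cy + cx) - cy * (sy + sx)) · eq p)
        halve : ∀ {u v} → ∣ (1# + 1#) * u ∣ ≤ v + v → ∣ u ∣ ≤ v
        halve {u} {v} p = *-cancel-≤ {1# + 1#} (lin< [] 1+) (lin≤ (∣ u ∣ ∷ v ∷ ∣ (1# + 1#) * u ∣ ∷ [])
          (le p ⊕ eq (sym (trans (∣∣-* (1# + 1#) u) (*-congʳ (0≤⇒∣x∣≈x (lin≤ [] none)))))))
      constant-slope : ∀ {u v w} → ∣ u - v ∣ ≤ w → ∀ h → h * 0# - w ≤ u - v × h * 0# - w ≤ - u - - v
      constant-slope {u} {v} {w} p h = lin≤ (u ∷ v ∷ w ∷ h ∷ []) (le (∣∣-≤ʳ p)) , lin≤ (u ∷ v ∷ w ∷ h ∷ []) (le (∣∣-≤ˡ p))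
      q-lower : q 0# ≤ q b
      q-lower = from-slope (increment-bound 0≤b q K 0≤K (λ _ → 0#) 0#
        (λ x y 0≤x x≤y y≤b → proj₁ (constant-slope (q-increment x y 0≤x x≤y y≤b) (y - x))) (λ x _ _ → ≤-refl))
        where
        from-slope : ∀ {u v} → 0# * (b - 0#) ≤ v - u → u ≤ v
        from-slope {u} {v} p = lin≤ (u ∷ v ∷ b ∷ []) (le p)
      q-upper : q b ≤ q 0#
      q-upper = from-slope (increment-bound 0≤b (λ x → - q x) K 0≤K (λ _ → 0#) 0#
        (λ x y 0≤x x≤y y≤b → proj₂ (constant-slope (q-increment x y 0≤x x≤y y≤b) (y - x))) (λ x _ _ → ≤-refl))
        where
        from-slope : ∀ {u v} → 0# * (b - 0#) ≤ - v - - u → v ≤ u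
        from-slope {u} {v} p = lin≤ (u ∷ v ∷ b ∷ []) (le p)

    -- Linearising at 0 gives s x ≥ x - M x², which is positive up to 1 / (1 + M); this radius also
    -- keeps x inside [0, 1].
    s-pos-near-0 : ∃ λ η → 0# < η × (∀ x → 0# < x → x ≤ η → 0# < s x)
    s-pos-near-0 with localBound 1# (<⇒≤ 0<1)
    ... | M , B = (1# + M) ⁻¹ , ⁻¹-pos 1+M>0 , λ x 0<x x≤η → pos x 0<x x≤η
      (s-increment 0# x ≤-refl (<⇒≤ 0<x) (x≤1 x 0<x x≤η))
      where
      open Bounds B
      1+M>0 : 0# < 1# + M
      1+M>0 = lin< (M ∷ []) (le 0≤M ⊕ 1+)
      x≤1 : ∀ x → 0# < x → x ≤ (1# + M) ⁻¹ → x ≤ 1#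
      x≤1 x 0<x x≤η = lin≤ (x ∷ M ∷ (1# + M) ⁻¹ ∷ [])
        (lt 1+M>0 ⊗ le x≤η ⊕ eq (⁻¹-inverse (<⇒≉ 1+M>0)) ⊕ le 0≤M ⊗ lt 0<x)
      pos : ∀ x → 0# < x → x ≤ (1# + M) ⁻¹ → (x - 0#) * c 0# - M * ((x - 0#) * (x - 0#)) ≤ s x - s 0# → 0# < s x
      pos x 0<x x≤η p = lin< (x ∷ M ∷ (1# + M) ⁻¹ ∷ c 0# ∷ s 0# ∷ s x ∷ [])
        (le p ⊕ eq (sym s-zero) ⊕ x · eq (sym c-zero) ⊕ lt 0<x ⊗ lt 0<x
          ⊕ lt 0<x ⊗ (lt 1+M>0 ⊗ le x≤η ⊕ eq (⁻¹-inverse (<⇒≉ 1+M>0))))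

    s-pos : ∀ b → (∀ x → 0# < x → x ≤ b → ¬ s x ≈ 0#) → ∀ x → 0# < x → x ≤ b → 0# < s x
    s-pos b nonzero x 0<x x≤b =
      let η , 0<η , pos = s-pos-near-0
          0<a = min-glb-< 0<η 0<x
      in go (min η x) 0<a (min-≤ʳ η x) (pos (min η x) 0<a (min-≤ˡ η x)) (localBound x (<⇒≤ 0<x))
      where
      go : ∀ a → 0# < a → a ≤ x → 0# < s a → ∃ (LocalBounds s c x) → 0# < s x
      go a 0<a a≤x 0<sa (M , B) = intermediate-value a≤x s K (0≤K (<⇒≤ 0<x))
        (λ y z a≤y → s-lipschitz y z (≤-trans (<⇒≤ 0<a) a≤y))
        (λ y a≤y y≤x → nonzero y (<-≤-trans 0<a a≤y) (≤-trans y≤x x≤b)) 0<sa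
        where open Bounds B

    -- Without zeros s stays positive, so that c decreases.  If c becomes
    -- negative, s decreases at least linearly; otherwise s increases, and c
    -- decreases at least linearly.  Neither is possible.
    s-has-zero : ∃ λ z → 0# < z × s z ≈ 0#
    s-has-zero with decide (∃ λ z → 0# < z × s z ≈ 0#)
    ... | yes z = z
    ... | no ¬z = ⊥-elim (impossible (decide (∃ λ x → 0# ≤ x × c x < 0#)))
      where
      pos : ∀ x → 0# < x → 0# < s x
      pos x 0<x = s-pos x (λ y 0<y _ sy≈0 → ¬z (y , 0<y , sy≈0)) x 0<x ≤-refl
      nonNeg : ∀ x → 0# ≤ x → 0# ≤ s x
      nonNeg x 0≤x with ≤-or-> x 0#
      ... | inj₂ 0<x = <⇒≤ (pos x 0<x)
      ... | inj₁ x≤0 with localBound x 0≤x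
      ...   | M , B = lin≤ (s x ∷ s 0# ∷ M ∷ x ∷ [])
        (le (∣∣-≤ʳ (s-lipschitz 0# x ≤-refl 0≤x ≤-refl)) ⊕ eq (sym s-zero) ⊕ le (0≤K 0≤x) ⊗ le x≤0)
        where open Bounds B
      impossible : Dec (∃ λ x → 0# ≤ x × c x < 0#) → ⊥
      impossible (yes (x₀ , 0≤x₀ , cx₀<0)) = refute (x₀ ∷ s x₀ ∷ c x₀ ∷ s b ∷ w ∷ [])
        (le (s-antitone 0≤x₀ x₀≤b (- c x₀) c-below) ⊕ le (nonNeg b (≤-trans 0≤x₀ x₀≤b))
          ⊕ (s x₀ + 1#) · eq (sym (⁻¹-inverse (<⇒≉ 0<-c))))
        where
        0<-c : 0# < - c x₀
        0<-c = lin< (c x₀ ∷ []) (lt cx₀<0)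
        w b : ℝ
        w = (- c x₀) ⁻¹
        b = x₀ + (s x₀ + 1#) * w
        x₀≤b : x₀ ≤ b
        x₀≤b = lin≤ (x₀ ∷ s x₀ ∷ w ∷ []) ((le (nonNeg x₀ 0≤x₀) ⊕ 1+) ⊗ lt (⁻¹-pos 0<-c))
        c-below : ∀ x → x₀ ≤ x → x ≤ b → - c x₀ ≤ - c x
        c-below x x₀≤x _ = lin≤ (x₀ ∷ x ∷ c x₀ ∷ c x ∷ [])
          (le (c-antitone 0≤x₀ x₀≤x 0# (λ y x₀≤y _ → nonNeg y (≤-trans 0≤x₀ x₀≤y))))
      impossible (no ¬neg) = refute (c 1# ∷ s 1# ∷ c b ∷ w ∷ [])
        (le (c-antitone 0≤1 1≤b (s 1#) s-above) ⊕ le (c-nonNeg b (≤-trans 0≤1 1≤b))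
          ⊕ (c 1# + 1#) · eq (sym (⁻¹-inverse (<⇒≉ (pos 1# 0<1)))))
        where
        0≤1 : 0# ≤ 1#
        0≤1 = <⇒≤ 0<1
        c-nonNeg : ∀ x → 0# ≤ x → 0# ≤ c x
        c-nonNeg x 0≤x = ≮⇒≥ λ cx<0 → ¬neg (x , 0≤x , cx<0)
        w b : ℝ
        w = s 1# ⁻¹
        b = 1# + (c 1# + 1#) * w
        1≤b : 1# ≤ b
        1≤b = lin≤ (c 1# ∷ w ∷ []) ((le (c-nonNeg 1# 0≤1) ⊕ 1+) ⊗ lt (⁻¹-pos (pos 1# 0<1)))
        s-above : ∀ x → 1# ≤ x → x ≤ b → s 1# ≤ s x
        s-above x 1≤x _ = lin≤ (x ∷ s 1# ∷ s x ∷ [])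
          (le (s-monotone 0≤1 1≤x 0# (λ y 1≤y _ → c-nonNeg y (≤-trans 0≤1 1≤y))))

    IsLeastZero : ℝ → Set
    IsLeastZero p = 0# < p × s p ≈ 0# × (∀ x → 0# < x → s x ≈ 0# → p ≤ x)

    -- The supremum p of the lower bounds of all positive zeros. If s p were nonzero, the Lipschitz
    -- bound would exclude zeros within |s p| / (1 + K) beyond p, and a number above p would still
    -- be a lower bound.
    least-zero : ∃ IsLeastZero
    least-zero =
      let η , 0<η , pos = s-pos-near-0
          z , 0<z , sz≈0 = s-has-zero
          η-below : Below η
          η-below = λ x 0<x sx≈0 → ≮⇒≥ λ x<η → <⇒≉ (pos x 0<x (<⇒≤ x<η)) sx≈0
          p , ub , least = complete Below (η , η-below) (z , λ x below → below z 0<z sz≈0)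
          0<p = <-≤-trans 0<η (ub η η-below)
          p-below : Below p
          p-below = λ x 0<x sx≈0 → least x λ y below → below x 0<x sx≈0
      in p , 0<p , root p 0<p ub p-below , p-below
      where
      Below : ℝ → Set
      Below x = ∀ z → 0# < z → s z ≈ 0# → x ≤ z
      root : ∀ p → 0# < p → IsUpperBound Below p → Below p → s p ≈ 0#
      root p 0<p ub p-below with decide (s p ≈ 0#)
      ... | yes sp≈0 = sp≈0
      ... | no sp≉0 with localBound (p + 1#) (<⇒≤ (lin< (p ∷ []) (lt 0<p ⊕ 1+)))
      ...   | M , B = ⊥-elim (<⇒≱ (<-+-r (min 1# d) (min-glb-< 0<1 0<d)) (ub (p + min 1# d) p+r-below))
        where
        open Bounds B
        0<1+K : 0# < 1# + K
        0<1+K = <-≤-trans 0<1 (lin≤ (M ∷ p ∷ []) (le (0≤K (<⇒≤ (lin< (p ∷ []) (lt 0<p ⊕ 1+))))))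
        d : ℝ
        d = ∣ s p ∣ * (1# + K) ⁻¹
        0<d : 0# < d
        0<d = *-pos (≉0⇒0<∣x∣ sp≉0) (⁻¹-pos 0<1+K)
        <-+-r : ∀ r → 0# < r → p < p + r
        <-+-r r 0<r = lin< (p ∷ r ∷ []) (lt 0<r)
        contra : ∀ z w → p ≤ z → z < p + ∣ s p ∣ * w → s z ≈ 0# → ∣ s z - s p ∣ ≤ K * (z - p) → (1# + K) * w ≈ 1# → ⊥
        contra z w p≤z z<p+d sz≈0 lip inv = refute (p ∷ z ∷ M ∷ w ∷ ∣ s p ∣ ∷ ∣ s z - s p ∣ ∷ [])
          (lt 0<1+K ⊗ lt z<p+d ⊕ ∣ s p ∣ · eq inv ⊕ le lip ⊕ le p≤z
            ⊕ eq ∣sp∣≈)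
          where
          ∣sp∣≈ : ∣ s p ∣ ≈ ∣ s z - s p ∣
          ∣sp∣≈ = trans (sym (∣-x∣≈∣x∣ (s p))) (∣∣-cong (lin≈ (s z ∷ s p ∷ []) (eq (sym sz≈0))))
        p+r-below : Below (p + min 1# d)
        p+r-below z 0<z sz≈0 = ≮⇒≥ λ z<p+r → let p≤z = p-below z 0<z sz≈0 in
          contra z ((1# + K) ⁻¹) p≤z
            (<-≤-trans z<p+r (+-monoʳ-≤ (min-≤ʳ 1# d))) sz≈0
            (s-lipschitz p z (<⇒≤ 0<p) p≤z (≤-trans (<⇒≤ z<p+r) (+-monoʳ-≤ (min-≤ˡ 1# d))))
            (⁻¹-inverse (<⇒≉ 0<1+K))
          where
          +-monoʳ-≤ : ∀ {u v} → u ≤ v → p + u ≤ p + v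
          +-monoʳ-≤ {u} {v} u≤v = lin≤ (p ∷ u ∷ v ∷ []) (le u≤v)

    module _ (p : ℝ) (isLeastZero : IsLeastZero p) where

      private
        0<p = proj₁ isLeastZero

      s-pos-below-p : ∀ x → 0# < x → x < p → 0# < s x
      s-pos-below-p x 0<x x<p = s-pos x
        (λ y 0<y y≤x sy≈0 → <⇒≱ (≤-<-trans y≤x x<p) (proj₂ (proj₂ isLeastZero) y 0<y sy≈0)) x 0<x ≤-refl

      -- A bare function on the carrier need not respect `≈`; the Lipschitz bound forces it.
      s-cong : ∀ {x y} → 0# ≤ x → 0# ≤ y → x ≈ y → s x ≈ s y
      s-cong {x} {y} 0≤x 0≤y x≈y with localBound y 0≤y
      ... | M , B = antisym
        (lin≤ (x ∷ y ∷ s x ∷ s y ∷ M ∷ []) (le (∣∣-≤ʳ lip) ⊕ K · eq (sym x≈y)))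
        (lin≤ (x ∷ y ∷ s x ∷ s y ∷ M ∷ []) (le (∣∣-≤ˡ lip) ⊕ K · eq (sym x≈y)))
        where
        open Bounds B
        lip : ∣ s y - s x ∣ ≤ K * (y - x)
        lip = s-lipschitz x y 0≤x (≤-reflexive x≈y) ≤-refl

      s-nonNeg : ∀ x → 0# ≤ x → x ≤ p → 0# ≤ s x
      s-nonNeg x 0≤x x≤p with trichotomy 0# x | trichotomy x p
      ... | equal 0≈x   | _           = ≤-reflexive (trans (sym s-zero) (s-cong ≤-refl 0≤x 0≈x))
      ... | greater x<0 | _           = ⊥-elim (<⇒≱ x<0 0≤x)
      ... | less 0<x    | less x<p    = <⇒≤ (s-pos-below-p x 0<x x<p)
      ... | less 0<x    | equal x≈p   =
        ≤-reflexive (sym (trans (s-cong 0≤x (<⇒≤ 0<p) x≈p) (proj₁ (proj₂ isLeastZero))))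
      ... | less 0<x    | greater p<x = ⊥-elim (<⇒≱ p<x x≤p)

      -- As s p = 0, a nonnegative c p would be 1. Since c decreases on [p / 2, p], it would be at
      -- least 1 at p / 2 too, where s is positive, against Pythagoras.
      c-p<0 : c p < 0#
      c-p<0 with ≤-or-> 0# (c p)
      ... | inj₂ cp<0 = cp<0
      ... | inj₁ 0≤cp = ⊥-elim (<⇒≉ 0<s[p/2] (x*x≈0⇒x≈0 (antisym
          (lin≤ (s h ∷ c h ∷ []) (eq (pythagoras 0≤h) ⊕ le 1≤ch ⊗ (le 1≤ch ⊕ 1+ ⊕ 1+))) (0≤x*x (s h)))))
        where
        h : ℝ
        h = p * half
        0≤h : 0# ≤ h
        0≤h = <⇒≤ (half-pos 0<p)
        0<s[p/2] : 0# < s h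
        0<s[p/2] = s-pos-below-p h (half-pos 0<p) (half-< 0<p)
        1≤cp : 1# ≤ c p
        1≤cp = square-cancel-≤ 0≤cp (lin≤ (s p ∷ c p ∷ [])
          (eq (sym (pythagoras (<⇒≤ 0<p))) ⊕ s p · eq (proj₁ (proj₂ isLeastZero))))
        1≤ch : 1# ≤ c h
        1≤ch = lin≤ (c h ∷ c p ∷ p ∷ half ∷ []) (le 1≤cp ⊕
          le (c-antitone 0≤h (<⇒≤ (half-< 0<p)) 0# (λ x h≤x x≤p → s-nonNeg x (≤-trans 0≤h h≤x) x≤p)))

      -- If c missed the value t, then c - t would stay positive from 0 up to p, where c is
      -- negative. The range [0, 1] is the one of |(g_i , g_j)|.
      c-surjective : ∀ t → 0# ≤ t → t ≤ 1# → ∃ λ x → 0# ≤ x × x ≤ p × c x ≈ t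
      c-surjective t 0≤t t≤1 with decide (∃ λ x → 0# ≤ x × x ≤ p × c x ≈ t)
      ... | yes x = x
      ... | no ¬x with localBound p (<⇒≤ 0<p)
      ...   | M , B = refute (c p ∷ t ∷ []) (lt (intermediate-value (<⇒≤ 0<p) (λ x → c x - t) K (0≤K (<⇒≤ 0<p))
        (λ x y 0≤x x≤y y≤p → ≤-resp (∣∣-cong (ring≈ (c x ∷ c y ∷ t ∷ []))) refl (c-lipschitz x y 0≤x x≤y y≤p))
        (λ x 0≤x x≤p cx-t≈0 → ¬x (x , 0≤x , x≤p , lin≈ (c x ∷ t ∷ []) (eq cx-t≈0)))
        start) ⊕ lt c-p<0 ⊕ le 0≤t)
        where
        open Bounds B
        start : 0# < c 0# - t
        start = lin≤ (c 0# ∷ t ∷ []) (le t≤1 ⊕ eq (sym c-zero)) ,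
          λ 0≈c-t → ¬x (0# , ≤-refl , <⇒≤ 0<p , lin≈ (c 0# ∷ t ∷ []) (eq (sym 0≈c-t)))

  -- The outcome of the trigonometry: the sine is nonnegative up to π, so its square, known from
  -- Pythagoras, determines it.
  sin-arccos : ∀ {t} → 0# ≤ t → t ≤ 1# → 0# ≤ sin (arccos t) × sin (arccos t) * sin (arccos t) ≈ 1# - t * t
  sin-arccos {t} 0≤t t≤1 = go (arccos t) (choose-spec 0# (λ α → 0# ≤ α × α ≤ π × cos α ≈ t)
    (c-surjective sin cos sin-zero cos-zero localBounds π π-spec t 0≤t t≤1))
    where
    π-spec : IsLeastZero sin cos sin-zero cos-zero localBounds π
    π-spec = choose-spec 0# _ (least-zero sin cos sin-zero cos-zero localBounds)
    go : ∀ α → 0# ≤ α × α ≤ π × cos α ≈ t → 0# ≤ sin α × sin α * sin α ≈ 1# - t * t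
    go α (0≤α , α≤π , cosα≈t) = s-nonNeg sin cos sin-zero cos-zero localBounds π π-spec α 0≤α α≤π ,
      lin≈ (sin α ∷ cos α ∷ t ∷ []) (eq (pythagoras sin cos sin-zero cos-zero localBounds 0≤α)
        ⊕ (cos α + t) · eq (sym cosα≈t))

  -- Vectors and balls in the plane.

  open GridTilings em realField using (K; α; δ; D; ε; Δ; υ)

  sum²-cong : ∀ {n} {u v : Fin n → ℝ²} → (∀ i → u i ≈² v i) → sum² u ≈² sum² v
  sum²-cong p = sum-cong-≋ (proj₁ ∘ p) , sum-cong-≋ (proj₂ ∘ p)

  ≈²-sym : ∀ {u v} → u ≈² v → v ≈² u
  ≈²-sym (p , q) = sym p , sym q

  ≈²-trans : ∀ {u v w} → u ≈² v → v ≈² w → u ≈² w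
  ≈²-trans (p , q) (r , s) = trans p r , trans q s

  lagrange : ∀ u v → ⟨ u , v ⟩ * ⟨ u , v ⟩ + det u v * det u v ≈ ⟨ u , u ⟩ * ⟨ v , v ⟩
  lagrange (u₁ , u₂) (v₁ , v₂) = ring≈ (u₁ ∷ u₂ ∷ v₁ ∷ v₂ ∷ [])

  if-does : ∀ {P A : Set} (d : Dec P) (C : A → Set) {a b : A} → (P → C a) → (¬ P → C b) → C (if does d then a else b)
  if-does (yes p) C f g = f p
  if-does (no ¬p) C f g = g ¬p

  -- Otherwise x - t² would have no zero on [0, 1 + x], although it is positive at 0 and negative at
  -- 1 + x.
  square-root : ∀ x → 0# < x → ∃ λ r → 0# < r × r * r ≈ x
  square-root x 0<x with decide (∃ λ r → 0# < r × r * r ≈ x)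
  ... | yes r = r
  ... | no ¬r = refute (x ∷ []) (lt (intermediate-value 0≤1+x (λ t → x - t * t) ((1# + x) + (1# + x))
      (lin≤ (x ∷ []) (le 0≤1+x ⊕ le 0≤1+x)) lipschitz nonzero (lin< (x ∷ []) (lt 0<x))) ⊕ lt 0<x ⊕ sq x ⊕ 1+)
    where
    0≤1+x : 0# ≤ 1# + x
    0≤1+x = lin≤ (x ∷ []) (lt 0<x ⊕ 1+)
    lipschitz : ∀ s t → 0# ≤ s → s ≤ t → t ≤ 1# + x →
      ∣ (x - t * t) - (x - s * s) ∣ ≤ ((1# + x) + (1# + x)) * (t - s)
    lipschitz s t 0≤s s≤t t≤ = ∣∣-≤
      (lin≤ (x ∷ s ∷ t ∷ []) (le s≤t ⊗ (le t≤ ⊕ le t≤ ⊕ le s≤t ⊕ le 0≤t ⊕ le 0≤t ⊕ le 0≤s ⊕ le 0≤s)))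
      (lin≤ (x ∷ s ∷ t ∷ []) (le s≤t ⊗ (le t≤ ⊕ le t≤ ⊕ le s≤t)))
      where
      0≤t : 0# ≤ t
      0≤t = ≤-trans 0≤s s≤t
    nonzero : ∀ t → 0# ≤ t → t ≤ 1# + x → ¬ x - t * t ≈ 0#
    nonzero t 0≤t _ p = ¬r (t , (0≤t , λ 0≈t → <⇒≉ 0<x (lin≈ (x ∷ t ∷ []) (eq p ⊕ t · eq (sym 0≈t)))) ,
      lin≈ (x ∷ t ∷ []) (eq (sym p)))

  ball-component₁ : ∀ {c r y} → Ball c r y → ∣ proj₁ y - proj₁ c ∣ ≤ r
  ball-component₁ {c₁ , c₂} {r} {y₁ , y₂} (0≤r , d<r²) = square-cancel-≤ 0≤r
    (lin≤ (c₁ ∷ c₂ ∷ y₁ ∷ y₂ ∷ r ∷ ∣ y₁ - c₁ ∣ ∷ []) (eq (∣x∣*∣x∣ (y₁ - c₁)) ⊕ lt d<r² ⊕ sq (y₂ - c₂)))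

  ball-component₂ : ∀ {c r y} → Ball c r y → ∣ proj₂ y - proj₂ c ∣ ≤ r
  ball-component₂ {c₁ , c₂} {r} {y₁ , y₂} (0≤r , d<r²) = square-cancel-≤ 0≤r
    (lin≤ (c₁ ∷ c₂ ∷ y₁ ∷ y₂ ∷ r ∷ ∣ y₂ - c₂ ∣ ∷ []) (eq (∣x∣*∣x∣ (y₂ - c₂)) ⊕ lt d<r² ⊕ sq (y₁ - c₁)))

  square-mono-≤ : ∀ {x k} → ∣ x ∣ ≤ k → x * x ≤ k * k
  square-mono-≤ {x} {k} p = lin≤ (∣ x ∣ ∷ x ∷ k ∷ [])
    (eq (sym (∣x∣*∣x∣ x)) ⊕ le p ⊗ (le 0≤∣ x ∣ ⊕ le 0≤∣ x ∣ ⊕ le p))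

  -- The factor 2, larger than the square root of 2, leaves room for strictness: 2 k² ≤ r² / 2 < r².
  components⇒ball : ∀ {c y r} k → 0# < r → k + k ≤ r → ∣ proj₁ y - proj₁ c ∣ ≤ k → ∣ proj₂ y - proj₂ c ∣ ≤ k → Ball c r y
  components⇒ball {c₁ , c₂} {y₁ , y₂} {r} k 0<r 2k≤r p q = <⇒≤ 0<r ,
    lin< (c₁ ∷ c₂ ∷ y₁ ∷ y₂ ∷ r ∷ k ∷ half ∷ [])
      (le (square-mono-≤ p) ⊕ le (square-mono-≤ q) ⊕ lt 0<half ⊗ lt 0<r ⊗ lt 0<r
        ⊕ lt 0<half ⊗ (le 2k≤r ⊗ (lt 0<r ⊕ le 0≤k ⊕ le 0≤k)) ⊕ (r * r - (k * k + k * k)) · eq half+half)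
    where
    0≤k : 0# ≤ k
    0≤k = ≤-trans 0≤∣ _ ∣ p

  -- Dividing by 1 + b rather than b covers b = 0 and leaves the spare d on the right, which yields
  -- strict bounds.
  *-inverse-≤ : ∀ {a b d} → 0# ≤ b → 0# ≤ d → d ≤ a * (1# + b) ⁻¹ → d * b ≤ a - d
  *-inverse-≤ {a} {b} {d} 0≤b 0≤d p = lin≤ (a ∷ b ∷ d ∷ (1# + b) ⁻¹ ∷ [])
    (lt 0<1+b ⊗ le p ⊕ a · eq (⁻¹-inverse (<⇒≉ 0<1+b)))
    where
    0<1+b : 0# < 1# + b
    0<1+b = lin< (b ∷ []) (le 0≤b ⊕ 1+)

  -- Norms on the plane and their unit spheres.

  record IsNorm (ν : ℝ² → ℝ) : Set where
    field
      ν-cong      : ∀ {x y} → x ≈² y → ν x ≈ ν y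
      triangle    : ∀ x y → ν (x +² y) ≤ ν x + ν y
      homogeneous : ∀ t x → ν (t ∙ x) ≈ ∣ t ∣ * ν x
      definite    : ∀ {x} → ν x ≈ 0# → x ≈² 0²

  module UnitSphere (ν : ℝ² → ℝ) (isNorm : IsNorm ν) where
    open IsNorm isNorm

    ν-zero : ν 0² ≈ 0#
    ν-zero = trans (ν-cong (sym (zeroˡ 0#) , sym (zeroˡ 0#)))
      (trans (homogeneous 0# 0²) (trans (*-congʳ (0≤⇒∣x∣≈x ≤-refl)) (zeroˡ _)))

    ν-neg : ∀ x → ν (- 1# ∙ x) ≈ ν x
    ν-neg x = trans (homogeneous (- 1#) x) (trans (*-congʳ (trans (∣-x∣≈∣x∣ 1#) (0≤⇒∣x∣≈x (<⇒≤ 0<1)))) (*-identityˡ _))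

    ν-nonNeg : ∀ x → 0# ≤ ν x
    ν-nonNeg x = *-cancel-≤ {1# + 1#} (lin< [] 1+) (lin≤ (ν x ∷ ν (x +² - 1# ∙ x) ∷ ν (- 1# ∙ x) ∷ [])
      (eq (sym (trans (ν-cong {x +² - 1# ∙ x} {0²} (ring≈ (proj₁ x ∷ []) , ring≈ (proj₂ x ∷ []))) ν-zero))
        ⊕ le (triangle x (- 1# ∙ x)) ⊕ eq (ν-neg x)))

    -- Writing x in the standard basis bounds ν by L times a bound for both components; this makes ν
    -- Lipschitz on Euclidean balls.
    L : ℝ
    L = ν (1# , 0#) + ν (0# , 1#)

    0≤L : 0# ≤ L
    0≤L = +-nonNeg (ν-nonNeg _) (ν-nonNeg _)

    ν-bound : ∀ x k → ∣ proj₁ x ∣ ≤ k → ∣ proj₂ x ∣ ≤ k → ν x ≤ k * L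
    ν-bound x k p q = ≤-trans (≤-reflexive (ν-cong {y = proj₁ x ∙ (1# , 0#) +² proj₂ x ∙ (0# , 1#)}
        (ring≈ (proj₁ x ∷ proj₂ x ∷ []) , ring≈ (proj₁ x ∷ proj₂ x ∷ []))))
      (≤-trans (triangle _ _) (combine (homogeneous _ _) (homogeneous _ _) (ν-nonNeg _) (ν-nonNeg _)))
      where
      combine : ∀ {u v a b} → u ≈ ∣ proj₁ x ∣ * a → v ≈ ∣ proj₂ x ∣ * b → 0# ≤ a → 0# ≤ b → u + v ≤ k * (a + b)
      combine {u} {v} {a} {b} hu hv 0≤a 0≤b = lin≤ (u ∷ v ∷ a ∷ b ∷ k ∷ ∣ proj₁ x ∣ ∷ ∣ proj₂ x ∣ ∷ [])
        (eq hu ⊕ eq hv ⊕ le p ⊗ le 0≤a ⊕ le q ⊗ le 0≤b)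

    ν-difference : ∀ x y → ν y - ν x ≤ ν (y -² x)
    ν-difference x y = lin≤ (ν x ∷ ν y ∷ ν (y -² x) ∷ []) (le (≤-trans
      (≤-reflexive (ν-cong {y} {(y -² x) +² x} (ring≈ (proj₁ x ∷ proj₁ y ∷ []) , ring≈ (proj₂ x ∷ proj₂ y ∷ [])))) (triangle (y -² x) x)))

    ν-lipschitz : ∀ x y → ∣ ν y - ν x ∣ ≤ ν (y -² x)
    ν-lipschitz x y = ∣∣-≤ (ν-difference x y) (≤-trans (≤-trans (≤-reflexive (ring≈ (ν x ∷ ν y ∷ []))) (ν-difference y x))
      (≤-reflexive (trans (sym (ν-neg _)) (ν-cong (ring≈ (proj₁ x ∷ proj₁ y ∷ []) , ring≈ (proj₂ x ∷ proj₂ y ∷ []))))))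

    ball-ν : ∀ {c r y} → Ball c r y → ∣ ν y - ν c ∣ ≤ r * L
    ball-ν {c} {r} {y} b = ≤-trans (ν-lipschitz c y) (ν-bound (y -² c) r (ball-component₁ {c} {r} {y} b) (ball-component₂ {c} {r} {y} b))

    Sphere : Pred ℝ² 0ℓ
    Sphere z = ν z ≈ 1#

    -- The hypotheses make `H` the unit ball. A point of the sphere is left by stretching it
    -- slightly; around any other point a small ball stays on one side, since ν is Lipschitz.
    sphere≐∂ : (H : Pred ℝ² 0ℓ) → (∀ z → z ∈ H → ν z ≤ 1#) → (∀ z → ν z ≤ 1# → z ∈ H) → Sphere ≐ ∂ H
    sphere≐∂ H H⊆ ⊆H = (λ {z} νz≈1 → inside z νz≈1 , outside z νz≈1) , λ {z} → boundary z
      where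
      inside : ∀ z → ν z ≈ 1# → z ∈ Closure H
      inside z νz≈1 r 0<r = z , (<⇒≤ 0<r , lin< (proj₁ z ∷ proj₂ z ∷ r ∷ []) (lt 0<r ⊗ lt 0<r)) , ⊆H z (≤-reflexive νz≈1)
      outside : ∀ z → ν z ≈ 1# → z ∈ Closure (∁ H)
      outside z νz≈1 r 0<r = (1# + η) ∙ z ,
        components⇒ball {z} {(1# + η) ∙ z} (r * half) 0<r (≤-reflexive (lin≈ (r ∷ half ∷ []) (r · eq half+half)))
          (near (proj₁ z) (lin≤ (∣ proj₁ z ∣ ∷ ∣ proj₂ z ∣ ∷ []) (le 0≤∣ proj₂ z ∣)))
          (near (proj₂ z) (lin≤ (∣ proj₁ z ∣ ∷ ∣ proj₂ z ∣ ∷ []) (le 0≤∣ proj₁ z ∣))) ,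
        λ y∈H → <⇒≱ 1<ν (H⊆ _ y∈H)
        where
        m : ℝ
        m = ∣ proj₁ z ∣ + ∣ proj₂ z ∣
        0≤m : 0# ≤ m
        0≤m = +-nonNeg 0≤∣ _ ∣ 0≤∣ _ ∣
        0<1+m : 0# < 1# + m
        0<1+m = <-≤-trans 0<1 (≤-resp (+-identityʳ 1#) refl (lin≤ (∣ proj₁ z ∣ ∷ ∣ proj₂ z ∣ ∷ []) (le 0≤m)))
        η : ℝ
        η = r * half * (1# + m) ⁻¹
        0<η : 0# < η
        0<η = *-pos (half-pos 0<r) (⁻¹-pos 0<1+m)
        near : ∀ x → ∣ x ∣ ≤ m → ∣ (1# + η) * x - x ∣ ≤ r * half
        near x x≤m = ≤-trans (≤-reflexive (trans (∣∣-cong (difference η x)) (trans (∣∣-* η x) (*-congʳ (0≤⇒∣x∣≈x (<⇒≤ 0<η))))))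
          (close η ∣ x ∣ m (r * half) (<⇒≤ 0<η) x≤m (*-inverse-≤ 0≤m (<⇒≤ 0<η) ≤-refl))
          where
          difference : ∀ η x → (1# + η) * x - x ≈ η * x
          difference η x = ring≈ (η ∷ x ∷ [])
          close : ∀ η x m a → 0# ≤ η → x ≤ m → η * m ≤ a - η → η * x ≤ a
          close η x m a 0≤η x≤m p = lin≤ (η ∷ x ∷ m ∷ a ∷ []) (le p ⊕ le 0≤η ⊕ le 0≤η ⊗ le x≤m)
        1<ν : 1# < ν ((1# + η) ∙ z)
        1<ν = <-resp refl (sym (trans (homogeneous (1# + η) z) (trans (*-cong (0≤⇒∣x∣≈x (1+-nonNeg (<⇒≤ 0<η))) νz≈1) (*-identityʳ _))))
          (1<1+ 0<η)
          where
          1+-nonNeg : ∀ {x} → 0# ≤ x → 0# ≤ 1# + x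
          1+-nonNeg {x} p = lin≤ (x ∷ []) (le p ⊕ 1+)
          1<1+ : ∀ {x} → 0# < x → 1# < 1# + x
          1<1+ {x} p = lin< (x ∷ []) (lt p)
      gap : ∀ {a} → 0# < a → a * (1# + L) ⁻¹ * L < a
      gap {a} 0<a = ≤-<-trans (*-inverse-≤ 0≤L (<⇒≤ 0<d) ≤-refl) (shrink a (a * (1# + L) ⁻¹) 0<d)
        where
        0<d : 0# < a * (1# + L) ⁻¹
        0<d = *-pos 0<a (⁻¹-pos (<-≤-trans 0<1 (1≤1+ 0≤L)))
          where
          1≤1+ : ∀ {x} → 0# ≤ x → 1# ≤ 1# + x
          1≤1+ {x} p = lin≤ (x ∷ []) (le p)
        shrink : ∀ a d → 0# < d → a - d < a
        shrink a d 0<d = lin< (a ∷ d ∷ []) (lt 0<d)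
      radius-pos : ∀ {a} → 0# < a → 0# < a * (1# + L) ⁻¹
      radius-pos 0<a = *-pos 0<a (⁻¹-pos (<-≤-trans 0<1 (1≤1+ 0≤L)))
        where
        1≤1+ : ∀ {x} → 0# ≤ x → 1# ≤ 1# + x
        1≤1+ {x} p = lin≤ (x ∷ []) (le p)
      boundary : ∀ z → z ∈ ∂ H → ν z ≈ 1#
      boundary z (inner , outer) with trichotomy (ν z) 1#
      ... | equal νz≈1 = νz≈1
      ... | less νz<1 = let y , y∈B , y∉H = outer ((1# - ν z) * (1# + L) ⁻¹) (radius-pos (<⇒0<- νz<1)) in
        ⊥-elim (y∉H (⊆H y (<⇒≤ (tooLow (∣∣-≤ˡ (ball-ν {z} y∈B)) (gap (<⇒0<- νz<1))))))
        where
        tooLow : ∀ {a b d} → a - b ≤ d → d < 1# - b → a < 1#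
        tooLow {a} {b} {d} p q = lin< (a ∷ b ∷ d ∷ []) (le p ⊕ lt q)
      ... | greater 1<νz = let y , y∈B , y∈H = inner ((ν z - 1#) * (1# + L) ⁻¹) (radius-pos (<⇒0<- 1<νz)) in
        ⊥-elim (<⇒≱ (tooHigh (∣∣-≤ʳ (ball-ν {z} y∈B)) (gap (<⇒0<- 1<νz))) (H⊆ y y∈H))
        where
        tooHigh : ∀ {a b d} → - (a - b) ≤ d → d < b - 1# → 1# < a
        tooHigh {a} {b} {d} p q = lin< (a ∷ b ∷ d ∷ []) (le p ⊕ lt q)

    project : ℝ² → ℝ²
    project u = ν u ⁻¹ ∙ u

    unit⇒ν>0 : ∀ {u} → u ∈ IsUnit → 0# < ν u
    unit⇒ν>0 {u} u·u≈1 = ν-nonNeg u , λ 0≈ν → let p , q = definite (sym 0≈ν) in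
      0≉1 (lin≈ (proj₁ u ∷ proj₂ u ∷ []) (eq u·u≈1 ⊕ proj₁ u · eq (sym p) ⊕ proj₂ u · eq (sym q)))

    ν-project : ∀ {u} → 0# < ν u → ν (project u) ≈ 1#
    ν-project {u} 0<ν = trans (homogeneous _ u) (trans (*-congʳ (0≤⇒∣x∣≈x (<⇒≤ (⁻¹-pos 0<ν))))
      (trans (*-comm _ _) (⁻¹-inverse (<⇒≉ 0<ν))))

    project-continuous : ContinuousOn IsUnit project
    project-continuous u u·u≈1 e 0<e = d , 0<d , λ y y·y≈1 y∈B →
      let 0<νy = unit⇒ν>0 {y} y·y≈1 in
      components⇒ball {project u} {project y} (d * κ) 0<e 2dκ≤e
        (component (proj₁ y) (proj₁ u) (ν y) (ν y ⁻¹) (⁻¹-inverse (<⇒≉ 0<νy)) 0<νy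
          (ball-component₁ {u} {d} {y} y∈B) (ball-ν {u} {d} {y} y∈B) (∣u₁∣≤1 (proj₁ u) (proj₂ u) u·u≈1))
        (component (proj₂ y) (proj₂ u) (ν y) (ν y ⁻¹) (⁻¹-inverse (<⇒≉ 0<νy)) 0<νy
          (ball-component₂ {u} {d} {y} y∈B) (ball-ν {u} {d} {y} y∈B) (∣u₁∣≤1 (proj₂ u) (proj₁ u) (trans (+-comm _ _) u·u≈1)))
      where
      m w κ d : ℝ
      m = ν u
      w = m ⁻¹
      0<m : 0# < m
      0<m = unit⇒ν>0 {u} u·u≈1
      0<w : 0# < w
      0<w = ⁻¹-pos 0<m
      -- From v y - w x = v (y - x) + x v w (m - ν y) with v = 1 / ν y ≤ 2 w, |x| ≤ 1 and |m - ν y|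
      -- ≤ d L.
      κ = (w + w) + (w + w) * (w * L)
      0≤κ : 0# ≤ κ
      0≤κ = +-nonNeg 0≤2w (*-nonNeg 0≤2w (*-nonNeg (<⇒≤ 0<w) 0≤L))
        where
        0≤2w : 0# ≤ w + w
        0≤2w = +-nonNeg (<⇒≤ 0<w) (<⇒≤ 0<w)
      -- The first bound keeps ν y above m / 2, whence v ≤ 2 w; the second brings the resulting
      -- error below e.
      d = min (m * half * (1# + L) ⁻¹) (e * half * (1# + κ) ⁻¹)
      0<1+ : ∀ {x} → 0# ≤ x → 0# < 1# + x
      0<1+ {x} p = lin< (x ∷ []) (le p ⊕ 1+)
      0<d : 0# < d
      0<d = min-glb-< (*-pos (half-pos 0<m) (⁻¹-pos (0<1+ 0≤L))) (*-pos (half-pos 0<e) (⁻¹-pos (0<1+ 0≤κ)))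
      dL≤ : d * L ≤ m * half
      dL≤ = ≤-trans (*-inverse-≤ 0≤L (<⇒≤ 0<d) (min-≤ˡ _ _)) (drop (m * half) d (<⇒≤ 0<d))
        where
        drop : ∀ a d → 0# ≤ d → a - d ≤ a
        drop a d p = lin≤ (a ∷ d ∷ []) (le p)
      2dκ≤e : d * κ + d * κ ≤ e
      2dκ≤e = twice (d * κ) d (<⇒≤ 0<d) (*-inverse-≤ 0≤κ (<⇒≤ 0<d) (min-≤ʳ _ _))
        where
        twice : ∀ a d → 0# ≤ d → a ≤ e * half - d → a + a ≤ e
        twice a d 0≤d p = lin≤ (a ∷ d ∷ e ∷ half ∷ []) (le p ⊕ le p ⊕ le 0≤d ⊕ le 0≤d ⊕ e · eq half+half)
      ∣u₁∣≤1 : ∀ a b → a * a + b * b ≈ 1# → ∣ a ∣ ≤ 1#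
      ∣u₁∣≤1 a b p = square-cancel-≤ (<⇒≤ 0<1) (lin≤ (∣ a ∣ ∷ a ∷ b ∷ []) (eq (∣x∣*∣x∣ a) ⊕ eq p ⊕ sq b))
      component : ∀ y x νy v → νy * v ≈ 1# → 0# < νy → ∣ y - x ∣ ≤ d → ∣ νy - m ∣ ≤ d * L → ∣ x ∣ ≤ 1# → ∣ v * y - w * x ∣ ≤ d * κ
      component y x νy v νyv≈1 0<νy p q r = go m w d L m*w≈1 0<m 0<w (<⇒≤ 0<d) 0≤L dL≤ p q
        where
        m*w≈1 : m * w ≈ 1#
        m*w≈1 = ⁻¹-inverse (<⇒≉ 0<m)
        go : ∀ m w d L → m * w ≈ 1# → 0# < m → 0# < w → 0# ≤ d → 0# ≤ L → d * L ≤ m * half → ∣ y - x ∣ ≤ d → ∣ νy - m ∣ ≤ d * L →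
             ∣ v * y - w * x ∣ ≤ d * ((w + w) + (w + w) * (w * L))
        go m w d L mw≈1 0<m 0<w 0≤d 0≤L dL≤ p q =
          ≤-trans (≤-reflexive (∣∣-cong (lin≈ (v ∷ w ∷ x ∷ y ∷ νy ∷ m ∷ [])
              ((v * x) · eq (sym mw≈1) ⊕ (w * x) · eq νyv≈1))))
            (≤-trans (∣∣-+-≤ {v * (y - x)} {x * (v * (w * (m - νy)))}
              (∣∣-*-≤ ∣v∣≤2w p)
              (∣∣-*-≤ r (∣∣-*-≤ ∣v∣≤2w (∣∣-*-≤ ∣w∣≤w (≤-trans (≤-reflexive (∣x-y∣≈∣y-x∣ m νy)) q)))))
            (lin≤ (w ∷ d ∷ L ∷ []) none))
          where
          ∣w∣≤w : ∣ w ∣ ≤ w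
          ∣w∣≤w = ≤-reflexive (0≤⇒∣x∣≈x (<⇒≤ 0<w))
          0<v : 0# < v
          0<v = <-resp refl (⁻¹-unique νyv≈1) (⁻¹-pos 0<νy)
          m/2≤νy : m * half ≤ νy
          m/2≤νy = lin≤ (m ∷ half ∷ νy ∷ d ∷ L ∷ ∣ νy - m ∣ ∷ [])
            (le (-x≤∣x∣ (νy - m)) ⊕ le q ⊕ le dL≤ ⊕ m · eq half+half)
          ∣v∣≤2w : ∣ v ∣ ≤ w + w
          ∣v∣≤2w = ≤-trans (≤-reflexive (0≤⇒∣x∣≈x (<⇒≤ 0<v))) (lin≤ (v ∷ w ∷ m ∷ half ∷ νy ∷ [])
            ((le m/2≤νy ⊗ lt 0<v) ⊗ (lt 0<w ⊕ lt 0<w) ⊕ (w + w) · eq νyv≈1 ⊕ ((half + half) * v) · eq (sym mw≈1)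
              ⊕ v · eq (sym half+half)))

    -- Proportional unit vectors with positive factors agree: b u = a v gives b² = a² after taking
    -- lengths.
    project-injective : ∀ u v → u ∈ IsUnit → v ∈ IsUnit → project u ≈² project v → u ≈² v
    project-injective u v u·u≈1 v·v≈1 (p , q) =
      go (ν u) (ν v) (ν u ⁻¹) (ν v ⁻¹) (unit⇒ν>0 {u} u·u≈1) (unit⇒ν>0 {v} v·v≈1)
        (⁻¹-inverse (<⇒≉ (unit⇒ν>0 {u} u·u≈1))) (⁻¹-inverse (<⇒≉ (unit⇒ν>0 {v} v·v≈1)))
        (proj₁ u) (proj₂ u) (proj₁ v) (proj₂ v) p q u·u≈1 v·v≈1
      where
      go : ∀ a b y z → 0# < a → 0# < b → a * y ≈ 1# → b * z ≈ 1# → ∀ u₁ u₂ v₁ v₂ → y * u₁ ≈ z * v₁ → y * u₂ ≈ z * v₂ →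
           u₁ * u₁ + u₂ * u₂ ≈ 1# → v₁ * v₁ + v₂ * v₂ ≈ 1# → (u₁ , u₂) ≈² (v₁ , v₂)
      go a b y z 0<a 0<b ay≈1 bz≈1 u₁ u₂ v₁ v₂ p q hu hv =
        *-cancel-≈ (<⇒≉ 0<b) (trans (cross u₁ v₁ p) (*-congʳ a≈b)) , *-cancel-≈ (<⇒≉ 0<b) (trans (cross u₂ v₂ q) (*-congʳ a≈b))
        where
        cross : ∀ r s → y * r ≈ z * s → b * r ≈ a * s
        cross r s h = lin≈ (a ∷ b ∷ y ∷ z ∷ r ∷ s ∷ [])
          ((a * b) · eq h ⊕ (b * r) · eq (sym ay≈1) ⊕ (a * s) · eq bz≈1)
        b²≈a² : b * b ≈ a * a
        b²≈a² = lin≈ (a ∷ b ∷ u₁ ∷ u₂ ∷ v₁ ∷ v₂ ∷ [])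
          ((b * u₁ + a * v₁) · eq (cross u₁ v₁ p) ⊕ (b * u₂ + a * v₂) · eq (cross u₂ v₂ q)
            ⊕ (b * b) · eq (sym hu) ⊕ (a * a) · eq hv)
        a≈b : a ≈ b
        a≈b = antisym (square-cancel-≤ (<⇒≤ 0<b) (≤-reflexive (sym b²≈a²))) (square-cancel-≤ (<⇒≤ 0<a) (≤-reflexive b²≈a²))

    sphere⊆image : ∀ z → ν z ≈ 1# → ∃ λ u → u ∈ IsUnit × z ≈² project u
    sphere⊆image z νz≈1 = go (square-root ⟨ z , z ⟩ 0<z·z)
      where
      0<z·z : 0# < ⟨ z , z ⟩
      0<z·z = lin≤ (proj₁ z ∷ proj₂ z ∷ []) (sq (proj₁ z) ⊕ sq (proj₂ z)) , λ 0≈ → 0≉1 (trans (sym ν-zero) (trans (ν-cong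
        (sym (x*x≈0⇒x≈0 (antisym (lin≤ (proj₁ z ∷ proj₂ z ∷ []) (eq (sym 0≈) ⊕ sq (proj₂ z))) (0≤x*x _))) ,
         sym (x*x≈0⇒x≈0 (antisym (lin≤ (proj₁ z ∷ proj₂ z ∷ []) (eq (sym 0≈) ⊕ sq (proj₁ z))) (0≤x*x _))))) νz≈1))
      go : (∃ λ r → 0# < r × r * r ≈ ⟨ z , z ⟩) → ∃ λ u → u ∈ IsUnit × z ≈² project u
      go (r , 0<r , r²≈) = r ⁻¹ ∙ z ,
        lin≈ (r ⁻¹ ∷ r ∷ proj₁ z ∷ proj₂ z ∷ [])
          ((r ⁻¹ * r ⁻¹) · eq (sym r²≈) ⊕ (1# + r * r ⁻¹) · eq rr⁻¹≈1) ,
        scale (proj₁ z) , scale (proj₂ z)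
        where
        rr⁻¹≈1 : r * r ⁻¹ ≈ 1#
        rr⁻¹≈1 = ⁻¹-inverse (<⇒≉ 0<r)
        νu⁻¹≈r : ν (r ⁻¹ ∙ z) ⁻¹ ≈ r
        νu⁻¹≈r = ⁻¹-unique (trans (*-congʳ (trans (homogeneous (r ⁻¹) z) (trans (*-cong (0≤⇒∣x∣≈x (<⇒≤ (⁻¹-pos 0<r))) νz≈1) (*-identityʳ _))))
          (trans (*-comm _ _) rr⁻¹≈1))
        scale : ∀ x → x ≈ ν (r ⁻¹ ∙ z) ⁻¹ * (r ⁻¹ * x)
        scale x = sym (trans (*-congʳ νu⁻¹≈r) (lin≈ (r ∷ r ⁻¹ ∷ x ∷ []) (x · eq rr⁻¹≈1)))

    sphere-closedCurve : ClosedCurve Sphere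
    sphere-closedCurve = project , project-continuous , project-injective ,
      (λ {z} νz≈1 → sphere⊆image z νz≈1) ,
      λ { {z} (u , u·u≈1 , z≈) → trans (ν-cong z≈) (ν-project {u} (unit⇒ν>0 {u} u·u≈1)) }

  module ConvexNorm (ν : ℝ² → ℝ) (isNorm : IsNorm ν) where
    open IsNorm isNorm
    open UnitSphere ν isNorm

    ν-sum : ∀ {n} (p : Fin n → ℝ²) → ν (sum² p) ≤ sum (ν ∘ p)
    ν-sum {zero}  p = ≤-reflexive ν-zero
    ν-sum {suc n} p = ≤-trans (triangle (p zero) (sum² (p ∘ suc)))
      (lin≤ (ν (p zero) ∷ ν (sum² (p ∘ suc)) ∷ sum (ν ∘ p ∘ suc) ∷ []) (le (ν-sum (p ∘ suc))))

    convexHull⊆ball : ∀ {ℓ} {S : Pred ℝ² ℓ} → (∀ z → z ∈ S → ν z ≤ 1#) → ∀ z → z ∈ convexHull S → ν z ≤ 1#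
    convexHull⊆ball S⊆ z (n , w , p , 0≤w , Σw≈1 , p∈S , z≈) = ≤-trans (≤-reflexive (ν-cong z≈)) (≤-trans (ν-sum (λ k → w k ∙ p k))
      (≤-trans (sum-mono bound) (≤-reflexive Σw≈1)))
      where
      bound : ∀ k → ν (w k ∙ p k) ≤ w k
      bound k = ≤-trans (≤-reflexive (trans (homogeneous (w k) (p k)) (*-congʳ (0≤⇒∣x∣≈x (0≤w k)))))
        (scale (0≤w k) (S⊆ (p k) (p∈S k)))
        where
        scale : ∀ {a b} → 0# ≤ a → b ≤ 1# → a * b ≤ a
        scale {a} {b} 0≤a b≤1 = lin≤ (a ∷ b ∷ []) (le 0≤a ⊗ le b≤1)

  ∙-congˡ : ∀ {t u v} → u ≈² v → t ∙ u ≈² t ∙ v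
  ∙-congˡ (p , q) = *-congˡ p , *-congˡ q

  ∙-congʳ : ∀ {s t v} → s ≈ t → s ∙ v ≈² t ∙ v
  ∙-congʳ p = *-congʳ p , *-congʳ p

  +²-cong : ∀ {u v x y} → u ≈² v → x ≈² y → u +² x ≈² v +² y
  +²-cong (p , q) (r , s) = +-cong p r , +-cong q s

  -- Rounding of levels.

  -- The positions at which K may be placed over t: the interval between the
  -- one-sided limits of the ceiling function at t.
  Ceilings : ℝ → ℝ → Set
  Ceilings t κ = up t ≤ κ × κ ≤ dn t + 1#

  up-mono : ∀ {s t} → s ≤ t → up s ≤ up t
  up-mono {s} {t} s≤t = up-least (up-isInteger t) (≤-trans s≤t (t≤up t))

  dn-mono : ∀ {s t} → s ≤ t → dn s ≤ dn t
  dn-mono {s} {t} s≤t = dn-greatest (dn-isInteger s) (≤-trans (dn≤t s) s≤t)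

  up-cong : ∀ {s t} → s ≈ t → up s ≈ up t
  up-cong p = antisym (up-mono (≤-reflexive p)) (up-mono (≤-reflexive (sym p)))

  dn+1≤up : ∀ {s t} → s < t → dn s + 1# ≤ up t
  dn+1≤up {s} {t} s<t = integer-< (dn-isInteger s) (up-isInteger t) (≤-<-trans (dn≤t s) (<-≤-trans s<t (t≤up t)))

  up≤dn+1 : ∀ t → up t ≤ dn t + 1#
  up≤dn+1 t = integer-<+1 (up-isInteger t) (isInteger-+ (dn-isInteger t) isInteger-1)
    (lin< (up t ∷ dn t ∷ t ∷ []) (lt (up<t+1 t) ⊕ lt (t<dn+1 t)))

  dn≤up : ∀ t → dn t ≤ up t
  dn≤up t = ≤-trans (dn≤t t) (t≤up t)

  integer-rounding : ∀ {t} → IsInteger t → up t ≈ t × dn t ≈ t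
  integer-rounding {t} int = antisym (up-least int ≤-refl) (t≤up t) , antisym (dn≤t t) (dn-greatest int ≤-refl)

  noninteger-rounding : ∀ {t} → ¬ IsInteger t → up t ≈ dn t + 1#
  noninteger-rounding {t} ¬int = antisym (up≤dn+1 t) (integer-< (dn-isInteger t) (up-isInteger t)
    (<-≤-trans (dn≤t t , λ dn≈t → ¬int (isInteger-resp dn≈t (dn-isInteger t))) (t≤up t)))

  -- Twice t, rounded so that the value is even exactly at the integers.
  abstract
    E : ℝ → ℝ
    E t = up t + dn t

    E-def : ∀ t → E t ≈ up t + dn t
    E-def t = refl

  E-mono : ∀ {s t} → s ≤ t → E s ≤ E t
  E-mono {s} {t} s≤t = lin≤ (E s ∷ E t ∷ up s ∷ up t ∷ dn s ∷ dn t ∷ [])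
    (eq (E-def s) ⊕ eq (sym (E-def t)) ⊕ le (up-mono s≤t) ⊕ le (dn-mono s≤t))

  -- Arriving at the integer k raises the floor; in `E-strictʳ`, leaving it raises the ceiling. Each
  -- is half a passage of the line.
  E-strictˡ : ∀ {s k t} → IsInteger k → s < k → k ≤ t → E s + 1# ≤ E t
  E-strictˡ {s} {k} {t} int s<k k≤t = lin≤ (E s ∷ E t ∷ up s ∷ up t ∷ dn s ∷ dn t ∷ k ∷ [])
    (eq (E-def s) ⊕ eq (sym (E-def t)) ⊕ le (up-mono (≤-trans (<⇒≤ s<k) k≤t))
      ⊕ le (integer-< (dn-isInteger s) int (≤-<-trans (dn≤t s) s<k)) ⊕ le (dn-greatest int k≤t))

  E-strictʳ : ∀ {s k t} → IsInteger k → s ≤ k → k < t → E s + 1# ≤ E t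
  E-strictʳ {s} {k} {t} int s≤k k<t = lin≤ (E s ∷ E t ∷ up s ∷ up t ∷ dn s ∷ dn t ∷ k ∷ [])
    (eq (E-def s) ⊕ eq (sym (E-def t)) ⊕ le (dn-mono (≤-trans s≤k (<⇒≤ k<t)))
      ⊕ le (integer-< int (up-isInteger t) (<-≤-trans k<t (t≤up t))) ⊕ le (up-least int s≤k))

  E-integer : ∀ {t} → IsInteger t → E t ≈ t + t
  E-integer {t} int = trans (E-def t) (+-cong (proj₁ (integer-rounding int)) (proj₂ (integer-rounding int)))

  E≤2t+1 : ∀ t → E t ≤ t + t + 1#
  E≤2t+1 t = lin≤ (E t ∷ up t ∷ dn t ∷ t ∷ []) (eq (E-def t) ⊕ lt (up<t+1 t) ⊕ le (dn≤t t))

  2t≤E+1 : ∀ t → t + t ≤ E t + 1#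
  2t≤E+1 t = lin≤ (E t ∷ up t ∷ dn t ∷ t ∷ []) (eq (sym (E-def t)) ⊕ le (t≤up t) ⊕ lt (t<dn+1 t))

  abstract
    -- The width of the interval `Ceilings t`: 1 at the integers and 0 elsewhere.
    integrality : ℝ → ℝ
    integrality t = dn t + 1# - up t

    integrality-def : ∀ t → integrality t ≈ dn t + 1# - up t
    integrality-def t = refl

  integrality≤1 : ∀ t → integrality t ≤ 1#
  integrality≤1 t = lin≤ (integrality t ∷ up t ∷ dn t ∷ []) (eq (integrality-def t) ⊕ le (dn≤up t))

  integrality-noninteger : ∀ {t} → ¬ IsInteger t → integrality t ≈ 0#
  integrality-noninteger {t} ¬int = lin≈ (integrality t ∷ up t ∷ dn t ∷ [])
    (eq (integrality-def t) ⊕ eq (sym (noninteger-rounding ¬int)))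

  -- A common position squeezes up t ≤ κ ≤ dn s + 1, so no integer lies strictly between s and t,
  -- and only integers at the ends are left to count.
  E-near : ∀ {s t κ} → s < t → Ceilings s κ → Ceilings t κ → ∣ E t - E s ∣ ≤ integrality s + integrality t
  E-near {s} {t} {κ} s<t (_ , κ≤) (≤κ , _) = ∣∣-≤
    (lin≤ (E s ∷ E t ∷ up s ∷ up t ∷ dn s ∷ dn t ∷ integrality s ∷ integrality t ∷ κ ∷ [])
      (eq (sym (E-def s)) ⊕ eq (E-def t) ⊕ eq (sym (integrality-def s)) ⊕ eq (sym (integrality-def t)) ⊕ le κ≤ ⊕ le ≤κ ⊕ le κ≤ ⊕ le ≤κ))
    (≤-trans (lin≤ (E s ∷ E t ∷ []) (le (E-mono (<⇒≤ s<t)))) (+-nonNeg (integrality-nonNeg s) (integrality-nonNeg t)))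
    where
    integrality-nonNeg : ∀ t → 0# ≤ integrality t
    integrality-nonNeg t = lin≤ (integrality t ∷ up t ∷ dn t ∷ []) (eq (sym (integrality-def t)) ⊕ le (up≤dn+1 t))

  -- Segments and connectedness.

  segment : ℝ² → ℝ² → ℝ → ℝ²
  segment a b t = a +² t ∙ (b -² a)

  scaleFor : ℝ² → ℝ² → ℝ → ℝ
  scaleFor a b r = r * half * (1# + (∣ proj₁ b - proj₁ a ∣ + ∣ proj₂ b - proj₂ a ∣)) ⁻¹

  0≤size : ∀ a b → 0# ≤ ∣ proj₁ b - proj₁ a ∣ + ∣ proj₂ b - proj₂ a ∣
  0≤size a b = +-nonNeg 0≤∣ _ ∣ 0≤∣ _ ∣

  scaleFor-pos : ∀ a b {r} → 0# < r → 0# < scaleFor a b r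
  scaleFor-pos a b 0<r = *-pos (half-pos 0<r) (⁻¹-pos (0<1+ (0≤size a b)))
    where
    0<1+ : ∀ {x} → 0# ≤ x → 0# < 1# + x
    0<1+ {x} p = lin< (x ∷ []) (le p ⊕ 1+)

  segment-near : ∀ a b s t {r} → 0# < r → ∣ s - t ∣ ≤ scaleFor a b r → Ball (segment a b t) r (segment a b s)
  segment-near a b s t {r} 0<r p = components⇒ball {segment a b t} {segment a b s} (r * half) 0<r
    (≤-reflexive (trans (sym (distribˡ r half half)) (trans (*-congˡ half+half) (*-identityʳ r))))
    (component (proj₁ a) (proj₁ b) (≤-resp (+-identityʳ _) refl (+-monoʳ 0≤∣ proj₂ b - proj₂ a ∣)))
    (component (proj₂ a) (proj₂ b) (≤-resp (+-identityˡ _) refl (+-monoˡ-≤ _ 0≤∣ proj₁ b - proj₁ a ∣)))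
    where
    +-monoʳ : ∀ {x y z} → y ≤ z → x + y ≤ x + z
    +-monoʳ {x} {y} {z} p = lin≤ (x ∷ y ∷ z ∷ []) (le p)
    m : ℝ
    m = ∣ proj₁ b - proj₁ a ∣ + ∣ proj₂ b - proj₂ a ∣
    component : ∀ a b → ∣ b - a ∣ ≤ m → ∣ (a + s * (b - a)) - (a + t * (b - a)) ∣ ≤ r * half
    component a b q = ≤-trans (≤-reflexive (∣∣-cong (factor a b))) (≤-trans (∣∣-*-≤ ≤-refl q)
      (drop (*-inverse-≤ (0≤size _ _) 0≤∣ s - t ∣ p) 0≤∣ s - t ∣))
      where
      factor : ∀ a b → (a + s * (b - a)) - (a + t * (b - a)) ≈ (s - t) * (b - a)
      factor a b = ring≈ (a ∷ b ∷ s ∷ t ∷ [])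
      drop : ∀ {x y d} → x ≤ y - d → 0# ≤ d → x ≤ y
      drop {x} {y} {d} p q = lin≤ (x ∷ y ∷ d ∷ []) (le p ⊕ le q)

  -- If A and B did not meet in S, membership in A would propagate along the segment from a to b,
  -- first locally by openness and then by `local⇒global`; the end of the segment would be in both.
  convex⇒connected : (S : Pred ℝ² 0ℓ) → (∀ a b t → a ∈ S → b ∈ S → 0# ≤ t → t ≤ 1# → segment a b t ∈ S) → Connected S
  convex⇒connected S convex A B A-open B-open S⊆A∪B (a , a∈S , a∈A) (b , b∈S , b∈B) with decide (S ≬ (A ∩ B))
  ... | yes meet = meet
  ... | no ¬meet = ⊥-elim (¬meet (b′ , b′∈S , b′∈A , b′∈B))
    where
    γ : ℝ → ℝ²
    γ = segment a b
    γ∈S : ∀ t → 0# ≤ t → t ≤ 1# → γ t ∈ S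
    γ∈S t = convex a b t a∈S b∈S
    close : ∀ t u {r} → t - r < u → u ≤ t → ∣ u - t ∣ ≤ r
    close t u {r} p q = ∣∣-≤ (≤-trans {j = 0#} (lin≤ (t ∷ u ∷ []) (le q)) (lin≤ (t ∷ u ∷ r ∷ []) (le q ⊕ lt p)))
      (lin≤ (t ∷ u ∷ r ∷ []) (lt p))
    close′ : ∀ t u {r} → t ≤ u → u < t + r → ∣ u - t ∣ ≤ r
    close′ t u {r} p q = ∣∣-≤ (lin≤ (t ∷ u ∷ r ∷ []) (lt q))
      (≤-trans {j = 0#} (lin≤ (t ∷ u ∷ []) (le p)) (lin≤ (t ∷ u ∷ r ∷ []) (le p ⊕ lt q)))
    A⇒A : A (γ 0#) → A (γ 1#)
    A⇒A = local⇒global 0# 1# (<⇒≤ 0<1) (λ s t → A (γ s) → A (γ t)) (λ p q → q ∘ p) local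
      where
      local : ∀ t → 0# ≤ t → t ≤ 1# → ∃ λ d → 0# < d × (∀ s → 0# ≤ s → s ≤ 1# →
        (t - d < s → s ≤ t → A (γ s) → A (γ t)) × (t ≤ s → s < t + d → A (γ t) → A (γ s)))
      local t 0≤t t≤1 with S⊆A∪B (γ∈S t 0≤t t≤1)
      ... | inj₁ t∈A = let r , 0<r , ball⊆A = A-open (γ t) t∈A in scaleFor a b r , scaleFor-pos a b 0<r , λ s 0≤s s≤1 →
        (λ _ _ _ → t∈A) , (λ t≤s s<t+d _ → ball⊆A {γ s} (segment-near a b s t 0<r (close′ t s t≤s s<t+d)))
      ... | inj₂ t∈B = let r , 0<r , ball⊆B = B-open (γ t) t∈B in scaleFor a b r , scaleFor-pos a b 0<r , λ s 0≤s s≤1 →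
        (λ t-d<s s≤t s∈A → ⊥-elim (¬meet (γ s , γ∈S s 0≤s s≤1 , s∈A ,
          ball⊆B {γ s} (segment-near a b s t 0<r (close t s t-d<s s≤t))))) ,
        (λ _ _ t∈A → ⊥-elim (¬meet (γ t , γ∈S t 0≤t t≤1 , t∈A , t∈B)))
    b′ : ℝ²
    b′ = γ 1#
    b′∈S : b′ ∈ S
    b′∈S = γ∈S 1# (<⇒≤ 0<1) ≤-refl
    open-resp : ∀ {P : Pred ℝ² 0ℓ} → Open P → ∀ {x y} → proj₁ x ≈ proj₁ y → proj₂ x ≈ proj₂ y → P x → P y
    open-resp P-open {x} {y} p q x∈P = let r , 0<r , ball⊆P = P-open x x∈P in
      ball⊆P {y} (<⇒≤ 0<r , <-resp (sym (trans (+-cong (vanish p) (vanish q)) (+-identityʳ 0#))) refl (*-pos 0<r 0<r))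
      where
      vanish : ∀ {u v} → u ≈ v → (v - u) * (v - u) ≈ 0#
      vanish {u} {v} p = lin≈ (u ∷ v ∷ []) ((v - u) · eq (sym p))
    b′∈A : A b′
    b′∈A = A⇒A (open-resp A-open {a} {γ 0#} (start (proj₁ a)) (start (proj₂ a)) a∈A)
      where
      start : ∀ x {y} → x ≈ x + 0# * y
      start x {y} = ring≈ (x ∷ y ∷ [])
    b′∈B : B b′
    b′∈B = open-resp B-open {b} {γ 1#} (end (proj₁ a) (proj₁ b)) (end (proj₂ a) (proj₂ b)) b∈B
      where
      end : ∀ x y → y ≈ x + 1# * (y - x)
      end x y = ring≈ (x ∷ y ∷ [])

  -- Sets of zero and of positive length.

  ball-projection : ∀ {c r y u} → IsUnit u → Ball c r y → ∣ ⟨ y -² c , u ⟩ ∣ < r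
  ball-projection {c} {r} {y} {u} u·u≈1 (0≤r , d<r²) = go (lagrange (y -² c) u) d<r²
    where
    go : ∀ {p q d} → p * p + q * q ≈ d * ⟨ u , u ⟩ → d < r * r → ∣ p ∣ < r
    go {p} {q} {d} h d<r² = ≰⇒> λ r≤∣p∣ → refute (p ∷ q ∷ d ∷ r ∷ ∣ p ∣ ∷ [])
      (eq (trans h (trans (*-congˡ u·u≈1) (*-identityʳ d))) ⊕ lt d<r² ⊕ sq q ⊕ eq (∣x∣*∣x∣ p)
        ⊕ le r≤∣p∣ ⊗ (le r≤∣p∣ ⊕ le 0≤r ⊕ le 0≤r))

  term≤partial : ∀ {a : ℕ → ℝ} → (∀ n → 0# ≤ a n) → ∀ n → a n ≤ partial a (suc n)
  term≤partial {a} 0≤a n = lin≤ (partial a n ∷ a n ∷ []) (le (partial-nonNeg n))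
    where
    partial-nonNeg : ∀ n → 0# ≤ partial a n
    partial-nonNeg zero    = ≤-refl
    partial-nonNeg (suc n) = +-nonNeg (partial-nonNeg n) (0≤a n)

  partial-mono : ∀ {a : ℕ → ℝ} → (∀ n → 0# ≤ a n) → ∀ {m n} → m ℕ.≤ n → partial a m ≤ partial a n
  partial-mono {a} 0≤a {m} {n} = nondecreasing {partial a} (λ n → lin≤ (partial a n ∷ a n ∷ []) (le (0≤a n))) m n

  abstract
    -- Truncation to [-r, r]. The increment of the truncated t - c over [s, t] is the length that
    -- the interval of centre c and radius r cuts out of [s, t].
    clamp : ℝ → ℝ → ℝ
    clamp r x = - min r (- min r x)

    min-mono : ∀ r {x y} → x ≤ y → min r x ≤ min r y
    min-mono r {x} {y} x≤y = min-glb (min-≤ˡ r x) (≤-trans (min-≤ʳ r x) x≤y)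

    neg-anti : ∀ {x y} → x ≤ y → - y ≤ - x
    neg-anti {x} {y} p = lin≤ (x ∷ y ∷ []) (le p)

    clamp-mono : ∀ r {x y} → x ≤ y → clamp r x ≤ clamp r y
    clamp-mono r p = neg-anti (min-mono r (neg-anti (min-mono r p)))

    -≤clamp : ∀ {r x} → 0# ≤ r → - r ≤ clamp r x
    -≤clamp {r} {x} _ = neg-anti (min-≤ˡ r _)

    clamp-≤ : ∀ {r x} → 0# ≤ r → clamp r x ≤ r
    clamp-≤ {r} {x} 0≤r = flip-neg (min-glb (lin≤ (r ∷ []) (le 0≤r ⊕ le 0≤r)) (neg-anti (min-≤ˡ r x)))
      where
      flip-neg : ∀ {x y} → - y ≤ x → - x ≤ y
      flip-neg {x} {y} p = lin≤ (x ∷ y ∷ []) (le p)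

    clamp-id : ∀ {r x} → ∣ x ∣ ≤ r → clamp r x ≈ x
    clamp-id {r} {x} p = trans (-‿cong (trans (min-id (≤-trans (≤-reflexive (-‿cong (min-id (∣∣-≤ˡ p)))) (∣∣-≤ʳ p)))
      (-‿cong (min-id (∣∣-≤ˡ p))))) (ring≈ (x ∷ []))
      where
      min-id : ∀ {y} → y ≤ r → min r y ≈ y
      min-id {y} q = antisym (min-≤ʳ r y) (min-glb q ≤-refl)

  -- The lengths that the first m intervals cut out of [s, t] add up to at
  -- least t - s for some m; this relation is transitive and, since the
  -- intervals are open, holds locally.
  intervals-cover : ∀ (c r : ℕ → ℝ) M → (∀ n → 0# ≤ r n) → (∀ m → partial r m ≤ M) →
    (∀ t → 0# ≤ t → t ≤ 1# → ∃ λ n → ∣ t - c n ∣ < r n) → 1# ≤ M + M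
  intervals-cover c r M 0≤r bounded cover = conclude (local⇒global 0# 1# (<⇒≤ 0<1) Covered transitive local)
    where
    φ : ℕ → ℝ → ℝ
    φ n t = clamp (r n) (t - c n)
    increment : ℝ → ℝ → ℕ → ℝ
    increment s t n = φ n t - φ n s
    0≤increment : ∀ {s t} → s ≤ t → ∀ n → 0# ≤ increment s t n
    0≤increment {s} {t} s≤t n = ≤⇒0≤- (clamp-mono (r n) (+-monoˡ-≤ _ s≤t))
    Covered : ℝ → ℝ → Set
    Covered s t = s ≤ t × ∃ λ m → t - s ≤ partial (increment s t) m
    transitive : ∀ {s t u} → Covered s t → Covered t u → Covered s u
    transitive {s} {t} {u} (s≤t , m , p) (t≤u , m′ , q) = ≤-trans s≤t t≤u , m ℕ.⊔ m′ , ≤-trans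
      (sum-≤ (≤-trans p (partial-mono (0≤increment s≤t) (ℕₚ.m≤m⊔n m m′))) (≤-trans q (partial-mono (0≤increment t≤u) (ℕₚ.m≤n⊔m m m′))))
      (≤-reflexive (additive (m ℕ.⊔ m′)))
      where
      sum-≤ : ∀ {a b} → t - s ≤ a → u - t ≤ b → u - s ≤ a + b
      sum-≤ {a} {b} p q = lin≤ (s ∷ t ∷ u ∷ a ∷ b ∷ []) (le p ⊕ le q)
      additive : ∀ m → partial (increment s t) m + partial (increment t u) m ≈ partial (increment s u) m
      additive zero    = +-identityʳ 0#
      additive (suc m) = telescope (additive m)
        where
        telescope : ∀ {a b d x y z} → a + b ≈ d → (a + (y - x)) + (b + (z - y)) ≈ d + (z - x)
        telescope {a} {b} {d} {x} {y} {z} p = lin≈ (a ∷ b ∷ d ∷ x ∷ y ∷ z ∷ []) (eq p)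
    inside : ∀ {s t n} → s ≤ t → ∣ s - c n ∣ ≤ r n → ∣ t - c n ∣ ≤ r n → Covered s t
    inside {s} {t} {n} s≤t p q = s≤t , suc n , ≤-trans (≤-reflexive (sym (difference (clamp-id p) (clamp-id q))))
      (term≤partial (0≤increment s≤t) n)
      where
      difference : ∀ {x y} → x ≈ s - c n → y ≈ t - c n → y - x ≈ t - s
      difference {x} {y} p q = lin≈ (x ∷ y ∷ s ∷ t ∷ c n ∷ []) (eq (sym p) ⊕ eq q)
    local : ∀ t → 0# ≤ t → t ≤ 1# → ∃ λ d → 0# < d × (∀ s → 0# ≤ s → s ≤ 1# →
      (t - d < s → s ≤ t → Covered s t) × (t ≤ s → s < t + d → Covered t s))
    local t 0≤t t≤1 with cover t 0≤t t≤1
    ... | n , p = r n - ∣ t - c n ∣ , <⇒0<- p , λ s _ _ →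
      (λ q s≤t → inside s≤t (near (∣∣-≤ (left₁ s≤t) (left₂ q))) (<⇒≤ p)) ,
      (λ t≤s q → inside t≤s (<⇒≤ p) (near (∣∣-≤ (right₁ q) (right₂ t≤s))))
      where
      b : ℝ
      b = ∣ t - c n ∣
      slack : 0# < r n - b
      slack = <⇒0<- p
      near : ∀ {s} → ∣ s - t ∣ ≤ r n - b → ∣ s - c n ∣ ≤ r n
      near {s} q = ≤-trans (≤-reflexive (∣∣-cong (split s t (c n)))) (≤-trans (∣∣-triangle (s - t) (t - c n)) (merge q))
        where
        split : ∀ s t c → s - c ≈ (s - t) + (t - c)
        split s t c = ring≈ (s ∷ t ∷ c ∷ [])
        merge : ∀ {a b r} → a ≤ r - b → a + b ≤ r
        merge {a} {b} {r} p = lin≤ (a ∷ b ∷ r ∷ []) (le p)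
      left₁ : ∀ {s} → s ≤ t → s - t ≤ r n - b
      left₁ {s} q = ≤-trans {j = 0#} (lin≤ (s ∷ t ∷ []) (le q)) (<⇒≤ slack)
      left₂ : ∀ {s d} → t - d < s → - (s - t) ≤ d
      left₂ {s} {d} q = lin≤ (s ∷ t ∷ d ∷ []) (lt q)
      right₁ : ∀ {s d} → s < t + d → s - t ≤ d
      right₁ {s} {d} q = lin≤ (s ∷ t ∷ d ∷ []) (lt q)
      right₂ : ∀ {s} → t ≤ s → - (s - t) ≤ r n - b
      right₂ {s} q = ≤-trans {j = 0#} (lin≤ (s ∷ t ∷ []) (le q)) (<⇒≤ slack)
    conclude : Covered 0# 1# → 1# ≤ M + M
    conclude (_ , m , p) = ≤-trans (≤-trans (≤-reflexive (ring≈ [])) p) (≤-trans (total-≤ m)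
      (lin≤ (partial r m ∷ M ∷ []) (le (bounded m) ⊕ le (bounded m))))
      where
      total-≤ : ∀ m → partial (increment 0# 1#) m ≤ partial r m + partial r m
      total-≤ zero    = ≤-reflexive (sym (+-identityʳ 0#))
      total-≤ (suc m) = step′ (total-≤ m) (clamp-≤ (0≤r m)) (-≤clamp (0≤r m))
        where
        step′ : ∀ {a b x y r} → a ≤ b + b → y ≤ r → - r ≤ x → a + (y - x) ≤ (b + r) + (b + r)
        step′ {a} {b} {x} {y} {r} h₁ h₂ h₃ = lin≤ (a ∷ b ∷ x ∷ y ∷ r ∷ []) (le h₁ ⊕ le h₂ ⊕ le h₃)

  -- Projection along u turns a cover by balls into a cover of [0, 1] by intervals of the same
  -- radii. For total radius 1 / 4 their lengths add up to at most 1 / 2.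
  unit-segment-positive : ∀ {ℓ} {S : Pred ℝ² ℓ} a u → IsUnit u → (∀ t → 0# ≤ t → t ≤ 1# → a +² t ∙ u ∈ S) → ¬ LengthZero S
  unit-segment-positive {S = S} a u u·u≈1 a+tu∈S lengthZero =
    let c , r , 0≤r , covers , bounded = lengthZero (half * half) (half-pos 0<half) in
    too-short (intervals-cover (λ n → ⟨ c n -² a , u ⟩) r (half * half) 0≤r
      (λ m → ≤-resp (sum≈partial m r) refl (bounded m))
      (λ t 0≤t t≤1 → let n , inside = covers (a +² t ∙ u) (a+tu∈S t 0≤t t≤1) in n ,
        <-resp (∣∣-cong (project t (proj₁ a) (proj₂ a) (proj₁ u) (proj₂ u) (proj₁ (c n)) (proj₂ (c n)) u·u≈1)) refl
          (ball-projection {c n} {r n} {a +² t ∙ u} {u} u·u≈1 inside)))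
    where
    too-short : 1# ≤ half * half + half * half → ⊥
    too-short h = refute (half ∷ []) (le h ⊕ (half + 1#) · eq half+half ⊕ lt 0<half)
    project : ∀ t a₁ a₂ u₁ u₂ c₁ c₂ → u₁ * u₁ + u₂ * u₂ ≈ 1# →
      ((a₁ + t * u₁) - c₁) * u₁ + ((a₂ + t * u₂) - c₂) * u₂ ≈ t - ((c₁ - a₁) * u₁ + (c₂ - a₂) * u₂)
    project t a₁ a₂ u₁ u₂ c₁ c₂ h = lin≈ (a₁ ∷ a₂ ∷ u₁ ∷ u₂ ∷ c₁ ∷ c₂ ∷ t ∷ []) (t · eq h)

  -- One ball of radius e around the point, if there is one; the balls of radius 0 after it are
  -- empty.
  subsingleton-lengthZero : ∀ {S : Pred ℝ² (lsuc 0ℓ)} → (∀ x y → x ∈ S → y ∈ S → x ≈² y) → LengthZero S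
  subsingleton-lengthZero {S} unique e 0<e = centre (em {∃ λ z → z ∈ S}) , r , 0≤r , covered (em {∃ λ z → z ∈ S}) , total-≤
    where
    centre : Dec (∃ λ z → z ∈ S) → ℕ → ℝ²
    centre (yes (z , _)) _ = z
    centre (no _)        _ = 0²
    r : ℕ → ℝ
    r zero    = e
    r (suc _) = 0#
    0≤r : ∀ n → 0# ≤ r n
    0≤r zero    = <⇒≤ 0<e
    0≤r (suc _) = ≤-refl
    covered : ∀ d z → z ∈ S → ∃ λ n → z ∈ Ball (centre d n) (r n)
    covered (no ¬z)         z z∈S = ⊥-elim (¬z (z , z∈S))
    covered (yes (z₀ , z₀∈S)) z z∈S = zero , <⇒≤ 0<e , <-resp (sym (vanish (unique z z₀ z∈S z₀∈S))) refl (*-pos 0<e 0<e)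
      where
      vanish : z ≈² z₀ → distSq z z₀ ≈ 0#
      vanish (p , q) = lin≈ (proj₁ z ∷ proj₂ z ∷ proj₁ z₀ ∷ proj₂ z₀ ∷ [])
        ((proj₁ z - proj₁ z₀) · eq p ⊕ (proj₂ z - proj₂ z₀) · eq q)
    total-≤ : ∀ m → sum {m} (r ∘ toℕ) ≤ e
    total-≤ zero    = <⇒≤ 0<e
    total-≤ (suc m) = ≤-reflexive (trans (+-congˡ (sum-zero {m} (λ _ → refl))) (+-identityʳ e))

  lengthZero-⊆ : ∀ {ℓ ℓ′} {S : Pred ℝ² ℓ} {T : Pred ℝ² ℓ′} → (∀ {z} → z ∈ S → z ∈ T) → LengthZero T → LengthZero S
  lengthZero-⊆ S⊆T lengthZero e 0<e = let c , r , 0≤r , covers , bounded = lengthZero e 0<e in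
    c , r , 0≤r , (λ z z∈S → covers z (S⊆T z∈S)) , bounded

  convexHull-mono : ∀ {ℓ ℓ′} {S : Pred ℝ² ℓ} {T : Pred ℝ² ℓ′} → (∀ {z} → z ∈ S → z ∈ T) → ∀ {z} → z ∈ convexHull S → z ∈ convexHull T
  convexHull-mono S⊆T (n , w , p , 0≤w , Σw≈1 , p∈S , z≈) = n , w , p , 0≤w , Σw≈1 , (λ k → S⊆T (p∈S k)) , z≈

  up-strictly-between : ∀ {k y} → IsInteger k → k - 1# < y → y < k → up y ≈ k × ¬ IsInteger y
  up-strictly-between {k} {y} int k-1<y y<k = up-unique int (<⇒≤ y<k) (lin< (k ∷ y ∷ []) (lt k-1<y)) ,
    λ int-y → contra (integer-< int-y int y<k)
    where
    contra : y + 1# ≤ k → ⊥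
    contra h = refute (k ∷ y ∷ []) (le h ⊕ lt k-1<y)

  NoIntegerBetween : ℝ → ℝ → Set
  NoIntegerBetween s t = ∀ c → IsInteger c → ¬ (s < c × c < t)

  no-integer-between : ∀ {s t c} → NoIntegerBetween s t → s < c → c < t →
    ¬ IsInteger c × (up c - 1# ≤ s × s ≤ up c) × (up c - 1# ≤ t × t ≤ up c)
  no-integer-between {s} {t} {c} none-between s<c c<t = (λ int → none-between c int (s<c , c<t)) ,
    (≮⇒≥ (λ h → none-between _ (isInteger-+ (up-isInteger c) (isInteger-neg isInteger-1)) (h , <-≤-trans below (<⇒≤ c<t))) ,
     <⇒≤ (<-≤-trans s<c (t≤up c))) ,
    (<⇒≤ (<-≤-trans below (<⇒≤ c<t)) , ≮⇒≥ (λ h → none-between _ (up-isInteger c) (<-≤-trans s<c (t≤up c) , h)))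
    where
    shift : ∀ {a b} → a < b + 1# → a - 1# < b
    shift {a} {b} p = lin< (a ∷ b ∷ []) (lt p)
    below : up c - 1# < c
    below = shift (up<t+1 c)

  sum-indicator-* : ∀ {n} (i : Fin n) (f : Fin n → ℝ) → sum (λ j → indicator i j * f j) ≈ f i
  sum-indicator-* {suc n} zero    f = trans (+-cong (*-identityˡ _) (sum-zero {n} (λ j → zeroˡ _))) (+-identityʳ _)
  sum-indicator-* {suc n} (suc i) f = trans (+-cong (zeroˡ _) (sum-indicator-* i (f ∘ suc))) (+-identityˡ _)

  -- Determinants, line directions and cones.

  module Tiling (n : ℕ) (g : Fin (suc (suc n)) → ℝ²) (unit : ∀ i → IsUnit (g i))
                (¬parallel : ∀ i j → i ≢ j → ¬ Parallel (g i) (g j)) where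

    N : ℕ
    N = suc (suc n)

    unit-lagrange : ∀ i j → ⟨ g i , g j ⟩ * ⟨ g i , g j ⟩ + D g i j * D g i j ≈ 1#
    unit-lagrange i j = trans (lagrange (g i) (g j)) (trans (*-cong (unit i) (unit j)) (*-identityˡ 1#))

    -- If the determinant vanishes, g_i equals its own projection (g_i , g_j) g_j onto the unit
    -- vector g_j.
    det≉0 : ∀ {i j} → i ≢ j → ¬ D g i j ≈ 0#
    det≉0 {i} {j} i≢j D≈0 = ¬parallel i j i≢j (⟨ g i , g j ⟩ ,
      go (proj₁ (g i)) (proj₂ (g i)) (proj₁ (g j)) (proj₂ (g j)) D≈0 (unit j))
      where
      go : ∀ a b c d → a * d - b * c ≈ 0# → c * c + d * d ≈ 1# → (a , b) ≈² (a * c + b * d) ∙ (c , d)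
      go a b c d p q = lin≈ (a ∷ b ∷ c ∷ d ∷ []) (d · eq p ⊕ a · eq (sym q)) ,
                       lin≈ (a ∷ b ∷ c ∷ d ∷ []) ((- c) · eq p ⊕ b · eq (sym q))

    -- For unit vectors the identity of Lagrange reads (g_i , g_j)² + D² = 1, so the sine of the
    -- angle between the lines is |D|.
    δ⁻¹≈∣det∣ : ∀ i j → δ g i j ⁻¹ ≈ ∣ D g i j ∣
    δ⁻¹≈∣det∣ i j = trans (⁻¹-involutive _) (go (sin (α g i j)) (D g i j) ⟨ g i , g j ⟩ (unit-lagrange i j)
      (sin-arccos (0≤∣ _ ∣) (∣cos∣≤1 ⟨ g i , g j ⟩ (D g i j) (unit-lagrange i j))))
      where
      ∣cos∣≤1 : ∀ c d → c * c + d * d ≈ 1# → ∣ c ∣ ≤ 1#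
      ∣cos∣≤1 c d p = square-cancel-≤ (<⇒≤ 0<1) (lin≤ (∣ c ∣ ∷ c ∷ d ∷ []) (eq (∣x∣*∣x∣ c) ⊕ eq p ⊕ sq d))
      go : ∀ s d c → c * c + d * d ≈ 1# → 0# ≤ s × s * s ≈ 1# - ∣ c ∣ * ∣ c ∣ → s ≈ ∣ d ∣
      go s d c p (0≤s , q) = antisym (square-cancel-≤ 0≤∣ d ∣ (≤-reflexive s²≈))
                                     (square-cancel-≤ 0≤s (≤-reflexive (sym s²≈)))
        where
        s²≈ : s * s ≈ ∣ d ∣ * ∣ d ∣
        s²≈ = lin≈ (s ∷ d ∷ c ∷ ∣ c ∣ ∷ ∣ d ∣ ∷ []) (eq q ⊕ eq (sym (∣x∣*∣x∣ d)) ⊕ eq (sym (∣x∣*∣x∣ c)) ⊕ eq (sym p))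

    det-diagonal : ∀ i → D g i i ≈ 0#
    det-diagonal i = ring≈ (proj₁ (g i) ∷ proj₂ (g i) ∷ [])

    ε*∣det∣≈det : ∀ i j → ε g i j * ∣ D g i j ∣ ≈ D g i j
    ε*∣det∣≈det i j = go (D g i j) (decide (0# < D g i j)) (decide (D g i j < 0#))
      where
      negated : ∀ d → ∣ d ∣ ≈ - d → - 1# * ∣ d ∣ ≈ d
      negated d h = lin≈ (∣ d ∣ ∷ d ∷ []) (eq (sym h))
      go : ∀ d (p : Dec (0# < d)) (q : Dec (d < 0#)) →
           (if does p then 1# else if does q then - 1# else 0#) * ∣ d ∣ ≈ d
      go d (yes p) _       = trans (*-identityˡ _) (0≤⇒∣x∣≈x (<⇒≤ p))
      go d (no ¬p) (yes q) = negated d (≤0⇒∣x∣≈-x (<⇒≤ q))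
      go d (no ¬p) (no ¬q) = trans (zeroˡ _) (antisym (≮⇒≥ ¬q) (≮⇒≥ ¬p))

    -- The excluded index j = i may be restored, as its determinant is zero.
    Δ≈sum∣det∣ : ∀ i → Δ g i ≈ sum (λ j → ∣ D g i j ∣)
    Δ≈sum∣det∣ i = sum-cong-≋ λ j → if-does (j Fin.≟ i) (_≈ ∣ D g i j ∣)
      (λ { ≡.refl → sym (trans (∣∣-cong (det-diagonal i)) (0≤⇒∣x∣≈x ≤-refl)) })
      (λ _ → δ⁻¹≈∣det∣ i j)

    υ≈sum-det : ∀ i → υ g i ≈² sum² (λ j → D g i j ∙ g j)
    υ≈sum-det i = sum²-cong term
      where
      vanish : ∀ {a b} → a ≈ 0# → 0# ≈ a * b
      vanish a≈0 = sym (trans (*-congʳ a≈0) (zeroˡ _))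
      sign*det : ∀ j → ε g i j * δ g i j ⁻¹ ≈ D g i j
      sign*det j = trans (*-congˡ (δ⁻¹≈∣det∣ i j)) (ε*∣det∣≈det i j)
      term : ∀ j → (if does (j Fin.≟ i) then 0² else (ε g i j * δ g i j ⁻¹) ∙ g j) ≈² D g i j ∙ g j
      term j = if-does (j Fin.≟ i) (_≈² D g i j ∙ g j) {0²} {(ε g i j * δ g i j ⁻¹) ∙ g j}
        (λ { ≡.refl → vanish (det-diagonal i) , vanish (det-diagonal i) })
        (λ _ → *-congʳ (sign*det j) , *-congʳ (sign*det j))

    -- g_i after a quarter turn: the direction of the lines of family i.
    e : Fin N → ℝ²
    e i = - proj₂ (g i) , proj₁ (g i)

    abstract
      coord : ℝ² → Fin N → ℝ
      coord x j = ⟨ x , g j ⟩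

      coord-def : ∀ x j → coord x j ≈ ⟨ x , g j ⟩
      coord-def x j = refl

      coord-cong : ∀ {x y} → x ≈² y → ∀ j → coord x j ≈ coord y j
      coord-cong (p , q) j = +-cong (*-congʳ p) (*-congʳ q)

      coord-+ : ∀ x y j → coord (x +² y) j ≈ coord x j + coord y j
      coord-+ x y j = ring≈ (proj₁ x ∷ proj₂ x ∷ proj₁ y ∷ proj₂ y ∷ proj₁ (g j) ∷ proj₂ (g j) ∷ [])

      coord-- : ∀ x y j → coord (x -² y) j ≈ coord x j - coord y j
      coord-- x y j = ring≈ (proj₁ x ∷ proj₂ x ∷ proj₁ y ∷ proj₂ y ∷ proj₁ (g j) ∷ proj₂ (g j) ∷ [])

      coord-∙ : ∀ t x j → coord (t ∙ x) j ≈ t * coord x j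
      coord-∙ t x j = ring≈ (t ∷ proj₁ x ∷ proj₂ x ∷ proj₁ (g j) ∷ proj₂ (g j) ∷ [])

      coord-e : ∀ i j → coord (e i) j ≈ D g i j
      coord-e i j = ring≈ (proj₁ (g i) ∷ proj₂ (g i) ∷ proj₁ (g j) ∷ proj₂ (g j) ∷ [])

    coord-e-self : ∀ i → coord (e i) i ≈ 0#
    coord-e-self i = trans (coord-e i i) (det-diagonal i)

    coord-e≉0 : ∀ {i j} → i ≢ j → ¬ coord (e i) j ≈ 0#
    coord-e≉0 i≢j p = det≉0 i≢j (trans (sym (coord-e _ _)) p)

    decompose : ∀ x i → x ≈² coord x i ∙ g i +² ⟨ x , e i ⟩ ∙ e i
    decompose (x₁ , x₂) i = go (proj₁ (g i)) (proj₂ (g i)) (coord (x₁ , x₂) i) (coord-def _ i) (unit i)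
      where
      go : ∀ c d v → v ≈ x₁ * c + x₂ * d → c * c + d * d ≈ 1# →
           (x₁ , x₂) ≈² v ∙ (c , d) +² (x₁ * (- d) + x₂ * c) ∙ (- d , c)
      go c d v p q = lin≈ (x₁ ∷ x₂ ∷ c ∷ d ∷ v ∷ []) (c · eq (sym p) ⊕ x₁ · eq (sym q)) ,
                     lin≈ (x₁ ∷ x₂ ∷ c ∷ d ∷ v ∷ []) (d · eq (sym p) ⊕ x₂ · eq (sym q))

    coord≈0⇒multiple : ∀ x i → coord x i ≈ 0# → x ≈² ⟨ x , e i ⟩ ∙ e i
    coord≈0⇒multiple x i p = ≈²-trans (decompose x i) (vanish , vanish)
      where
      vanish : ∀ {u v} → coord x i * u + v ≈ v
      vanish {u} {v} = lin≈ (coord x i ∷ u ∷ v ∷ []) (u · eq p)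

    other : ∀ (i : Fin N) → ∃ λ k → i ≢ k
    other zero    = suc zero , λ ()
    other (suc i) = zero , λ ()

    -- By the last field no coordinate has opposite signs at s e_i and t e_k, which makes `Z`
    -- additive on this decomposition.
    record ConeDecomposition (x : ℝ²) : Set where
      field
        i k      : Fin N
        i≢k      : i ≢ k
        s t      : ℝ
        sum-≈    : x ≈² s ∙ e i +² t ∙ e k
        additive : ∀ j → ∣ coord x j ∣ ≈ ∣ s ∣ * ∣ coord (e i) j ∣ + ∣ t ∣ * ∣ coord (e k) j ∣

    coneDecomposition : ∀ x → ConeDecomposition x
    coneDecomposition x with decide (∃ λ i → coord x i ≈ 0#)
    -- x runs along e_i, so the cone degenerates to a ray; any second direction completes it with
    -- weight 0.
    ... | yes (i , xᵢ≈0) = let k , i≢k = other i in record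
      { i = i ; k = k ; i≢k = i≢k ; s = ⟨ x , e i ⟩ ; t = 0#
      ; sum-≈ = ≈²-trans (coord≈0⇒multiple x i xᵢ≈0) (pad , pad)
      ; additive = λ j → trans (∣∣-cong (trans (coord-cong (coord≈0⇒multiple x i xᵢ≈0) j) (coord-∙ _ (e i) j)))
          (trans (∣∣-* _ _) (trans (sym (+-identityʳ _)) (+-congˡ (sym (trans (*-congʳ (0≤⇒∣x∣≈x ≤-refl)) (zeroˡ _))))))
      }
      where
      pad : ∀ {u v} → u ≈ u + 0# * v
      pad {u} {v} = ring≈ (u ∷ v ∷ [])
    -- Order the directions by the cotangent τ of their angle with x; then x
    -- lies between the extremal direction i and the opposite of k.
    ... | no nonzero = fromExtremes (argmax τ) (argmax (λ j → - τ j))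
      where
      x≉0 : ∀ j → ¬ coord x j ≈ 0#
      x≉0 j p = nonzero (j , p)
      q : Fin N → ℝ
      q j = ⟨ x , e j ⟩
      τ : Fin N → ℝ
      τ j = q j * coord x j ⁻¹
      norm² : ℝ
      norm² = ⟨ x , x ⟩

      -- The subtraction formula for cotangents, cleared of denominators. It reads the sign of a
      -- determinant off the order of the τ and the signs of the coordinates of x.
      slope : ∀ i j → norm² * coord (e i) j ≈ (coord x i * coord x j) * (τ i - τ j)
      slope i j = go (proj₁ x) (proj₂ x) (proj₁ (g i)) (proj₂ (g i)) (proj₁ (g j)) (proj₂ (g j))
        (coord x i) (coord x j) (coord (e i) j) (coord x i ⁻¹) (coord x j ⁻¹)
        (coord-def x i) (coord-def x j) (coord-e i j) (⁻¹-inverse (x≉0 i)) (⁻¹-inverse (x≉0 j))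
        where
        identity : ∀ x₁ x₂ a b c d → (x₁ * x₁ + x₂ * x₂) * (a * d - b * c) ≈
          (x₁ * (- b) + x₂ * a) * (x₁ * c + x₂ * d) - (x₁ * a + x₂ * b) * (x₁ * (- d) + x₂ * c)
        identity x₁ x₂ a b c d = ring≈ (x₁ ∷ x₂ ∷ a ∷ b ∷ c ∷ d ∷ [])
        combine : ∀ p r u v y z → u * y ≈ 1# → v * z ≈ 1# → p * v - u * r ≈ (u * v) * (p * y - r * z)
        combine p r u v y z h k = lin≈ (p ∷ r ∷ u ∷ v ∷ y ∷ z ∷ []) ((p * v) · eq (sym h) ⊕ (u * r) · eq k)
        go : ∀ x₁ x₂ a b c d u v w y z → u ≈ x₁ * a + x₂ * b → v ≈ x₁ * c + x₂ * d → w ≈ a * d - b * c →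
             u * y ≈ 1# → v * z ≈ 1# →
             (x₁ * x₁ + x₂ * x₂) * w ≈ (u * v) * ((x₁ * (- b) + x₂ * a) * y - (x₁ * (- d) + x₂ * c) * z)
        go x₁ x₂ a b c d u v w y z hu hv hw hy hz = trans (*-congˡ hw) (trans (identity x₁ x₂ a b c d)
          (trans (+-cong (*-congˡ (sym hv)) (-‿cong (*-congʳ (sym hu)))) (combine _ _ u v y z hy hz)))

      norm²>0 : 0# < norm²
      norm²>0 = 0≤n , λ 0≈n → *-≉0 (coord-e≉0 {zero} {suc zero} (λ ())) (x≉0 zero) (vanish (sym 0≈n))
        where
        0≤n : 0# ≤ norm²
        0≤n = lin≤ (proj₁ x ∷ proj₂ x ∷ []) (sq (proj₁ x) ⊕ sq (proj₂ x))
        vanish : norm² ≈ 0# → coord (e zero) (suc zero) * coord x zero ≈ 0#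
        vanish n≈0 = trans (*-congˡ (trans (coord-def x zero) (trans (+-cong
          (*-congʳ (x*x≈0⇒x≈0 (antisym (lin≤ (proj₁ x ∷ proj₂ x ∷ []) (eq n≈0 ⊕ sq (proj₂ x))) (0≤x*x _))))
          (*-congʳ (x*x≈0⇒x≈0 (antisym (lin≤ (proj₁ x ∷ proj₂ x ∷ []) (eq n≈0 ⊕ sq (proj₁ x))) (0≤x*x _)))))
          (ring≈ (proj₁ (g zero) ∷ proj₂ (g zero) ∷ []))))) (zeroʳ _)

      fromExtremes : (∃ λ i → ∀ j → τ j ≤ τ i) → (∃ λ k → ∀ j → - τ j ≤ - τ k) → ConeDecomposition x
      fromExtremes (i , max) (k , min′) = record
        -- The weights are given by Cramer's rule: coordinate k removes e_k, and coordinate i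
        -- removes e_i.
        { i = i ; k = k ; i≢k = i≢k ; s = coord x k * w ; t = - coord x i * w
        ; sum-≈ = combination
        ; additive = λ j → trans (∣∣-cong (trans (coord-cong combination j) (trans (coord-+ _ _ j) (+-cong (coord-∙ _ _ j) (coord-∙ _ _ j)))))
            (trans (∣∣-additive (sameSign j)) (+-cong (∣∣-* _ _) (∣∣-* _ _)))
        }
        where
        i≢k : i ≢ k
        i≢k ≡.refl = let j , i≢j = other i in coord-e≉0 i≢j (*-cancel-≈ (<⇒≉ norm²>0)
          (trans (slope i j)
          (vanish _ _ _ _ (antisym (neg-cancel (min′ j)) (max j)))))
          where
          neg-cancel : ∀ {u v} → - u ≤ - v → v ≤ u
          neg-cancel {u} {v} p = lin≤ (u ∷ v ∷ []) (le p)
          vanish : ∀ a b c m → b ≈ c → a * (b - c) ≈ m * 0#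
          vanish a b c m p = lin≈ (a ∷ b ∷ c ∷ m ∷ []) (a · eq p)
        w : ℝ
        w = coord (e i) k ⁻¹
        combination : x ≈² (coord x k * w) ∙ e i +² (- coord x i * w) ∙ e k
        combination = go (proj₁ x) (proj₂ x) (proj₁ (g i)) (proj₂ (g i)) (proj₁ (g k)) (proj₂ (g k))
          (coord x i) (coord x k) (coord (e i) k) w (coord-def x i) (coord-def x k) (coord-e i k) (⁻¹-inverse (coord-e≉0 i≢k))
          where
          substitute : ∀ x₁ u v m p q w → x₁ * m ≈ v * p - u * q → m * w ≈ 1# → x₁ ≈ (v * w) * p + (- u * w) * q
          substitute x₁ u v m p q w h hw = lin≈ (x₁ ∷ u ∷ v ∷ m ∷ p ∷ q ∷ w ∷ []) (w · eq h ⊕ x₁ · eq (sym hw))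
          go : ∀ x₁ x₂ a b c d u v m w → u ≈ x₁ * a + x₂ * b → v ≈ x₁ * c + x₂ * d → m ≈ a * d - b * c → m * w ≈ 1# →
               (x₁ , x₂) ≈² (v * w) ∙ (- b , a) +² (- u * w) ∙ (- d , c)
          go x₁ x₂ a b c d u v m w hu hv hm hw =
            substitute x₁ u v m _ _ w (trans (*-congˡ hm) (trans (ring≈ (x₁ ∷ x₂ ∷ a ∷ b ∷ c ∷ d ∷ []))
              (+-cong (*-congʳ (sym hv)) (-‿cong (*-congʳ (sym hu)))))) hw ,
            substitute x₂ u v m _ _ w (trans (*-congˡ hm) (trans (ring≈ (x₁ ∷ x₂ ∷ a ∷ b ∷ c ∷ d ∷ []))
              (+-cong (*-congʳ (sym hv)) (-‿cong (*-congʳ (sym hu)))))) hw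
        -- By `slope` this product is, up to a positive factor, a square times (τ_i - τ_j) (τ_j -
        -- τ_k), and τ_j lies between the extremes.
        sameSign : ∀ j → 0# ≤ (coord x k * w) * coord (e i) j * ((- coord x i * w) * coord (e k) j)
        sameSign j = go norm² (coord x i) (coord x j) (coord x k) (τ i) (τ j) (τ k) w (coord (e i) j) (coord (e k) j)
          norm²>0 (slope i j) (slope k j) (max j) (min′ j)
          where
          go : ∀ n u v z τᵢ τⱼ τₖ w a b → 0# < n → n * a ≈ (u * v) * (τᵢ - τⱼ) → n * b ≈ (z * v) * (τₖ - τⱼ) →
               τⱼ ≤ τᵢ → - τⱼ ≤ - τₖ → 0# ≤ (z * w) * a * ((- u * w) * b)
          go n u v z τᵢ τⱼ τₖ w a b 0<n p q r s = *-cancel-≤ (*-pos 0<n 0<n) (≤-resp (sym (zeroʳ _)) (sym (trans regroup (*-congˡ (*-cong p q))))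
            (lin≤ (u ∷ v ∷ z ∷ τᵢ ∷ τⱼ ∷ τₖ ∷ w ∷ []) (sq (u * z * v * w) ⊗ (le r ⊗ le s))))
            where
            regroup : n * n * ((z * w) * a * ((- u * w) * b)) ≈ (- (z * w * u * w)) * ((n * a) * (n * b))
            regroup = ring≈ (n ∷ a ∷ b ∷ z ∷ w ∷ u ∷ [])

    -- The norm counting crossed lines and its image under A.

    -- The map x ↦ Σⱼ (x , gⱼ) gⱼ approximates K up to a bounded error; it is an
    -- isomorphism turning Z, which counts the grid lines that x crosses, into ν.
    abstract
      Z : ℝ² → ℝ
      Z x = sum (λ j → ∣ coord x j ∣)

      Z-def : ∀ x → Z x ≈ sum (λ j → ∣ coord x j ∣)
      Z-def x = refl

      Z-cong : ∀ {x y} → x ≈² y → Z x ≈ Z y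
      Z-cong p = sum-cong-≋ (λ j → ∣∣-cong (coord-cong p j))

      ∣coord∣≤Z : ∀ x j → ∣ coord x j ∣ ≤ Z x
      ∣coord∣≤Z x j = term≤sum {f = λ j → ∣ coord x j ∣} (λ j → 0≤∣ coord x j ∣) j

      Z-triangle : ∀ x y → Z (x +² y) ≤ Z x + Z y
      Z-triangle x y = ≤-trans (sum-mono (λ j → ≤-trans (≤-reflexive (∣∣-cong (coord-+ x y j))) (∣∣-triangle (coord x j) (coord y j))))
        (≤-reflexive (∑-distrib-+ (λ j → ∣ coord x j ∣) (λ j → ∣ coord y j ∣)))

      Z-homogeneous : ∀ t x → Z (t ∙ x) ≈ ∣ t ∣ * Z x
      Z-homogeneous t x = trans (sum-cong-≋ (λ j → trans (∣∣-cong (coord-∙ t x j)) (∣∣-* t (coord x j))))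
        (sym (*-distribˡ-sum ∣ t ∣ (λ j → ∣ coord x j ∣)))

    coords≈0⇒≈0² : ∀ {x} → (∀ j → coord x j ≈ 0#) → x ≈² 0²
    coords≈0⇒≈0² {x} p = ≈²-trans x≈qe (trans (*-congʳ q≈0) (zeroˡ _) , trans (*-congʳ q≈0) (zeroˡ _))
      where
      x≈qe : x ≈² ⟨ x , e zero ⟩ ∙ e zero
      x≈qe = coord≈0⇒multiple x zero (p zero)
      q≈0 : ⟨ x , e zero ⟩ ≈ 0#
      q≈0 = *-cancel-≈ (coord-e≉0 {zero} {suc zero} (λ ())) (trans (*-comm _ _)
        (trans (sym (coord-∙ _ (e zero) (suc zero))) (trans (sym (coord-cong x≈qe (suc zero))) (trans (p (suc zero)) (sym (zeroʳ _))))))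

    Z-isNorm : IsNorm Z
    Z-isNorm = record
      { ν-cong = Z-cong ; triangle = Z-triangle ; homogeneous = Z-homogeneous
      ; definite = λ {x} Zx≈0 → coords≈0⇒≈0² λ j → ∣x∣≤0⇒x≈0 (≤-trans (∣coord∣≤Z x j) (≤-reflexive Zx≈0)) }

    0<Z-e : ∀ i → 0# < Z (e i)
    0<Z-e i = let k , i≢k = other i in <-≤-trans (≉0⇒0<∣x∣ (coord-e≉0 i≢k)) (∣coord∣≤Z (e i) k)

    abstract
      -- The entries of the frame operator, the sum of the rank-one matrices of the g_j.
      g₁₁ g₁₂ g₂₂ : ℝ
      g₁₁ = sum (λ j → proj₁ (g j) * proj₁ (g j))
      g₁₂ = sum (λ j → proj₁ (g j) * proj₂ (g j))
      g₂₂ = sum (λ j → proj₂ (g j) * proj₂ (g j))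

      0≤g₁₁ : proj₁ (g zero) * proj₁ (g zero) ≤ g₁₁
      0≤g₁₁ = term≤sum {f = λ j → proj₁ (g j) * proj₁ (g j)} (λ j → 0≤x*x _) zero
      0≤g₂₂ : proj₂ (g zero) * proj₂ (g zero) ≤ g₂₂
      0≤g₂₂ = term≤sum {f = λ j → proj₂ (g j) * proj₂ (g j)} (λ j → 0≤x*x _) zero

      linear-sum : ∀ (f h k : Fin N → ℝ) s t → (∀ j → f j ≈ h j * s + k j * t) → sum f ≈ sum h * s + sum k * t
      linear-sum f h k s t p = trans (sum-cong-≋ p) (trans (∑-distrib-+ (λ j → h j * s) (λ j → k j * t))
        (+-cong (sym (*-distribʳ-sum s h)) (sym (*-distribʳ-sum t k))))

    A : ℝ² → ℝ²
    A x = g₁₁ * proj₁ x + g₁₂ * proj₂ x , g₁₂ * proj₁ x + g₂₂ * proj₂ x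

    A-matrix : ∀ x → A x ≈² (g₁₁ * proj₁ x + g₁₂ * proj₂ x , g₁₂ * proj₁ x + g₂₂ * proj₂ x)
    A-matrix x = refl , refl

    abstract
      A≈sum : ∀ x → A x ≈² sum² (λ j → coord x j ∙ g j)
      A≈sum (x , y) =
        sym (linear-sum _ (λ j → proj₁ (g j) * proj₁ (g j)) (λ j → proj₁ (g j) * proj₂ (g j)) x y λ j →
          trans (*-congʳ (coord-def (x , y) j)) (ring≈ (x ∷ y ∷ proj₁ (g j) ∷ proj₂ (g j) ∷ []))) ,
        sym (linear-sum _ (λ j → proj₁ (g j) * proj₂ (g j)) (λ j → proj₂ (g j) * proj₂ (g j)) x y λ j →
          trans (*-congʳ (coord-def (x , y) j)) (ring≈ (x ∷ y ∷ proj₁ (g j) ∷ proj₂ (g j) ∷ [])))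

    A-+ : ∀ x y → A (x +² y) ≈² A x +² A y
    A-+ (x₁ , x₂) (y₁ , y₂) = ring≈ (x₁ ∷ x₂ ∷ y₁ ∷ y₂ ∷ g₁₁ ∷ g₁₂ ∷ []) , ring≈ (x₁ ∷ x₂ ∷ y₁ ∷ y₂ ∷ g₁₂ ∷ g₂₂ ∷ [])

    A-∙ : ∀ t x → A (t ∙ x) ≈² t ∙ A x
    A-∙ t (x₁ , x₂) = ring≈ (t ∷ x₁ ∷ x₂ ∷ g₁₁ ∷ g₁₂ ∷ []) , ring≈ (t ∷ x₁ ∷ x₂ ∷ g₁₂ ∷ g₂₂ ∷ [])

    A-cong : ∀ {x y} → x ≈² y → A x ≈² A y
    A-cong (p , q) = +-cong (*-congˡ p) (*-congˡ q) , +-cong (*-congˡ p) (*-congˡ q)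

    -- Positive definiteness of A: the sum of squares vanishes only if all coordinates of x do.
    ⟨Ax,x⟩ : ∀ x → ⟨ A x , x ⟩ ≈ sum (λ j → coord x j * coord x j)
    ⟨Ax,x⟩ x = trans (+-cong (*-congʳ (proj₁ (A≈sum x))) (*-congʳ (proj₂ (A≈sum x))))
      (sym (linear-sum _ (λ j → coord x j * proj₁ (g j)) (λ j → coord x j * proj₂ (g j)) (proj₁ x) (proj₂ x) λ j →
        expand (coord x j) (proj₁ (g j)) (proj₂ (g j)) (coord-def x j)))
      where
      expand : ∀ c a b → c ≈ proj₁ x * a + proj₂ x * b → c * c ≈ c * a * proj₁ x + c * b * proj₂ x
      expand c a b p = lin≈ (c ∷ a ∷ b ∷ proj₁ x ∷ proj₂ x ∷ []) (c · eq p)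

    A-injective₀ : ∀ {x} → A x ≈² 0² → x ≈² 0²
    A-injective₀ {x} (p , q) = coords≈0⇒≈0² λ j → x*x≈0⇒x≈0 (antisym
      (≤-trans (term≤sum {f = λ j → coord x j * coord x j} (λ j → 0≤x*x (coord x j)) j)
        (≤-reflexive (trans (sym (⟨Ax,x⟩ x)) (vanish p q)))) (0≤x*x _))
      where
      vanish : ∀ {a b} → a ≈ 0# → b ≈ 0# → a * proj₁ x + b * proj₂ x ≈ 0#
      vanish {a} {b} p q = lin≈ (a ∷ b ∷ proj₁ x ∷ proj₂ x ∷ []) (proj₁ x · eq p ⊕ proj₂ x · eq q)

    frameDet : ℝ
    frameDet = g₁₁ * g₂₂ - g₁₂ * g₁₂

    -- If the determinant vanishes, the columns of the adjugate lie in the kernel.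
    frameDet≉0 : ¬ frameDet ≈ 0#
    frameDet≉0 d≈0 =
      let p , _ = A-injective₀ {g₂₂ , - g₁₂} (≈²-trans (A-matrix _) (trans (ring≈ (g₁₁ ∷ g₁₂ ∷ g₂₂ ∷ [])) d≈0 , ring≈ (g₁₂ ∷ g₂₂ ∷ [])))
          _ , q = A-injective₀ {x = - g₁₂ , g₁₁} (≈²-trans (A-matrix _) (ring≈ (g₁₁ ∷ g₁₂ ∷ []) , trans (ring≈ (g₁₁ ∷ g₁₂ ∷ g₂₂ ∷ [])) d≈0))
      in contradict (proj₁ (g zero)) (proj₂ (g zero)) (≤-trans 0≤g₁₁ (≤-reflexive q)) (≤-trans 0≤g₂₂ (≤-reflexive p)) (unit zero)
      where
      contradict : ∀ a b → a * a ≤ 0# → b * b ≤ 0# → a * a + b * b ≈ 1# → ⊥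
      contradict a b p q r = refute (a ∷ b ∷ []) (le p ⊕ le q ⊕ eq (sym r))

    abstract
      B : ℝ² → ℝ²
      B z = frameDet ⁻¹ ∙ (g₂₂ * proj₁ z - g₁₂ * proj₂ z , g₁₁ * proj₂ z - g₁₂ * proj₁ z)

      A∘B : ∀ z → A (B z) ≈² z
      A∘B (z₁ , z₂) = go g₁₁ g₁₂ g₂₂ (frameDet ⁻¹) (⁻¹-inverse frameDet≉0)
        where
        go : ∀ a b c w → (a * c - b * b) * w ≈ 1# →
          (a * (w * (c * z₁ - b * z₂)) + b * (w * (a * z₂ - b * z₁)) , b * (w * (c * z₁ - b * z₂)) + c * (w * (a * z₂ - b * z₁))) ≈² (z₁ , z₂)
        go a b c w h = lin≈ (a ∷ b ∷ c ∷ w ∷ z₁ ∷ z₂ ∷ []) (z₁ · eq h) , lin≈ (a ∷ b ∷ c ∷ w ∷ z₁ ∷ z₂ ∷ []) (z₂ · eq h)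

      B∘A : ∀ x → B (A x) ≈² x
      B∘A (x₁ , x₂) = go g₁₁ g₁₂ g₂₂ (frameDet ⁻¹) (⁻¹-inverse frameDet≉0)
        where
        go : ∀ a b c w → (a * c - b * b) * w ≈ 1# →
          (w * (c * (a * x₁ + b * x₂) - b * (b * x₁ + c * x₂)) , w * (a * (b * x₁ + c * x₂) - b * (a * x₁ + b * x₂))) ≈² (x₁ , x₂)
        go a b c w h = lin≈ (a ∷ b ∷ c ∷ w ∷ x₁ ∷ x₂ ∷ []) (x₁ · eq h) , lin≈ (a ∷ b ∷ c ∷ w ∷ x₁ ∷ x₂ ∷ []) (x₂ · eq h)

      B-cong : ∀ {x y} → x ≈² y → B x ≈² B y
      B-cong (p , q) = *-congˡ (+-cong (*-congˡ p) (-‿cong (*-congˡ q))) , *-congˡ (+-cong (*-congˡ q) (-‿cong (*-congˡ p)))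

    B-+ : ∀ x y → B (x +² y) ≈² B x +² B y
    B-+ x y = ≈²-trans (B-cong (≈²-sym (≈²-trans (A-+ (B x) (B y)) (+²-cong (A∘B x) (A∘B y))))) (B∘A (B x +² B y))

    B-∙ : ∀ t x → B (t ∙ x) ≈² t ∙ B x
    B-∙ t x = ≈²-trans (B-cong (≈²-sym (≈²-trans (A-∙ t (B x)) (∙-congˡ (A∘B x))))) (B∘A (t ∙ B x))

    A-injective : ∀ {x y} → A x ≈² A y → x ≈² y
    A-injective {x} {y} p = ≈²-trans (≈²-sym (B∘A x)) (≈²-trans (B-cong p) (B∘A y))

    ν : ℝ² → ℝ
    ν z = Z (B z)

    ν-isNorm : IsNorm ν
    ν-isNorm = record
      { ν-cong = λ p → Z-cong (B-cong p)
      ; triangle = λ x y → ≤-trans (≤-reflexive (Z-cong (B-+ x y))) (Z-triangle (B x) (B y))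
      ; homogeneous = λ t x → trans (Z-cong (B-∙ t x)) (Z-homogeneous t (B x))
      ; definite = λ {x} νx≈0 → ≈²-trans (≈²-sym (A∘B x)) (≈²-trans (A-cong (IsNorm.definite Z-isNorm νx≈0))
          (≈²-trans (A-matrix 0²) (vanish g₁₁ g₁₂ , vanish g₁₂ g₂₂)))
      }
      where
      vanish : ∀ a b → a * 0# + b * 0# ≈ 0#
      vanish a b = ring≈ (a ∷ b ∷ [])

    ν∘A : ∀ x → ν (A x) ≈ Z x
    ν∘A x = Z-cong (B∘A x)

    A-e≈υ : ∀ i → A (e i) ≈² υ g i
    A-e≈υ i = ≈²-trans (A≈sum (e i)) (≈²-trans (sum²-cong (λ j → ∙-congʳ {v = g j} (coord-e i j))) (≈²-sym (υ≈sum-det i)))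

    Z-e≈Δ : ∀ i → Z (e i) ≈ Δ g i
    Z-e≈Δ i = trans (Z-def (e i)) (trans (sum-cong-≋ (λ j → ∣∣-cong (coord-e i j))) (sym (Δ≈sum∣det∣ i)))

    -- The growth polygon and its vertices.

    ±1 : Sign → ℝ
    ±1 s+ = 1#
    ±1 s- = - 1#

    ±1-square : ∀ s → ±1 s * ±1 s ≈ 1#
    ±1-square s+ = *-identityˡ 1#
    ±1-square s- = ring≈ []

    ∣±1∣ : ∀ s → ∣ ±1 s ∣ ≈ 1#
    ∣±1∣ s+ = 0≤⇒∣x∣≈x (<⇒≤ 0<1)
    ∣±1∣ s- = trans (∣-x∣≈∣x∣ 1#) (0≤⇒∣x∣≈x (<⇒≤ 0<1))

    ±1-* : ∀ x → ∃ λ s → ±1 s * ∣ x ∣ ≈ x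
    ±1-* x with absCases x
    ... | nonNegative _ p = s+ , trans (*-identityˡ _) p
    ... | nonPositive _ p = s- , lin≈ (x ∷ ∣ x ∣ ∷ []) (eq (sym p))

    vertexScale : Sign × Fin N → ℝ
    vertexScale (s , i) = ±1 s * Z (e i) ⁻¹

    growthVertex≈ : ∀ a → growthVertex g a ≈² A (vertexScale a ∙ e (proj₂ a))
    growthVertex≈ (s+ , i) = ≈²-sym (≈²-trans (A-∙ _ (e i)) (≈²-trans (∙-congˡ (A-e≈υ i))
      (∙-congʳ (trans (*-identityˡ _) (⁻¹-cong (Z-e≈Δ i))))))
    growthVertex≈ (s- , i) = ≈²-sym (≈²-trans (A-∙ _ (e i)) (≈²-trans (∙-congˡ (A-e≈υ i))
      (≈²-trans (∙-congʳ (*-congˡ (⁻¹-cong (Z-e≈Δ i)))) (negate (Δ g i ⁻¹) , negate (Δ g i ⁻¹)))))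
      where
      negate : ∀ a {b} → (- 1# * a) * b ≈ - (a * b)
      negate a {b} = ring≈ (a ∷ b ∷ [])

    Z-vertex : ∀ a → Z (vertexScale a ∙ e (proj₂ a)) ≈ 1#
    Z-vertex (s , i) = trans (Z-homogeneous _ (e i)) (trans (*-congʳ (trans (∣∣-* _ _) (trans (*-congʳ (∣±1∣ s)) (*-identityˡ _))))
      (trans (*-congʳ (0≤⇒∣x∣≈x (<⇒≤ (⁻¹-pos (0<Z-e i))))) (trans (*-comm _ _) (⁻¹-inverse (<⇒≉ (0<Z-e i))))))

    open UnitSphere ν ν-isNorm using (Sphere; sphere≐∂; sphere-closedCurve)
    open IsNorm ν-isNorm using (ν-cong; definite) renaming (homogeneous to ν-homogeneous)

    hull : Pred ℝ² 0ℓ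
    hull = convexHull (λ z → ∃ λ a → z ≈² growthVertex g a)

    hull⊆ball : ∀ z → z ∈ hull → ν z ≤ 1#
    hull⊆ball = ConvexNorm.convexHull⊆ball ν ν-isNorm {S = λ z → ∃ λ a → z ≈² growthVertex g a} vertex∈ball
      where
      vertex∈ball : ∀ z → (∃ λ a → z ≈² growthVertex g a) → ν z ≤ 1#
      vertex∈ball z (a , z≈) = ≤-reflexive (trans (ν-cong {z} (≈²-trans z≈ (growthVertex≈ a)))
        (trans (ν∘A (vertexScale a ∙ e (proj₂ a))) (Z-vertex a)))

    Z-cone : ∀ {x} (c : ConeDecomposition x) → let open ConeDecomposition c in
             Z x ≈ ∣ s ∣ * Z (e i) + ∣ t ∣ * Z (e k)
    Z-cone {x} c = trans (Z-def x) (trans (sum-cong-≋ additive)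
      (trans (∑-distrib-+ (λ j → ∣ s ∣ * ∣ coord (e i) j ∣) (λ j → ∣ t ∣ * ∣ coord (e k) j ∣)) (+-cong (scaled s i) (scaled t k))))
      where
      open ConeDecomposition c
      scaled : ∀ s i → sum (λ j → ∣ s ∣ * ∣ coord (e i) j ∣) ≈ ∣ s ∣ * Z (e i)
      scaled s i = trans (sym (*-distribˡ-sum ∣ s ∣ (λ j → ∣ coord (e i) j ∣))) (*-congˡ (sym (Z-def (e i))))

    -- The weight missing from Σ w = 1 is split between two antipodal vertices.
    ball⊆hull : ∀ z → ν z ≤ 1# → z ∈ hull
    ball⊆hull z νz≤1 = go (coneDecomposition (B z))
      where
      go : ConeDecomposition (B z) → z ∈ hull
      go c = 4 , w , (λ k → growthVertex g (vertex k)) , 0≤w , Σw≈1 , (λ k → vertex k , refl , refl) ,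
        component (proj₁ A≈) (proj₁ (growthVertex≈′ (vertex zero))) (proj₁ (growthVertex≈′ (vertex (suc zero)))) (-‿inverseʳ _) ,
        component (proj₂ A≈) (proj₂ (growthVertex≈′ (vertex zero))) (proj₂ (growthVertex≈′ (vertex (suc zero)))) (-‿inverseʳ _)
        where
        open ConeDecomposition c
        rest : ℝ
        rest = (1# - (∣ s ∣ * Z (e i) + ∣ t ∣ * Z (e k))) * half
        0≤rest : 0# ≤ rest
        0≤rest = *-nonNeg (≤⇒0≤- (≤-trans (≤-reflexive (sym (Z-cone c))) νz≤1)) (<⇒≤ 0<half)
        w : Fin 4 → ℝ
        w zero                   = ∣ s ∣ * Z (e i)
        w (suc zero)             = ∣ t ∣ * Z (e k)
        w (suc (suc zero))       = rest
        w (suc (suc (suc zero))) = rest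
        vertex : Fin 4 → Sign × Fin N
        vertex zero                   = proj₁ (±1-* s) , i
        vertex (suc zero)             = proj₁ (±1-* t) , k
        vertex (suc (suc zero))       = s+ , i
        vertex (suc (suc (suc zero))) = s- , i
        0≤w : ∀ k → 0# ≤ w k
        0≤w zero                   = *-nonNeg 0≤∣ s ∣ (<⇒≤ (0<Z-e i))
        0≤w (suc zero)             = *-nonNeg 0≤∣ t ∣ (<⇒≤ (0<Z-e k))
        0≤w (suc (suc zero))       = 0≤rest
        0≤w (suc (suc (suc zero))) = 0≤rest
        Σw≈1 : sum w ≈ 1#
        Σw≈1 = total-weight (∣ s ∣ * Z (e i)) (∣ t ∣ * Z (e k))
          where
          total-weight : ∀ a b → a + (b + ((1# - (a + b)) * half + ((1# - (a + b)) * half + 0#))) ≈ 1#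
          total-weight a b = lin≈ (a ∷ b ∷ half ∷ []) ((1# - (a + b)) · eq half+half)
        A≈ : z ≈² s ∙ A (e i) +² t ∙ A (e k)
        A≈ = ≈²-trans (≈²-sym (A∘B z)) (≈²-trans (A-cong sum-≈) (≈²-trans (A-+ _ _) (+²-cong (A-∙ s (e i)) (A-∙ t (e k)))))
        growthVertex≈′ : ∀ a → growthVertex g a ≈² vertexScale a ∙ A (e (proj₂ a))
        growthVertex≈′ a = ≈²-trans (growthVertex≈ a) (A-∙ _ _)
        component : ∀ {z v₀ v₁ v₂ v₃ a b} → z ≈ s * a + t * b → v₀ ≈ (±1 (proj₁ (±1-* s)) * Z (e i) ⁻¹) * a →
          v₁ ≈ (±1 (proj₁ (±1-* t)) * Z (e k) ⁻¹) * b → v₂ + v₃ ≈ 0# →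
          z ≈ w zero * v₀ + (w (suc zero) * v₁ + (rest * v₂ + (rest * v₃ + 0#)))
        component h h₀ h₁ h₂ = arith h (weigh (∣ s ∣) (Z (e i)) (⁻¹-inverse (<⇒≉ (0<Z-e i))) (proj₂ (±1-* s)) h₀)
          (weigh (∣ t ∣) (Z (e k)) (⁻¹-inverse (<⇒≉ (0<Z-e k))) (proj₂ (±1-* t)) h₁) (opposite h₂)
          where
          weigh : ∀ {s} a z {z⁻¹ v σ c} → z * z⁻¹ ≈ 1# → σ * a ≈ s → v ≈ (σ * z⁻¹) * c → (a * z) * v ≈ s * c
          weigh {s} a z {z⁻¹} {v} {σ} {c} p q r = lin≈ (s ∷ a ∷ z ∷ z⁻¹ ∷ v ∷ σ ∷ c ∷ [])
            ((a * z) · eq r ⊕ (σ * a * c) · eq p ⊕ c · eq q)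
          opposite : ∀ {u v} → u + v ≈ 0# → rest * u + (rest * v + 0#) ≈ 0#
          opposite p = trans (+-congˡ (+-identityʳ _)) (trans (sym (distribˡ _ _ _)) (trans (*-congˡ p) (zeroʳ _)))
          arith : ∀ {z p q p′ q′ r} → z ≈ p + q → p′ ≈ p → q′ ≈ q → r ≈ 0# → z ≈ p′ + (q′ + r)
          arith {z} {p} {q} {p′} {q′} {r} h₁ h₂ h₃ h₄ = lin≈ (z ∷ p ∷ q ∷ p′ ∷ q′ ∷ r ∷ []) (eq h₁ ⊕ eq (sym h₂) ⊕ eq (sym h₃) ⊕ eq (sym h₄))

    vertexScale≉0 : ∀ a → ¬ vertexScale a ≈ 0#
    vertexScale≉0 (s , i) = *-≉0 (±1≉0 s) (<⇒≉ (⁻¹-pos (0<Z-e i)))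
      where
      ±1≉0 : ∀ s → ¬ ±1 s ≈ 0#
      ±1≉0 s p = 0≉1 (trans (sym (trans (*-congʳ p) (zeroˡ _))) (±1-square s))

    -- After removing A, multiples of e_i and e_j are compared: coordinate j vanishes at e_j but not
    -- at e_i. Within one family only the signs can differ.
    distinct : ∀ a b → growthVertex g a ≈² growthVertex g b → a ≡ b
    distinct (s , i) (t , j) p with i Fin.≟ j
    ... | no i≢j     = ⊥-elim (*-≉0 (vertexScale≉0 (s , i)) (coord-e≉0 i≢j) (trans (sym (coord-∙ _ (e i) j))
      (trans (coord-cong scaled j) (trans (coord-∙ _ (e j) j) (trans (*-congˡ (coord-e-self j)) (zeroʳ _))))))
      where
      scaled : vertexScale (s , i) ∙ e i ≈² vertexScale (t , j) ∙ e j
      scaled = A-injective (≈²-trans (≈²-sym (growthVertex≈ (s , i))) (≈²-trans p (growthVertex≈ (t , j))))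
    ... | yes ≡.refl = ≡.cong (_, i) (±1-injective s t (*-cancel-≈ (<⇒≉ (⁻¹-pos (0<Z-e i))) (trans (*-comm _ _)
        (trans (*-cancel-≈ (coord-e≉0 (proj₂ (other i))) (trans (*-comm _ _) (trans (sym (coord-∙ _ (e i) _)) (trans (coord-cong scaled _)
          (trans (coord-∙ _ (e i) _) (*-comm _ _)))))) (*-comm _ _)))))
      where
      scaled : vertexScale (s , i) ∙ e i ≈² vertexScale (t , i) ∙ e i
      scaled = A-injective (≈²-trans (≈²-sym (growthVertex≈ (s , i))) (≈²-trans p (growthVertex≈ (t , i))))
      ±1-injective : ∀ s t → ±1 s ≈ ±1 t → s ≡ t
      ±1-injective s+ s+ _ = ≡.refl
      ±1-injective s- s- _ = ≡.refl
      ±1-injective s+ s- p = refute [] (eq p)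
      ±1-injective s- s+ p = refute [] (eq (sym p))

    -- Equality must hold in the triangle inequality for `Z`, hence in every coordinate separately.
    -- Coordinate i of the vertex is 0, so it is 0 for x and y as well, and both are multiples of
    -- e_i. There the claim is one-dimensional: a mean of two numbers at most 1 equals 1 only if
    -- both do.
    vertex-extreme : ∀ a {x y u v} → 0# < u → 0# < v → u + v ≈ 1# → Z x ≤ 1# → Z y ≤ 1# →
      vertexScale a ∙ e (proj₂ a) ≈² u ∙ x +² v ∙ y → x ≈² vertexScale a ∙ e (proj₂ a)
    vertex-extreme (s , i) {x} {y} {u} {v} 0<u 0<v u+v≈1 Zx≤1 Zy≤1 p =
      ≈²-trans (coord≈0⇒multiple x i xᵢ≈0) (∙-congʳ λ≈κ)
      where
      κ : ℝ
      κ = vertexScale (s , i)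
      S : Fin N → ℝ
      S j = (u * ∣ coord x j ∣ + v * ∣ coord y j ∣) - ∣ κ ∣ * ∣ coord (e i) j ∣
      combination : ∀ j → κ * coord (e i) j ≈ u * coord x j + v * coord y j
      combination j = trans (sym (coord-∙ κ (e i) j)) (trans (coord-cong p j) (trans (coord-+ _ _ j) (+-cong (coord-∙ u x j) (coord-∙ v y j))))
      0≤S : ∀ j → 0# ≤ S j
      0≤S j = ≤⇒0≤- (≤-trans (≤-reflexive (trans (sym (∣∣-* κ _)) (∣∣-cong (combination j))))
        (≤-trans (∣∣-triangle _ _) (≤-reflexive (+-cong (weight 0<u (coord x j)) (weight 0<v (coord y j))))))
        where
        weight : ∀ {u} → 0# < u → ∀ x → ∣ u * x ∣ ≈ u * ∣ x ∣
        weight 0<u x = trans (∣∣-* _ x) (*-congʳ (0≤⇒∣x∣≈x (<⇒≤ 0<u)))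
      sumS : sum S ≈ (u * Z x + v * Z y) - Z (κ ∙ e i)
      sumS = trans (sum-sub (λ j → u * ∣ coord x j ∣ + v * ∣ coord y j ∣) (λ j → ∣ κ ∣ * ∣ coord (e i) j ∣)) (+-cong
        (trans (∑-distrib-+ (λ j → u * ∣ coord x j ∣) (λ j → v * ∣ coord y j ∣)) (+-cong (scaled u x) (scaled v y)))
        (-‿cong (trans (scaled ∣ κ ∣ (e i)) (sym (Z-homogeneous κ (e i))))))
        where
        scaled : ∀ u x → sum (λ j → u * ∣ coord x j ∣) ≈ u * Z x
        scaled u x = trans (sym (*-distribˡ-sum u (λ j → ∣ coord x j ∣))) (*-congˡ (sym (Z-def x)))
      sumS≤0 : sum S ≤ 0#
      sumS≤0 = bound sumS (Z-vertex (s , i)) Zx≤1 Zy≤1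
        where
        bound : ∀ {r a b c} → r ≈ (u * a + v * b) - c → c ≈ 1# → a ≤ 1# → b ≤ 1# → r ≤ 0#
        bound {r} {a} {b} {c} h₁ h₂ h₃ h₄ = lin≤ (r ∷ a ∷ b ∷ c ∷ u ∷ v ∷ [])
          (eq h₁ ⊕ eq (sym h₂) ⊕ lt 0<u ⊗ le h₃ ⊕ lt 0<v ⊗ le h₄ ⊕ eq u+v≈1)
      Sᵢ≤0 : S i ≤ 0#
      Sᵢ≤0 = ≤-trans (term≤sum 0≤S i) sumS≤0
      ∣coordᵢ∣≈0 : ∣ coord (e i) i ∣ ≈ 0#
      ∣coordᵢ∣≈0 = trans (∣∣-cong (coord-e-self i)) (0≤⇒∣x∣≈x ≤-refl)
      xᵢ≈0 : coord x i ≈ 0#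
      xᵢ≈0 = ∣x∣≤0⇒x≈0 (*-cancel-≤ 0<u (drop Sᵢ≤0 ∣coordᵢ∣≈0 0≤∣ coord y i ∣))
        where
        drop : ∀ {a b c d} → (u * a + v * b) - c * d ≤ 0# → d ≈ 0# → 0# ≤ b → u * a ≤ u * 0#
        drop {a} {b} {c} {d} h₁ h₂ h₃ = lin≤ (a ∷ b ∷ c ∷ d ∷ u ∷ v ∷ []) (le h₁ ⊕ lt 0<v ⊗ le h₃ ⊕ c · eq h₂)
      yᵢ≈0 : coord y i ≈ 0#
      yᵢ≈0 = ∣x∣≤0⇒x≈0 (*-cancel-≤ 0<v (drop Sᵢ≤0 ∣coordᵢ∣≈0 0≤∣ coord x i ∣))
        where
        drop : ∀ {a b c d} → (u * a + v * b) - c * d ≤ 0# → d ≈ 0# → 0# ≤ a → v * b ≤ v * 0#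
        drop {a} {b} {c} {d} h₁ h₂ h₃ = lin≤ (a ∷ b ∷ c ∷ d ∷ u ∷ v ∷ []) (le h₁ ⊕ lt 0<u ⊗ le h₃ ⊕ c · eq h₂)
      l m r : ℝ
      l = ⟨ x , e i ⟩
      m = ⟨ y , e i ⟩
      r = Z (e i)
      mean : κ ≈ u * l + v * m
      mean = *-cancel-≈ (coord-e≉0 (proj₂ (other i))) (regroup (coord-cong (coord≈0⇒multiple x i xᵢ≈0) k) (coord-cong (coord≈0⇒multiple y i yᵢ≈0) k)
          (coord-∙ l (e i) k) (coord-∙ m (e i) k) (combination k))
        where
        k : Fin N
        k = proj₁ (other i)
        regroup : ∀ {c a a′ b b′ κ l m} → a ≈ a′ → b ≈ b′ → a′ ≈ l * c → b′ ≈ m * c → κ * c ≈ u * a + v * b → c * κ ≈ c * (u * l + v * m)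
        regroup {c} {a} {a′} {b} {b′} {κ} {l} {m} h₁ h₂ h₃ h₄ h₅ = trans (*-comm c κ) (trans h₅
          (trans (+-cong (*-congˡ (trans h₁ h₃)) (*-congˡ (trans h₂ h₄))) (ring≈ (u ∷ v ∷ l ∷ m ∷ c ∷ []))))
      length≤1 : ∀ {z} q → z ≈² q ∙ e i → Z z ≤ 1# → ±1 s * q * r ≤ 1#
      length≤1 {z} q z≈ Zz≤1 = ≤-trans (*-monoʳ (<⇒≤ (0<Z-e i)) (≤-trans (x≤∣x∣ _) (≤-reflexive (trans (∣∣-* (±1 s) q) (trans (*-congʳ (∣±1∣ s)) (*-identityˡ _))))))
        (≤-trans (≤-reflexive (trans (sym (Z-homogeneous q (e i))) (sym (Z-cong z≈)))) Zz≤1)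
        where
        *-monoʳ : ∀ {a b c} → 0# ≤ c → a ≤ b → a * c ≤ b * c
        *-monoʳ {a} {b} {c} p q = lin≤ (a ∷ b ∷ c ∷ []) (le p ⊗ le q)
      λ≈κ : l ≈ κ
      λ≈κ = go (±1 s) l m r (r ⁻¹) (±1-square s) (⁻¹-inverse (<⇒≉ (0<Z-e i))) mean
        (length≤1 l (coord≈0⇒multiple x i xᵢ≈0) Zx≤1) (length≤1 m (coord≈0⇒multiple y i yᵢ≈0) Zy≤1)
        where
        go : ∀ σ l m r r⁻¹ → σ * σ ≈ 1# → r * r⁻¹ ≈ 1# → σ * r⁻¹ ≈ u * l + v * m → σ * l * r ≤ 1# → σ * m * r ≤ 1# → l ≈ σ * r⁻¹
        go σ l m r r⁻¹ σ²≈1 rr⁻¹≈1 mean hl hm = lin≈ (σ ∷ l ∷ r ∷ r⁻¹ ∷ [])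
          ((σ * r⁻¹) · eq σlr≈1 ⊕ l · eq (sym σ²≈1) ⊕ (σ * σ * l) · eq (sym rr⁻¹≈1))
          where
          weighted : u * (σ * l * r) + v * (σ * m * r) ≈ 1#
          weighted = lin≈ (σ ∷ l ∷ m ∷ r ∷ r⁻¹ ∷ u ∷ v ∷ []) ((σ * r) · eq (sym mean) ⊕ eq rr⁻¹≈1 ⊕ (r * r⁻¹) · eq σ²≈1)
          σlr≈1 : σ * l * r ≈ 1#
          σlr≈1 = antisym hl (*-cancel-≤ 0<u (squeeze (σ * l * r) (σ * m * r) weighted hm))
            where
            squeeze : ∀ a b → u * a + v * b ≈ 1# → b ≤ 1# → u * 1# ≤ u * a
            squeeze a b h₁ h₂ = lin≤ (a ∷ b ∷ u ∷ v ∷ []) (eq (sym h₁) ⊕ lt 0<v ⊗ le h₂ ⊕ eq u+v≈1)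

    growthVertex-extreme : ∀ a → growthVertex g a ∈ Extreme hull
    growthVertex-extreme a = ball⊆hull _ (≤-reflexive (trans (ν-cong (growthVertex≈ a)) (trans (ν∘A _) (Z-vertex a)))) ,
      λ x y t x∈hull y∈hull 0<t t<1 p →
        let Bp : vertexScale a ∙ e (proj₂ a) ≈² (1# - t) ∙ B x +² t ∙ B y
            Bp = ≈²-trans (≈²-sym (B∘A _)) (≈²-trans (B-cong (≈²-trans (≈²-sym (growthVertex≈ a)) p))
                   (≈²-trans (B-+ _ _) (+²-cong (B-∙ _ x) (B-∙ _ y))))
        in back x (vertex-extreme a (<⇒0<- t<1) 0<t (ring≈ (t ∷ [])) (hull⊆ball x x∈hull) (hull⊆ball y y∈hull) Bp) ,
           back y (vertex-extreme a 0<t (<⇒0<- t<1) (ring≈ (t ∷ [])) (hull⊆ball y y∈hull) (hull⊆ball x x∈hull)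
             (≈²-trans Bp (+-comm _ _ , +-comm _ _)))
      where
      back : ∀ x → B x ≈² vertexScale a ∙ e (proj₂ a) → x ≈² growthVertex g a
      back x Bx≈ = ≈²-trans (≈²-sym (A∘B x)) (≈²-trans (A-cong Bx≈) (≈²-sym (growthVertex≈ a)))

    sphere-isPolygon : IsPolygonWithVertices Sphere (growthVertex g)
    sphere-isPolygon = record
      { distinct = distinct
      ; extreme  = growthVertex-extreme
      ; boundary = sphere≐∂ hull hull⊆ball ball⊆hull
      }

    -- Levels and cells of the grid.

    module Grid (γ : Fin (suc (suc n)) → ℝ) where

      infix 4 _on_
      _on_ : ℝ² → Line g γ → Set
      _on_ = _liesOn_ g γ

      abstract
        level : ℝ² → Fin N → ℝ
        level x j = ⟨ x , g j ⟩ - γ j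

        level-def : ∀ x j → level x j ≈ ⟨ x , g j ⟩ - γ j
        level-def x j = refl

      level-difference : ∀ x y j → level x j - level y j ≈ coord (x -² y) j
      level-difference x y j = trans (+-cong (level-def x j) (-‿cong (level-def y j)))
        (trans (cancel (coord-def x j) (coord-def y j)) (sym (coord-- x y j)))
        where
        cancel : ∀ {a b c d e} → c ≈ a → d ≈ b → (a - e) - (b - e) ≈ c - d
        cancel {a} {b} {c} {d} {e} p q = lin≈ (a ∷ b ∷ c ∷ d ∷ e ∷ []) (eq (sym p) ⊕ eq q)

      level-+ : ∀ x v j → level (x +² v) j ≈ level x j + coord v j
      level-+ x v j = rearrange (level-difference (x +² v) x j) (coord-cong (cancel (proj₁ x) (proj₁ v) , cancel (proj₂ x) (proj₂ v)) j)
        where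
        cancel : ∀ a b → (a + b) - a ≈ b
        cancel a b = ring≈ (a ∷ b ∷ [])
        rearrange : ∀ {a b c d} → a - b ≈ c → c ≈ d → a ≈ b + d
        rearrange {a} {b} {c} {d} p q = lin≈ (a ∷ b ∷ c ∷ d ∷ []) (eq p ⊕ eq q)

      level-segment : ∀ x y t j → level (segment x y t) j ≈ level x j + t * (level y j - level x j)
      level-segment x y t j = trans (level-+ x _ j) (+-congˡ (trans (coord-∙ t _ j) (*-congˡ (sym (level-difference y x j)))))

      on⇒level : ∀ {x i m} → x on (i , m) → level x i ≈ fromℤ m
      on⇒level p = trans (level-def _ _) p

      level⇒on : ∀ {x i m} → level x i ≈ fromℤ m → x on (i , m)
      level⇒on p = trans (sym (level-def _ _)) p

      offGrid⇒noninteger : ∀ {x} → x ∈ OffGrid g γ → ∀ j → ¬ IsInteger (level x j)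
      offGrid⇒noninteger {x} off j (m , p) = off (j , m) (level⇒on {x} {j} {m} p)

      noninteger⇒offGrid : ∀ {x} → (∀ j → ¬ IsInteger (level x j)) → x ∈ OffGrid g γ
      noninteger⇒offGrid {x} ¬int (j , m) x∈h = ¬int j (m , on⇒level {x} {j} {m} x∈h)

      ball-level : ∀ {c r y} → Ball c r y → ∀ j → ∣ level y j - level c j ∣ < r
      ball-level {c} {r} {y} b j = <-resp (∣∣-cong (sym (trans (level-difference y c j) (coord-def _ j)))) refl
        (ball-projection {c} {r} {y} {g j} (unit j) b)

      open-below : ∀ j c → Open (λ x → level x j < c)
      open-below j c x x<c = c - level x j , <⇒0<- x<c , λ {y} y∈B → bound (∣∣-<ˡ (ball-level {x} {c - level x j} {y} y∈B j))
        where
        bound : ∀ {a} → a - level x j < c - level x j → a < c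
        bound {a} p = lin< (a ∷ level x j ∷ c ∷ []) (lt p)

      open-above : ∀ j c → Open (λ x → c < level x j)
      open-above j c x c<x = level x j - c , <⇒0<- c<x , λ {y} y∈B → bound (∣∣-<ʳ (ball-level {x} {level x j - c} {y} y∈B j))
        where
        bound : ∀ {a} → - (a - level x j) < level x j - c → c < a
        bound {a} p = lin< (a ∷ level x j ∷ c ∷ []) (lt p)

      ball-shrink : ∀ {c r s y} → 0# < r → r ≤ s → Ball c r y → Ball c s y
      ball-shrink {c} {r} {s} {y} 0<r r≤s (_ , d<r²) = ≤-trans (<⇒≤ 0<r) r≤s , <-≤-trans d<r²
        (lin≤ (r ∷ s ∷ []) (le r≤s ⊗ (le r≤s ⊕ lt 0<r ⊕ lt 0<r)))

      open-∩ : ∀ {P Q : Pred ℝ² 0ℓ} → Open P → Open Q → Open (P ∩ Q)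
      open-∩ P-open Q-open x (x∈P , x∈Q) = let r , 0<r , p = P-open x x∈P ; s , 0<s , q = Q-open x x∈Q in
        min r s , min-glb-< 0<r 0<s , λ {y} y∈B →
          p {y} (ball-shrink {x} {min r s} {r} {y} (min-glb-< 0<r 0<s) (min-≤ˡ r s) y∈B) ,
          q {y} (ball-shrink {x} {min r s} {s} {y} (min-glb-< 0<r 0<s) (min-≤ʳ r s) y∈B)

      open-∪ : ∀ {P Q : Pred ℝ² 0ℓ} → Open P → Open Q → Open (P ∪ Q)
      open-∪ P-open Q-open x (inj₁ x∈P) = let r , 0<r , p = P-open x x∈P in r , 0<r , λ {y} y∈B → inj₁ (p {y} y∈B)
      open-∪ P-open Q-open x (inj₂ x∈Q) = let r , 0<r , q = Q-open x x∈Q in r , 0<r , λ {y} y∈B → inj₂ (q {y} y∈B)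

      Strip : Fin N → ℝ → Pred ℝ² 0ℓ
      Strip j k x = k - 1# < level x j × level x j < k

      -- A set off the grid lies in the union of the open strip between two consecutive lines of
      -- family j and its open outside. A connected one that meets the strip cannot meet the
      -- outside.
      component⊆strip : ∀ {y} → y ∈ OffGrid g γ → ∀ {x} → x ∈ Component (OffGrid g γ) y → ∀ j → x ∈ Strip j (up (level y j))
      component⊆strip {y} y-off {x} (S , S⊆off , connected , y∈S , x∈S) j = conclude (classify x∈S)
        where
        k : ℝ
        k = up (level y j)
        k-int : IsInteger k
        k-int = up-isInteger (level y j)
        Outside : Pred ℝ² 0ℓ
        Outside x = level x j < k - 1# ⊎ k < level x j
        classify : ∀ {x} → x ∈ S → x ∈ Strip j k ⊎ x ∈ Outside
        classify {x} x∈S with trichotomy (level x j) (k - 1#) | trichotomy (level x j) k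
        ... | less p    | _         = inj₂ (inj₁ p)
        ... | equal p   | _         =
          ⊥-elim (offGrid⇒noninteger (S⊆off x∈S) j (isInteger-resp (sym p) (isInteger-+ k-int (isInteger-neg isInteger-1))))
        ... | greater p | less q    = inj₁ (p , q)
        ... | greater _ | equal q   = ⊥-elim (offGrid⇒noninteger (S⊆off x∈S) j (isInteger-resp (sym q) k-int))
        ... | greater _ | greater q = inj₂ (inj₂ q)
        y∈strip : y ∈ Strip j k
        y∈strip = below (up<t+1 (level y j)) , t≤up (level y j) ,
          λ p → offGrid⇒noninteger y-off j (isInteger-resp (sym p) k-int)
          where
          below : ∀ {a b} → a < b + 1# → a - 1# < b
          below {a} {b} p = lin< (a ∷ b ∷ []) (lt p)
        disjoint : ∀ {z} → ¬ (z ∈ Strip j k × z ∈ Outside)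
        disjoint ((p , _) , inj₁ r) = <⇒≱ p (<⇒≤ r)
        disjoint ((_ , q) , inj₂ r) = <⇒≱ q (<⇒≤ r)
        conclude : x ∈ Strip j k ⊎ x ∈ Outside → x ∈ Strip j k
        conclude (inj₁ x∈strip)   = x∈strip
        conclude (inj₂ x∈outside) =
          let z , _ , z∈strip , z∈outside = connected (Strip j k) Outside
                (open-∩ (open-above j (k - 1#)) (open-below j k)) (open-∪ (open-below j (k - 1#)) (open-above j k))
                classify (y , y∈S , y∈strip) (x , x∈S , x∈outside)
          in ⊥-elim (disjoint (z∈strip , z∈outside))

      cell⇒levels : ∀ {p y} → y ∈ OffGrid g γ → p ∈ Cell g γ y → ∀ j →
        up (level y j) - 1# ≤ level p j × level p j ≤ up (level y j)
      cell⇒levels {p} {y} y-off p∈cell j = ≮⇒≥ tooLow , ≮⇒≥ tooHigh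
        where
        tooLow : ¬ level p j < up (level y j) - 1#
        tooLow q = let x , x∈B , x∈C = p∈cell _ (<⇒0<- q) in
          contra (proj₁ (component⊆strip y-off x∈C j)) (∣∣-<ˡ (ball-level {p} x∈B j))
          where
          contra : ∀ {a} → up (level y j) - 1# < a → a - level p j < (up (level y j) - 1#) - level p j → ⊥
          contra {a} h₁ h₂ = refute (a ∷ up (level y j) ∷ level p j ∷ []) (lt h₁ ⊕ lt h₂)
        tooHigh : ¬ up (level y j) < level p j
        tooHigh q = let x , x∈B , x∈C = p∈cell _ (<⇒0<- q) in
          contra (proj₂ (component⊆strip y-off x∈C j)) (∣∣-<ʳ (ball-level {p} x∈B j))
          where
          contra : ∀ {a} → a < up (level y j) → - (a - level p j) < level p j - up (level y j) → ⊥
          contra {a} h₁ h₂ = refute (a ∷ up (level y j) ∷ level p j ∷ []) (lt h₁ ⊕ lt h₂)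

      cell⇒ceilings : ∀ {p y} → y ∈ OffGrid g γ → p ∈ Cell g γ y → ∀ j → Ceilings (level p j) (up (level y j))
      cell⇒ceilings {p} {y} y-off p∈cell j = let below , above = cell⇒levels y-off p∈cell j in
        up-least (up-isInteger _) above ,
        shift (dn-greatest (isInteger-+ (up-isInteger _) (isInteger-neg isInteger-1)) below)
        where
        shift : ∀ {a b} → a - 1# ≤ b → a ≤ b + 1#
        shift {a} {b} p = lin≤ (a ∷ b ∷ []) (le p)

      -- The points with the same strict level bounds as y form a convex, hence connected, set off
      -- the grid. A small move from p towards y makes all bounds strict, so this set comes
      -- arbitrarily close to p.
      levels⇒cell : ∀ {p y} → y ∈ OffGrid g γ →
        (∀ j → up (level y j) - 1# ≤ level p j × level p j ≤ up (level y j)) → p ∈ Cell g γ y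
      levels⇒cell {p} {y} y-off levels r 0<r = segment p y t ,
        ball (segment-near p y t 0# 0<r (≤-trans (≤-reflexive (trans (∣∣-cong (t-0 t)) (0≤⇒∣x∣≈x (<⇒≤ 0<t)))) (min-≤ʳ _ _))) ,
        U , (λ {x} → U⊆off x) , convex⇒connected U U-convex , y∈U , segment∈U
        where
        k : Fin N → ℝ
        k j = up (level y j)
        U : Pred ℝ² 0ℓ
        U x = ∀ j → k j - 1# < level x j × level x j < k j
        t : ℝ
        t = min 1# (scaleFor p y r)
        0<t : 0# < t
        0<t = min-glb-< 0<1 (scaleFor-pos p y 0<r)
        t-0 : ∀ t → t - 0# ≈ t
        t-0 t = ring≈ (t ∷ [])
        ball : Ball (segment p y 0#) r (segment p y t) → Ball p r (segment p y t)
        ball (0≤r , d<) = 0≤r , <-resp (+-cong (component (proj₁ p) (proj₁ y)) (component (proj₂ p) (proj₂ y))) refl d<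
          where
          component : ∀ p y → ((p + t * (y - p)) - (p + 0# * (y - p))) * ((p + t * (y - p)) - (p + 0# * (y - p))) ≈
            ((p + t * (y - p)) - p) * ((p + t * (y - p)) - p)
          component p y = squares t
            where
            squares : ∀ t → ((p + t * (y - p)) - (p + 0# * (y - p))) * ((p + t * (y - p)) - (p + 0# * (y - p))) ≈
              ((p + t * (y - p)) - p) * ((p + t * (y - p)) - p)
            squares t = ring≈ (p ∷ y ∷ t ∷ [])
        y∈U : y ∈ U
        y∈U j = below (up<t+1 (level y j)) , t≤up (level y j) ,
          λ q → offGrid⇒noninteger y-off j (isInteger-resp (sym q) (up-isInteger _))
          where
          below : ∀ {a b} → a < b + 1# → a - 1# < b
          below {a} {b} p = lin< (a ∷ b ∷ []) (lt p)
        U⊆off : ∀ x → x ∈ U → x ∈ OffGrid g γ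
        U⊆off x x∈U = noninteger⇒offGrid λ j int → strictly-between (integer-< int (up-isInteger _) (proj₂ (x∈U j))) (proj₁ (x∈U j))
          where
          strictly-between : ∀ {a k} → a + 1# ≤ k → k - 1# < a → ⊥
          strictly-between {a} {k} h₁ h₂ = refute (a ∷ k ∷ []) (le h₁ ⊕ lt h₂)
        mix-< : ∀ {a b c t} → 0# ≤ t → t ≤ 1# → a < c → b < c → a + t * (b - a) < c
        mix-< {a} {b} {c} {t} 0≤t t≤1 a<c b<c with trichotomy 0# t
        ... | less 0<t    = lin< (a ∷ b ∷ c ∷ t ∷ []) (lt 0<t ⊗ lt b<c ⊕ le t≤1 ⊗ lt a<c)
        ... | equal 0≈t   = lin< (a ∷ b ∷ c ∷ t ∷ []) (lt a<c ⊕ (b - a) · eq (sym 0≈t))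
        ... | greater t<0 = ⊥-elim (<⇒≱ t<0 0≤t)
        mix-> : ∀ {a b c t} → 0# ≤ t → t ≤ 1# → c < a → c < b → c < a + t * (b - a)
        mix-> {a} {b} {c} {t} 0≤t t≤1 c<a c<b with trichotomy 0# t
        ... | less 0<t    = lin< (a ∷ b ∷ c ∷ t ∷ []) (lt 0<t ⊗ lt c<b ⊕ le t≤1 ⊗ lt c<a)
        ... | equal 0≈t   = lin< (a ∷ b ∷ c ∷ t ∷ []) (lt c<a ⊕ (b - a) · eq 0≈t)
        ... | greater t<0 = ⊥-elim (<⇒≱ t<0 0≤t)
        U-convex : ∀ a b t → a ∈ U → b ∈ U → 0# ≤ t → t ≤ 1# → segment a b t ∈ U
        U-convex a b t a∈U b∈U 0≤t t≤1 j =
          <-resp refl (sym (level-segment a b t j)) (mix-> 0≤t t≤1 (proj₁ (a∈U j)) (proj₁ (b∈U j))) ,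
          <-resp (sym (level-segment a b t j)) refl (mix-< 0≤t t≤1 (proj₂ (a∈U j)) (proj₂ (b∈U j)))
        segment∈U : segment p y t ∈ U
        segment∈U j = <-resp refl (sym (level-segment p y t j)) (low t 0<t (min-≤ˡ _ _) (proj₁ (levels j)) (proj₁ (y∈U j))) ,
          <-resp (sym (level-segment p y t j)) refl (high t 0<t (min-≤ˡ _ _) (proj₂ (levels j)) (proj₂ (y∈U j)))
          where
          low : ∀ {a b c} t → 0# < t → t ≤ 1# → c ≤ a → c < b → c < a + t * (b - a)
          low {a} {b} {c} t 0<t t≤1 c≤a c<b = lin< (a ∷ b ∷ c ∷ t ∷ []) (lt 0<t ⊗ lt c<b ⊕ le t≤1 ⊗ le c≤a)
          high : ∀ {a b c} t → 0# < t → t ≤ 1# → a ≤ c → b < c → a + t * (b - a) < c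
          high {a} {b} {c} t 0<t t≤1 a≤c b<c = lin< (a ∷ b ∷ c ∷ t ∷ []) (lt 0<t ⊗ lt b<c ⊕ le t≤1 ⊗ le a≤c)

      -- Points of tiles and monotonicity.

      combine : (Fin N → ℝ) → ℝ²
      combine κ = sum² (λ j → κ j ∙ g j)

      K≈combine : ∀ y → K g γ y ≈² combine (λ j → up (level y j))
      K≈combine y = sum²-cong λ j → ∙-congʳ {v = g j} (up-cong (sym (level-def y j)))

      -- Averaging vertices K(y) averages their weights, and the intervals `Ceilings` are convex;
      -- hence every point of the hull has such weights.
      record TilePoint (p z : ℝ²) : Set where
        field
          κ        : Fin N → ℝ
          ceilings : ∀ j → Ceilings (level p j) (κ j)
          z≈       : z ≈² combine κ

      tilePoint : ∀ {p z} → z ∈ convexHull (tileVertices g γ p) → TilePoint p z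
      tilePoint {p} {z} (m , w , v , 0≤w , Σw≈1 , v∈ , z≈) = record
        { κ = λ j → sum (λ k → w k * a k j)
        ; ceilings = λ j → average-≥ (λ k → proj₁ (a-ceilings k j)) , average-≤ (λ k → proj₂ (a-ceilings k j))
        ; z≈ = ≈²-trans z≈ (swap proj₁ (λ k → proj₁ (v≈ k)) , swap proj₂ (λ k → proj₂ (v≈ k))) }
        where
        a : Fin m → Fin N → ℝ
        a k j = up (level (proj₁ (v∈ k)) j)
        a-ceilings : ∀ k j → Ceilings (level p j) (a k j)
        a-ceilings k = let y , y-off , p∈cell , _ = v∈ k in cell⇒ceilings y-off p∈cell
        v≈ : ∀ k → v k ≈² combine (a k)
        v≈ k = let y , _ , _ , v≈K = v∈ k in ≈²-trans v≈K (K≈combine y)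
        weigh : ∀ c → sum (λ k → w k * c) ≈ c
        weigh c = trans (sym (*-distribʳ-sum c w)) (trans (*-congʳ Σw≈1) (*-identityˡ c))
        scale : ∀ {w a b} → 0# ≤ w → a ≤ b → w * a ≤ w * b
        scale {w} {a} {b} p q = lin≤ (w ∷ a ∷ b ∷ []) (le p ⊗ le q)
        average-≥ : ∀ {f : Fin m → ℝ} {c} → (∀ k → c ≤ f k) → c ≤ sum (λ k → w k * f k)
        average-≥ {f} {c} p = ≤-trans (≤-reflexive (sym (weigh c))) (sum-mono (λ k → scale (0≤w k) (p k)))
        average-≤ : ∀ {f : Fin m → ℝ} {c} → (∀ k → f k ≤ c) → sum (λ k → w k * f k) ≤ c
        average-≤ {f} {c} p = ≤-trans (sum-mono (λ k → scale (0≤w k) (p k))) (≤-reflexive (weigh c))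
        swap : ∀ (π : ℝ² → ℝ) {u : Fin m → ℝ} → (∀ k → u k ≈ sum (λ j → a k j * π (g j))) →
               sum (λ k → w k * u k) ≈ sum (λ j → sum (λ k → w k * a k j) * π (g j))
        swap π {u} h = trans (sum-cong-≋ (λ k → trans (*-congˡ (h k)) (*-distribˡ-sum (w k) (λ j → a k j * π (g j)))))
          (trans (∑-comm (λ k j → w k * (a k j * π (g j))))
            (sum-cong-≋ (λ j → trans (sum-cong-≋ (λ k → sym (*-assoc (w k) (a k j) (π (g j)))))
              (sym (*-distribʳ-sum (π (g j)) (λ k → w k * a k j))))))

      combine-difference : ∀ κ κ′ x → combine κ ≈² combine κ′ → sum (λ j → (κ j - κ′ j) * coord x j) ≈ 0#
      combine-difference κ κ′ x (p , q) = trans (sum-cong-≋ (λ j → expand (κ j) (κ′ j) (coord-def x j)))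
        (trans (∑-distrib-+ (λ j → proj₁ x * d₁ j) (λ j → proj₂ x * d₂ j))
          (trans (+-cong (trans (sym (*-distribˡ-sum (proj₁ x) d₁)) (*-congˡ (vanish {λ j → κ j * proj₁ (g j)} {λ j → κ′ j * proj₁ (g j)} p)))
                         (trans (sym (*-distribˡ-sum (proj₂ x) d₂)) (*-congˡ (vanish {λ j → κ j * proj₂ (g j)} {λ j → κ′ j * proj₂ (g j)} q)))) (ring≈ (proj₁ x ∷ proj₂ x ∷ []))))
        where
        d₁ d₂ : Fin N → ℝ
        d₁ j = κ j * proj₁ (g j) - κ′ j * proj₁ (g j)
        d₂ j = κ j * proj₂ (g j) - κ′ j * proj₂ (g j)
        vanish : ∀ {f h : Fin N → ℝ} → sum f ≈ sum h → sum (λ j → f j - h j) ≈ 0#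
        vanish {f} {h} p = trans (sum-sub f h) (trans (+-congˡ (-‿cong (sym p))) (-‿inverseʳ _))
        expand : ∀ k k′ {c a b} → c ≈ proj₁ x * a + proj₂ x * b → (k - k′) * c ≈ proj₁ x * (k * a - k′ * a) + proj₂ x * (k * b - k′ * b)
        expand k k′ {c} {a} {b} h = lin≈ (k ∷ k′ ∷ c ∷ a ∷ b ∷ proj₁ x ∷ proj₂ x ∷ []) ((k - k′) · eq h)

      -- K is monotone: 0 = (z - z , p - q) = Σⱼ (κⱼ - κ′ⱼ)(pⱼ - qⱼ) has only
      -- nonnegative terms.
      common-point : ∀ {p q z} (P : TilePoint p z) (Q : TilePoint q z) → let open TilePoint in
        ∀ j → ¬ level p j ≈ level q j → κ P j ≈ κ Q j
      common-point {p} {q} {z} P Q j pⱼ≉qⱼ = zero-product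
        (antisym (≤-trans (term≤sum 0≤S j) (≤-reflexive ΣS≈0)) (0≤S j)) (level-difference p q j)
        where
        open TilePoint
        S : Fin N → ℝ
        S j = (κ P j - κ Q j) * coord (p -² q) j
        ΣS≈0 : sum S ≈ 0#
        ΣS≈0 = combine-difference (κ P) (κ Q) (p -² q) (≈²-trans (≈²-sym (z≈ P)) (z≈ Q))
        0≤S : ∀ j → 0# ≤ S j
        0≤S j with trichotomy (level p j) (level q j)
        ... | less p<q    = nonneg (≤-trans (proj₂ (ceilings P j)) (≤-trans (dn+1≤up p<q) (proj₁ (ceilings Q j)))) (level-difference p q j) (<⇒≤ p<q)
          where
          nonneg : ∀ {a b c d e} → a ≤ b → d - e ≈ c → d ≤ e → 0# ≤ (a - b) * c
          nonneg {a} {b} {c} {d} {e} h₁ h₂ h₃ = lin≤ (a ∷ b ∷ c ∷ d ∷ e ∷ []) (le h₁ ⊗ le h₃ ⊕ (a - b) · eq h₂)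
        ... | equal p≈q   = ≤-reflexive (sym (trans (*-congˡ (trans (sym (level-difference p q j)) (trans (+-congʳ p≈q) (-‿inverseʳ _)))) (zeroʳ _)))
        ... | greater q<p = nonneg (≤-trans (proj₂ (ceilings Q j)) (≤-trans (dn+1≤up q<p) (proj₁ (ceilings P j)))) (level-difference p q j) (<⇒≤ q<p)
          where
          nonneg : ∀ {a b c d e} → b ≤ a → d - e ≈ c → e ≤ d → 0# ≤ (a - b) * c
          nonneg {a} {b} {c} {d} {e} h₁ h₂ h₃ = lin≤ (a ∷ b ∷ c ∷ d ∷ e ∷ []) (le h₁ ⊗ le h₃ ⊕ (a - b) · eq h₂)
        zero-product : S j ≈ 0# → level p j - level q j ≈ coord (p -² q) j → κ P j ≈ κ Q j
        zero-product h d≈ with decide (κ P j ≈ κ Q j)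
        ... | yes e = e
        ... | no ne = ⊥-elim (*-≉0 (λ r → ne (sym (-≈0⇒≈ r))) (λ r → pⱼ≉qⱼ (sym (-≈0⇒≈ (trans d≈ r)))) h)

      -- Crossings and the lines separating them.

      Vertex : Set
      Vertex = Crossing g γ

      point : Vertex → ℝ²
      point = proj₁

      tileAt : ℝ² → Pred ℝ² (lsuc 0ℓ)
      tileAt p = convexHull (tileVertices g γ p)

      tileAt-cong : ∀ {p q} → p ≈² q → ∀ {z} → z ∈ tileAt p → z ∈ tileAt q
      tileAt-cong {p} {q} (p₁≈ , p₂≈) = convexHull-mono {S = tileVertices g γ p} {T = tileVertices g γ q} λ { (y , y-off , p∈cell , v≈) → y , y-off , move p∈cell , v≈ }
        where
        move : ∀ {y} → p ∈ Cell g γ y → q ∈ Cell g γ y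
        move p∈cell r 0<r = let x , (0≤r , d<) , x∈ = p∈cell r 0<r in x , (0≤r , <-resp
          (+-cong (*-cong (+-congˡ (-‿cong p₁≈)) (+-congˡ (-‿cong p₁≈))) (*-cong (+-congˡ (-‿cong p₂≈)) (+-congˡ (-‿cong p₂≈)))) refl d<) , x∈

      record TwoLines (p : ℝ²) : Set where
        field
          a b   : Fin N
          a≢b   : a ≢ b
          int-a : IsInteger (level p a)
          int-b : IsInteger (level p b)

      twoLines : ∀ (v : Vertex) → TwoLines (point v)
      twoLines (p , (a , m) , (b , m′) , h≢ , p∈h , p∈h′) = record
        { a = a ; b = b ; a≢b = distinct-families ; int-a = m , on⇒level {p} {a} {m} p∈h ; int-b = m′ , on⇒level {p} {b} {m′} p∈h′ }
        where
        distinct-families : a ≢ b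
        distinct-families ≡.refl = h≢ (≡.cong (a ,_) (fromℤ-injective {m} {m′} (trans (sym p∈h) p∈h′)))

      vertex : ∀ p a b → a ≢ b → IsInteger (level p a) → IsInteger (level p b) → Vertex
      vertex p a b a≢b (m , pₐ≈m) (m′ , p_b≈m′) =
        p , (a , m) , (b , m′) , (λ h → a≢b (≡.cong proj₁ h)) , level⇒on {p} {a} {m} pₐ≈m , level⇒on {p} {b} {m′} p_b≈m′

      -- Twice the number of lines separating p from q, lines through p or q
      -- counting one half.
      abstract
        separation : ℝ² → ℝ² → ℝ
        separation p q = sum (λ j → ∣ E (level q j) - E (level p j) ∣)

        separation-term : ∀ p q j → ∣ E (level q j) - E (level p j) ∣ ≤ separation p q
        separation-term p q j = term≤sum {f = λ j → ∣ E (level q j) - E (level p j) ∣} (λ j → 0≤∣ _ ∣) j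

        separation-≤ : ∀ p q f → (∀ j → ∣ E (level q j) - E (level p j) ∣ ≤ f j) → separation p q ≤ sum f
        separation-≤ p q f h = sum-mono h

        separation-≥ : ∀ p q f → (∀ j → f j ≤ ∣ E (level q j) - E (level p j) ∣) → sum f ≤ separation p q
        separation-≥ p q f h = sum-mono h

        separation-triangle : ∀ p q r → separation p r ≤ separation p q + separation q r
        separation-triangle p q r = ≤-trans (sum-mono (λ j → ≤-trans (≤-reflexive (∣∣-cong (split (E (level p j)) (E (level q j)) (E (level r j)))))
          (∣∣-triangle (E (level q j) - E (level p j)) (E (level r j) - E (level q j)))))
          (≤-reflexive (∑-distrib-+ (λ j → ∣ E (level q j) - E (level p j) ∣) (λ j → ∣ E (level r j) - E (level q j) ∣)))
          where
          split : ∀ a b c → c - a ≈ (b - a) + (c - b)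
          split a b c = ring≈ (a ∷ b ∷ c ∷ [])

        separation-additive : ∀ p q r →
          (∀ j → ∣ E (level q j) - E (level p j) ∣ + ∣ E (level r j) - E (level q j) ∣ ≤ ∣ E (level r j) - E (level p j) ∣) →
          separation p q + separation q r ≤ separation p r
        separation-additive p q r h = ≤-trans (≤-reflexive (sym
          (∑-distrib-+ (λ j → ∣ E (level q j) - E (level p j) ∣) (λ j → ∣ E (level r j) - E (level q j) ∣)))) (sum-mono h)

      #N : ℝ
      #N = fromℕ N

      sum-affine : ∀ (f : Fin N → ℝ) c → sum (λ j → (f j + f j) + c) ≈ (sum f + sum f) + #N * c
      sum-affine f c = trans (∑-distrib-+ (λ j → f j + f j) (λ _ → c)) (+-cong (∑-distrib-+ f f) (sum-const N c))

      -- At each end `E` differs from doubling by at most 1; so separation is 2 Z up to an error of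
      -- 2 for each family.
      ∣E-E∣≤ : ∀ s t → ∣ E t - E s ∣ ≤ (∣ t - s ∣ + ∣ t - s ∣) + (1# + 1#)
      ∣E-E∣≤ s t = ∣∣-≤
        (lin≤ (s ∷ t ∷ E s ∷ E t ∷ ∣ t - s ∣ ∷ []) (le (E≤2t+1 t) ⊕ le (2t≤E+1 s) ⊕ le (x≤∣x∣ (t - s)) ⊕ le (x≤∣x∣ (t - s))))
        (lin≤ (s ∷ t ∷ E s ∷ E t ∷ ∣ t - s ∣ ∷ []) (le (E≤2t+1 s) ⊕ le (2t≤E+1 t) ⊕ le (-x≤∣x∣ (t - s)) ⊕ le (-x≤∣x∣ (t - s))))

      2∣t-s∣≤ : ∀ s t → ∣ t - s ∣ + ∣ t - s ∣ ≤ ∣ E t - E s ∣ + (1# + 1#)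
      2∣t-s∣≤ s t = go (2t≤E+1 t) (E≤2t+1 s) (2t≤E+1 s) (E≤2t+1 t)
        where
        scale : ∀ {x y z} → x ≤ y → - x ≤ y → z ≈ ∣ x ∣ → z ≤ y
        scale h k l = ≤-trans (≤-reflexive l) (∣∣-≤ h k)
        go : ∀ {u v} → t + t ≤ u + 1# → v ≤ s + s + 1# → s + s ≤ v + 1# → u ≤ t + t + 1# →
          ∣ t - s ∣ + ∣ t - s ∣ ≤ ∣ u - v ∣ + (1# + 1#)
        go {u} {v} h₁ h₂ h₃ h₄ = scale {(t - s) + (t - s)}
          (lin≤ (s ∷ t ∷ u ∷ v ∷ ∣ u - v ∣ ∷ []) (le h₁ ⊕ le h₂ ⊕ le (x≤∣x∣ (u - v))))
          (lin≤ (s ∷ t ∷ u ∷ v ∷ ∣ u - v ∣ ∷ []) (le h₃ ⊕ le h₄ ⊕ le (-x≤∣x∣ (u - v))))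
          (sym (∣∣-additive (0≤x*x (t - s))))

      Z≈sum-levels : ∀ p q → Z (q -² p) ≈ sum (λ j → ∣ level q j - level p j ∣)
      Z≈sum-levels p q = trans (Z-def _) (sum-cong-≋ (λ j → ∣∣-cong (sym (level-difference q p j))))

      separation≤Z : ∀ p q → separation p q ≤ (Z (q -² p) + #N) + (Z (q -² p) + #N)
      separation≤Z p q = ≤-trans (separation-≤ p q _ (λ j → ∣E-E∣≤ (level p j) (level q j)))
        (≤-trans (≤-reflexive (sum-affine (λ j → ∣ level q j - level p j ∣) (1# + 1#))) (regroup (Z≈sum-levels p q)))
        where
        regroup : ∀ {z s} → z ≈ s → (s + s) + #N * (1# + 1#) ≤ (z + #N) + (z + #N)
        regroup {z} {s} h = atom #N
          where
          atom : ∀ m → (s + s) + m * (1# + 1#) ≤ (z + m) + (z + m)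
          atom m = lin≤ (z ∷ s ∷ m ∷ []) (eq (sym h) ⊕ eq (sym h))

      Z≤separation : ∀ p q → Z (q -² p) + Z (q -² p) ≤ separation p q + (#N + #N)
      Z≤separation p q = ≤-trans (≤-reflexive (trans (+-cong (Z≈sum-levels p q) (Z≈sum-levels p q))
          (sym (∑-distrib-+ (λ j → ∣ level q j - level p j ∣) (λ j → ∣ level q j - level p j ∣)))))
        (≤-trans (sum-mono (λ j → 2∣t-s∣≤ (level p j) (level q j)))
          (≤-trans (≤-reflexive (trans (∑-distrib-+ (λ j → ∣ E (level q j) - E (level p j) ∣) (λ _ → 1# + 1#)) (+-congˡ (sum-const N (1# + 1#)))))
            (atom #N (separation-≥ p q (λ j → ∣ E (level q j) - E (level p j) ∣) (λ j → ≤-refl)))))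
        where
        atom : ∀ m {s t} → s ≤ t → s + m * (1# + 1#) ≤ t + (m + m)
        atom m {s} {t} h = lin≤ (m ∷ s ∷ t ∷ []) (le h)

      E-equal : ∀ {s t} → s ≈ t → ∣ E t - E s ∣ ≈ 0#
      E-equal {s} {t} s≈t = trans (∣∣-cong (difference (antisym (E-mono (≤-reflexive s≈t)) (E-mono (≤-reflexive (sym s≈t)))))) (0≤⇒∣x∣≈x ≤-refl)
        where
        difference : ∀ {a b} → a ≈ b → b - a ≈ 0#
        difference {a} {b} h = lin≈ (a ∷ b ∷ []) (eq (sym h))

      module _ {p q z : ℝ²} (P : TilePoint p z) (Q : TilePoint q z) where
        open TilePoint

        -- By monotonicity the shared point has one weight for both crossings, and this lies in both
        -- intervals `Ceilings`. So no line of family j runs strictly between them; lines through p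
        -- or q are all that count.
        common-E : ∀ j → ¬ level p j ≈ level q j → ∣ E (level q j) - E (level p j) ∣ ≤ integrality (level p j) + integrality (level q j)
        common-E j p≉q with trichotomy (level p j) (level q j)
        ... | less p<q    = E-near p<q (ceilings P j) (ceilings-resp (sym (common-point P Q j p≉q)) (ceilings Q j))
          where
          ceilings-resp : ∀ {s a b} → a ≈ b → Ceilings s a → Ceilings s b
          ceilings-resp a≈b (h , k) = ≤-resp refl a≈b h , ≤-resp a≈b refl k
        ... | equal p≈q   = ⊥-elim (p≉q p≈q)
        ... | greater q<p = ≤-trans (≤-reflexive (∣x-y∣≈∣y-x∣ _ _)) (≤-trans
          (E-near q<p (ceilings Q j) (ceilings-resp (common-point P Q j p≉q) (ceilings P j))) (≤-reflexive (+-comm _ _)))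
          where
          ceilings-resp : ∀ {s a b} → a ≈ b → Ceilings s a → Ceilings s b
          ceilings-resp a≈b (h , k) = ≤-resp refl a≈b h , ≤-resp a≈b refl k

        common-separation : separation p q ≤ #N * (1# + 1#)
        common-separation = ≤-trans (separation-≤ p q (λ _ → 1# + 1#) term) (≤-reflexive (sum-const N (1# + 1#)))
          where
          term : ∀ j → ∣ E (level q j) - E (level p j) ∣ ≤ 1# + 1#
          term j = go (decide (level p j ≈ level q j))
            where
            two : ∀ {a b} → a ≤ 1# → b ≤ 1# → a + b ≤ 1# + 1#
            two {a} {b} h k = lin≤ (a ∷ b ∷ []) (le h ⊕ le k)
            go : Dec (level p j ≈ level q j) → ∣ E (level q j) - E (level p j) ∣ ≤ 1# + 1#
            go (yes p≈q) = ≤-trans (≤-reflexive (E-equal p≈q)) (lin≤ [] 1+)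
            go (no p≉q)  = ≤-trans (common-E j p≉q) (two (integrality≤1 _) (integrality≤1 _))

      -- Two tiles at p and q that meet in more than one point come from
      -- crossings on a common line: otherwise κ is determined in every family.
      forced-κ : ∀ {p q z z′} (P : TilePoint p z) (Q : TilePoint q z) (P′ : TilePoint p z′) (Q′ : TilePoint q z′) j →
        (IsInteger (level p j) → ¬ level p j ≈ level q j) → TilePoint.κ P j ≈ TilePoint.κ P′ j
      forced-κ {p} {q} P Q P′ Q′ j h = go (trichotomy (level p j) (level q j))
        where
        open TilePoint
        sandwich : ∀ {a b k l k′ l′} → k ≈ l → k′ ≈ l′ → k ≤ a → a ≤ b → b ≤ l → k′ ≤ a → b ≤ l′ → k ≈ k′
        sandwich {a} {b} {k} {l} {k′} {l′} e e′ h₁ h₂ h₃ h₄ h₅ = antisym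
          (lin≤ (a ∷ b ∷ k ∷ k′ ∷ l′ ∷ []) (le h₁ ⊕ le h₂ ⊕ le h₅ ⊕ eq (sym e′)))
          (lin≤ (a ∷ b ∷ k ∷ k′ ∷ l ∷ []) (le h₄ ⊕ le h₂ ⊕ le h₃ ⊕ eq (sym e)))
        go : Trichotomy (level p j) (level q j) → κ P j ≈ κ P′ j
        go (less p<q) = sandwich (common-point P Q j (proj₂ p<q)) (common-point P′ Q′ j (proj₂ p<q))
          (proj₂ (ceilings P j)) (dn+1≤up p<q) (proj₁ (ceilings Q j)) (proj₂ (ceilings P′ j)) (proj₁ (ceilings Q′ j))
        go (greater q<p) = trans (common-point P Q j (<⇒≉ q<p)) (trans
          (sandwich (sym (common-point P Q j (<⇒≉ q<p))) (sym (common-point P′ Q′ j (<⇒≉ q<p)))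
            (proj₂ (ceilings Q j)) (dn+1≤up q<p) (proj₁ (ceilings P j)) (proj₂ (ceilings Q′ j)) (proj₁ (ceilings P′ j)))
          (sym (common-point P′ Q′ j (<⇒≉ q<p))))
        go (equal p≈q) = trans (sym (squeeze P)) (squeeze P′)
          where
          squeeze : ∀ {z} (P : TilePoint p z) → up (level p j) ≈ κ P j
          squeeze P = antisym (proj₁ (ceilings P j)) (≤-trans (proj₂ (ceilings P j))
            (≤-reflexive (sym (noninteger-rounding (λ int → h int p≈q)))))

      combine-cong : ∀ {κ κ′} → (∀ j → κ j ≈ κ′ j) → combine κ ≈² combine κ′
      combine-cong h = sum²-cong (λ j → ∙-congʳ {v = g j} (h j))

      -- Lower bound for the length of a chain.

      module _ (regular : Regular g γ) where

        only-two : ∀ {p} (v : TwoLines p) → let open TwoLines v in ∀ j → IsInteger (level p j) → a ≡ j ⊎ b ≡ j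
        only-two {p} record { a = a ; b = b ; a≢b = a≢b ; int-a = m , pₐ ; int-b = m′ , p_b } j (m″ , pⱼ)
          with regular p (a , m) (b , m′) (j , m″) (level⇒on {p} {a} {m} pₐ) (level⇒on {p} {b} {m′} p_b) (level⇒on {p} {j} {m″} pⱼ)
        ... | inj₁ h        = ⊥-elim (a≢b (≡.cong proj₁ h))
        ... | inj₂ (inj₁ h) = inj₁ (≡.cong proj₁ h)
        ... | inj₂ (inj₂ h) = inj₂ (≡.cong proj₁ h)

        second-line : ∀ {p} (v : TwoLines p) i → IsInteger (level p i) → ∃ λ a → ∀ j → j ≢ i → IsInteger (level p j) → a ≡ j
        second-line v i int-i with only-two v i int-i
        ... | inj₁ ≡.refl = TwoLines.b v , λ j j≢i int-j → case only-two v j int-j of λ { (inj₁ a≡j) → ⊥-elim (j≢i (≡.sym a≡j)) ; (inj₂ b≡j) → b≡j }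
        ... | inj₂ ≡.refl = TwoLines.a v , λ j j≢i int-j → case only-two v j int-j of λ { (inj₁ a≡j) → a≡j ; (inj₂ b≡j) → ⊥-elim (j≢i (≡.sym b≡j)) }

        -- With no common line the tiles would share at most one point, by `forced-κ`. The family i
        -- of a common line contributes nothing, and by regularity each crossing lies on at most one
        -- line of another family, which costs at most 1 by `common-E`.
        neighbours⇒separation≤2 : ∀ (u v : Vertex) → Neighbours (gridTiling g γ) u v → separation (point u) (point v) ≤ 1# + 1#
        neighbours⇒separation≤2 u v neighbours = go (decide (∃ λ i → IsInteger (level p i) × level p i ≈ level q i))
          where
          p q : ℝ²
          p = point u
          q = point v
          go : Dec (∃ λ i → IsInteger (level p i) × level p i ≈ level q i) → separation p q ≤ 1# + 1#
          go (no ¬shared) = ⊥-elim (neighbours (subsingleton-lengthZero λ x y x∈ y∈ →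
            let P  = tilePoint (proj₁ x∈) ; Q  = tilePoint (proj₂ x∈)
                P′ = tilePoint (proj₁ y∈) ; Q′ = tilePoint (proj₂ y∈)
            in ≈²-trans (TilePoint.z≈ P) (≈²-trans (combine-cong (λ j → forced-κ P Q P′ Q′ j (λ int p≈q → ¬shared (j , int , p≈q))))
                 (≈²-sym (TilePoint.z≈ P′)))))
          go (yes (i , int-i , pᵢ≈qᵢ)) with em {∃ λ z → z ∈ (tileAt p ∩ tileAt q)}
          ... | no empty = ⊥-elim (neighbours (subsingleton-lengthZero λ x y x∈ _ → ⊥-elim (empty (x , x∈))))
          ... | yes (z , z∈p , z∈q) = bound (second-line (twoLines u) i int-i) (second-line (twoLines v) i (isInteger-resp pᵢ≈qᵢ int-i))
            where
            bound : (∃ λ a → ∀ j → j ≢ i → IsInteger (level p j) → a ≡ j) → (∃ λ b → ∀ j → j ≢ i → IsInteger (level q j) → b ≡ j) →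
              separation p q ≤ 1# + 1#
            bound (a , only-a) (b , only-b) = ≤-trans (separation-≤ p q (λ j → indicator a j + indicator b j) term)
              (≤-reflexive (trans (∑-distrib-+ (indicator a) (indicator b)) (+-cong (sum-indicator a) (sum-indicator b))))
              where
              integrality≤ : ∀ {x a} → (∀ j → j ≢ i → IsInteger (level x j) → a ≡ j) → ∀ j → j ≢ i → integrality (level x j) ≤ indicator a j
              integrality≤ {x} {a} only j j≢i = by-integrality (decide (IsInteger (level x j)))
                where
                by-integrality : Dec (IsInteger (level x j)) → integrality (level x j) ≤ indicator a j
                by-integrality (no ¬int) = ≤-trans (≤-reflexive (integrality-noninteger ¬int)) (indicator-nonNeg a j)
                by-integrality (yes int) = ≤-trans (integrality≤1 _)
                  (≤-reflexive (sym (≡.subst (λ k → indicator a k ≈ 1#) (only j j≢i int) (indicator-refl a))))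
              add : ∀ {a b c d} → a ≤ c → b ≤ d → a + b ≤ c + d
              add {a} {b} {c} {d} h k = lin≤ (a ∷ b ∷ c ∷ d ∷ []) (le h ⊕ le k)
              term : ∀ j → ∣ E (level q j) - E (level p j) ∣ ≤ indicator a j + indicator b j
              term j = by-level (decide (level p j ≈ level q j))
                where
                by-level : Dec (level p j ≈ level q j) → ∣ E (level q j) - E (level p j) ∣ ≤ indicator a j + indicator b j
                by-level (yes pⱼ≈qⱼ) = ≤-trans (≤-reflexive (E-equal pⱼ≈qⱼ)) (+-nonNeg (indicator-nonNeg a j) (indicator-nonNeg b j))
                by-level (no pⱼ≉qⱼ)  = ≤-trans (common-E (tilePoint z∈p) (tilePoint z∈q) j pⱼ≉qⱼ)
                  (add (integrality≤ {p} only-a j j≢i) (integrality≤ {q} only-b j j≢i))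
                  where
                  j≢i : j ≢ i
                  j≢i ≡.refl = pⱼ≉qⱼ pᵢ≈qᵢ

        -- Each step adds at most 2. The constant is spent once, at the end of the chain, where
        -- `here` equates tiles as sets and says nothing directly about their crossings.
        chain⇒separation : ∀ {u v : Vertex} {m} → Chain (gridTiling g γ) u v m → ∀ {z} → z ∈ tileAt (point v) →
          separation (point u) (point v) ≤ (fromℕ m + fromℕ m) + #N * (1# + 1#)
        chain⇒separation {u} {v} (here (_ , v⊆u)) z∈v = ≤-trans (common-separation (tilePoint (v⊆u z∈v)) (tilePoint z∈v)) (pad (#N * (1# + 1#)))
          where
          pad : ∀ x → x ≤ (0# + 0#) + x
          pad x = lin≤ (x ∷ []) none
        chain⇒separation {u} {v} {suc m} (advance {b = w} neighbours chain) z∈v = ≤-trans (separation-triangle (point u) (point w) (point v))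
          (add (fromℕ m) (#N * (1# + 1#)) (neighbours⇒separation≤2 u w neighbours) (chain⇒separation chain z∈v))
          where
          add : ∀ m c {a b} → a ≤ 1# + 1# → b ≤ (m + m) + c → a + b ≤ ((1# + m) + (1# + m)) + c
          add m c {a} {b} h k = lin≤ (m ∷ c ∷ a ∷ b ∷ []) (le h ⊕ le k)

      -- Consecutive crossings on a line have neighbouring tiles.

      ∣coord-g∣≤1 : ∀ i j → ∣ coord (g i) j ∣ ≤ 1#
      ∣coord-g∣≤1 i j = square-cancel-≤ (<⇒≤ 0<1) (bound (coord-def (g i) j) (unit-lagrange i j) (0≤x*x (D g i j)))
        where
        bound : ∀ {c b d} → c ≈ b → b * b + d ≈ 1# → 0# ≤ d → ∣ c ∣ * ∣ c ∣ ≤ 1# * 1#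
        bound {c} {b} {d} h k l = lin≤ (∣ c ∣ ∷ c ∷ b ∷ d ∷ []) (eq (∣x∣*∣x∣ c) ⊕ (c + b) · eq h ⊕ eq k ⊕ le l)

      coord-g-self : ∀ i → coord (g i) i ≈ 1#
      coord-g-self i = trans (coord-def (g i) i) (unit i)

      same-line : ∀ {p q} i → level p i ≈ level q i → q -² p ≈² ⟨ q -² p , e i ⟩ ∙ e i
      same-line {p} {q} i p≈q = coord≈0⇒multiple (q -² p) i (trans (sym (level-difference q p i)) (trans (+-congˡ (-‿cong p≈q)) (-‿inverseʳ _)))

      same-line-levels : ∀ {p q} i → level p i ≈ level q i → ∀ j → level q j - level p j ≈ ⟨ q -² p , e i ⟩ * coord (e i) j
      same-line-levels {p} {q} i p≈q j = trans (level-difference q p j) (trans (coord-cong (same-line {p} {q} i p≈q) j) (coord-∙ _ (e i) j))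

      distinct-levels : ∀ {p q} i → level p i ≈ level q i → ¬ p ≈² q → ∀ j → i ≢ j → ¬ level p j ≈ level q j
      distinct-levels {p} {q} i pᵢ≈qᵢ p≉q j i≢j pⱼ≈qⱼ = *-≉0 t≉0 (coord-e≉0 i≢j)
        (trans (sym (same-line-levels {p} {q} i pᵢ≈qᵢ j)) (trans (+-congˡ (-‿cong pⱼ≈qⱼ)) (-‿inverseʳ _)))
        where
        t≉0 : ¬ ⟨ q -² p , e i ⟩ ≈ 0#
        t≉0 t≈0 = p≉q (close (proj₁ (same-line {p} {q} i pᵢ≈qᵢ)) , close (proj₂ (same-line {p} {q} i pᵢ≈qᵢ)))
          where
          close : ∀ {a b c} → b - a ≈ ⟨ q -² p , e i ⟩ * c → a ≈ b
          close {a} {b} {c} h = -≈0⇒≈ (trans h (trans (*-congʳ t≈0) (zeroˡ c)))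

      -- The points `mid` ± σ g_i lie in the two cells on either side of the edge from p to q. Both
      -- cells contain p and q, and K grows by g_i across the line; so both tiles contain the unit
      -- segment between the two values of K.
      module CommonEdge (p q : ℝ²) (i : Fin N) (int-i : IsInteger (level p i)) (pᵢ≈qᵢ : level p i ≈ level q i) (p≉q : ¬ p ≈² q)
                        (none-between : ∀ j → NoIntegerBetween (level p j) (level q j) × NoIntegerBetween (level q j) (level p j)) where

        mid : ℝ²
        mid = segment p q half
        c : Fin N → ℝ
        c j = level mid j

        c-def : ∀ j → c j ≈ level p j + half * (level q j - level p j)
        c-def = level-segment p q half

        cᵢ≈pᵢ : c i ≈ level p i
        cᵢ≈pᵢ = trans (c-def i) (collapse pᵢ≈qᵢ)
          where
          collapse : ∀ {a b} → a ≈ b → a + half * (b - a) ≈ a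
          collapse {a} {b} h = lin≈ (a ∷ b ∷ half ∷ []) (half · eq (sym h))

        between : ∀ j → i ≢ j → ¬ IsInteger (c j) × (up (c j) - 1# ≤ level p j × level p j ≤ up (c j)) × (up (c j) - 1# ≤ level q j × level q j ≤ up (c j))
        between j i≢j with trichotomy (level p j) (level q j)
        ... | equal h   = ⊥-elim (distinct-levels {p} {q} i pᵢ≈qᵢ p≉q j i≢j h)
        ... | less h    = no-integer-between (proj₁ (none-between j)) (above h (c-def j)) (below h (c-def j))
          where
          above : ∀ {a b c} → a < b → c ≈ a + half * (b - a) → a < c
          above {a} {b} {c} h k = lin< (a ∷ b ∷ c ∷ half ∷ []) (eq (sym k) ⊕ lt 0<half ⊗ lt h)
          below : ∀ {a b c} → a < b → c ≈ a + half * (b - a) → c < b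
          below {a} {b} {c} h k = lin< (a ∷ b ∷ c ∷ half ∷ []) (eq k ⊕ lt 0<half ⊗ lt h ⊕ (b - a) · eq half+half)
        ... | greater h = let ¬int , q-bounds , p-bounds = no-integer-between (proj₂ (none-between j)) (above h (c-def j)) (below h (c-def j)) in ¬int , p-bounds , q-bounds
          where
          below : ∀ {a b c} → b < a → c ≈ a + half * (b - a) → c < a
          below {a} {b} {c} h k = lin< (a ∷ b ∷ c ∷ half ∷ []) (eq k ⊕ lt 0<half ⊗ lt h)
          above : ∀ {a b c} → b < a → c ≈ a + half * (b - a) → b < c
          above {a} {b} {c} h k = lin< (a ∷ b ∷ c ∷ half ∷ []) (eq (sym k) ⊕ lt 0<half ⊗ lt h ⊕ (a - b) · eq half+half)

        -- The distance from c j to the nearest integer other than c j itself. In family i, where c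
        -- i is an integer, it is 1, whence σ < 1.
        room : Fin N → ℝ
        room j = min (dn (c j) + 1# - c j) (c j - (up (c j) - 1#))

        0<room : ∀ j → 0# < room j
        0<room j = min-glb-< (<⇒0<- (t<dn+1 (c j))) (shift (up<t+1 (c j)))
          where
          shift : ∀ {a b} → a < b + 1# → 0# < b - (a - 1#)
          shift {a} {b} h = lin< (a ∷ b ∷ []) (lt h)

        η σ : ℝ
        η = proj₁ (positiveLowerBound room 0<room)
        σ = η * half

        0<σ : 0# < σ
        0<σ = half-pos (proj₁ (proj₂ (positiveLowerBound room 0<room)))

        σ<room : ∀ j → σ < room j
        σ<room j = <-≤-trans (half-< (proj₁ (proj₂ (positiveLowerBound room 0<room)))) (proj₂ (proj₂ (positiveLowerBound room 0<room)) j)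

        σ<1 : σ < 1#
        σ<1 = <-≤-trans (σ<room i) (≤-trans (min-≤ˡ _ _) (≤-reflexive (collapse (proj₂ (integer-rounding (isInteger-resp (sym cᵢ≈pᵢ) int-i))))))
          where
          collapse : ∀ {a b} → b ≈ a → b + 1# - a ≈ 1#
          collapse {a} {b} h = lin≈ (a ∷ b ∷ []) (eq h)

        y : ℝ → ℝ²
        y θ = mid +² θ ∙ g i

        level-y : ∀ θ j → level (y θ) j ≈ c j + θ * coord (g i) j
        level-y θ j = trans (level-+ mid (θ ∙ g i) j) (+-congˡ (coord-∙ θ (g i) j))

        level-yᵢ : ∀ θ → level (y θ) i ≈ level p i + θ
        level-yᵢ θ = trans (level-y θ i) (+-cong cᵢ≈pᵢ (trans (*-congˡ (coord-g-self i)) (*-identityʳ θ)))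

        up-y : ∀ θ → ∣ θ ∣ ≤ σ → ∀ j → i ≢ j → up (level (y θ) j) ≈ up (c j) × ¬ IsInteger (level (y θ) j)
        up-y θ ∣θ∣≤σ j i≢j = up-strictly-between (up-isInteger (c j))
          (low (∣∣-≤ʳ shift≤) (<-≤-trans (σ<room j) (min-≤ʳ _ _)) (level-y θ j))
          (high (∣∣-≤ˡ shift≤) (<-≤-trans (σ<room j) (min-≤ˡ _ _)) (level-y θ j) (noninteger-rounding (proj₁ (between j i≢j))))
          where
          shift≤ : ∣ θ * coord (g i) j ∣ ≤ σ * 1#
          shift≤ = ∣∣-*-≤ ∣θ∣≤σ (∣coord-g∣≤1 i j)
          low : ∀ {a u c d s} → - d ≤ s * 1# → s < c - (u - 1#) → a ≈ c + d → u - 1# < a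
          low {a} {u} {c} {d} {s} h k l = lin< (a ∷ u ∷ c ∷ d ∷ s ∷ []) (le h ⊕ lt k ⊕ eq (sym l))
          high : ∀ {a u c d s v} → d ≤ s * 1# → s < v + 1# - c → a ≈ c + d → u ≈ v + 1# → a < u
          high {a} {u} {c} {d} {s} {v} h k l m = lin< (a ∷ u ∷ c ∷ d ∷ s ∷ v ∷ []) (le h ⊕ lt k ⊕ eq l ⊕ eq (sym m))

        up-y₊ : up (level (y σ) i) ≈ level p i + 1# × ¬ IsInteger (level (y σ) i)
        up-y₊ = up-strictly-between (isInteger-+ int-i isInteger-1) (low 0<σ (level-yᵢ σ)) (high σ<1 (level-yᵢ σ))
          where
          low : ∀ {a b s} → 0# < s → a ≈ b + s → b + 1# - 1# < a
          low {a} {b} {s} h k = lin< (a ∷ b ∷ s ∷ []) (lt h ⊕ eq (sym k))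
          high : ∀ {a b s} → s < 1# → a ≈ b + s → a < b + 1#
          high {a} {b} {s} h k = lin< (a ∷ b ∷ s ∷ []) (lt h ⊕ eq k)

        up-y₋ : up (level (y (- σ)) i) ≈ level p i × ¬ IsInteger (level (y (- σ)) i)
        up-y₋ = up-strictly-between int-i (low σ<1 (level-yᵢ (- σ))) (high 0<σ (level-yᵢ (- σ)))
          where
          low : ∀ {a b s} → s < 1# → a ≈ b + - s → b - 1# < a
          low {a} {b} {s} h k = lin< (a ∷ b ∷ s ∷ []) (lt h ⊕ eq (sym k))
          high : ∀ {a b s} → 0# < s → a ≈ b + - s → a < b
          high {a} {b} {s} h k = lin< (a ∷ b ∷ s ∷ []) (lt h ⊕ eq k)

        ∣σ∣≤σ : ∣ σ ∣ ≤ σ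
        ∣σ∣≤σ = ≤-reflexive (0≤⇒∣x∣≈x (<⇒≤ 0<σ))

        ∣-σ∣≤σ : ∣ - σ ∣ ≤ σ
        ∣-σ∣≤σ = ≤-trans (≤-reflexive (∣-x∣≈∣x∣ σ)) ∣σ∣≤σ

        y-off : ∀ θ → ∣ θ ∣ ≤ σ → ¬ IsInteger (level (y θ) i) → y θ ∈ OffGrid g γ
        y-off θ ∣θ∣≤σ ¬int = noninteger⇒offGrid {y θ} λ j → case i Fin.≟ j of λ
          { (yes ≡.refl) → ¬int ; (no i≢j) → proj₂ (up-y θ ∣θ∣≤σ j i≢j) }

        in-cell : ∀ {x} θ → ∣ θ ∣ ≤ σ → ¬ IsInteger (level (y θ) i) →
          (∀ j → i ≢ j → up (c j) - 1# ≤ level x j × level x j ≤ up (c j)) →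
          up (level (y θ) i) - 1# ≤ level x i → level x i ≤ up (level (y θ) i) → x ∈ Cell g γ (y θ)
        in-cell {x} θ ∣θ∣≤σ ¬int away low high = levels⇒cell {x} {y θ} (y-off θ ∣θ∣≤σ ¬int) λ j → case i Fin.≟ j of λ
          { (yes ≡.refl) → low , high
          ; (no i≢j)     → let up≈ = proj₁ (up-y θ ∣θ∣≤σ j i≢j) in
              ≤-resp (+-congʳ (sym up≈)) refl (proj₁ (away j i≢j)) , ≤-resp refl (sym up≈) (proj₂ (away j i≢j)) }

        cells : ∀ {x} → level x i ≈ level p i → (∀ j → i ≢ j → up (c j) - 1# ≤ level x j × level x j ≤ up (c j)) →
          x ∈ Cell g γ (y (- σ)) × x ∈ Cell g γ (y σ)
        cells {x} xᵢ≈pᵢ away =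
          in-cell {x} (- σ) ∣-σ∣≤σ (proj₂ up-y₋) away (low₋ (proj₁ up-y₋) xᵢ≈pᵢ) (≤-reflexive (trans xᵢ≈pᵢ (sym (proj₁ up-y₋)))) ,
          in-cell {x} σ ∣σ∣≤σ (proj₂ up-y₊) away (≤-reflexive (level₊ (proj₁ up-y₊) xᵢ≈pᵢ)) (high₊ (proj₁ up-y₊) xᵢ≈pᵢ)
          where
          low₋ : ∀ {u a b} → u ≈ a → b ≈ a → u - 1# ≤ b
          low₋ {u} {a} {b} h k = lin≤ (u ∷ a ∷ b ∷ []) (eq h ⊕ eq (sym k) ⊕ 1+)
          level₊ : ∀ {u a b} → u ≈ a + 1# → b ≈ a → u - 1# ≈ b
          level₊ {u} {a} {b} h k = lin≈ (u ∷ a ∷ b ∷ []) (eq h ⊕ eq (sym k))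
          high₊ : ∀ {u a b} → u ≈ a + 1# → b ≈ a → b ≤ u
          high₊ {u} {a} {b} h k = lin≤ (u ∷ a ∷ b ∷ []) (eq (sym h) ⊕ eq k ⊕ 1+)

        K-jump : K g γ (y σ) ≈² K g γ (y (- σ)) +² g i
        K-jump = ≈²-trans (K≈combine (y σ)) (≈²-trans (≈²-trans
          (combine-cong (λ j → jump j (i Fin.≟ j))) (split proj₁ , split proj₂))
          (+²-cong (≈²-sym (K≈combine (y (- σ)))) (refl , refl)))
          where
          jump : ∀ j → Dec (i ≡ j) → up (level (y σ) j) ≈ up (level (y (- σ)) j) + indicator i j
          jump j (no i≢j)     = trans (proj₁ (up-y σ ∣σ∣≤σ j i≢j)) (trans (sym (proj₁ (up-y (- σ) ∣-σ∣≤σ j i≢j)))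
            (trans (sym (+-identityʳ _)) (+-congˡ (sym (indicator-≢ i≢j)))))
          jump j (yes ≡.refl) = trans (proj₁ up-y₊) (+-cong (sym (proj₁ up-y₋)) (sym (indicator-refl i)))
          split : ∀ (π : ℝ² → ℝ) → sum (λ j → (up (level (y (- σ)) j) + indicator i j) * π (g j)) ≈
            sum (λ j → up (level (y (- σ)) j) * π (g j)) + π (g i)
          split π = trans (sum-cong-≋ (λ j → distribʳ (π (g j)) (up (level (y (- σ)) j)) (indicator i j)))
            (trans (∑-distrib-+ (λ j → up (level (y (- σ)) j) * π (g j)) (λ j → indicator i j * π (g j)))
              (+-congˡ (sum-indicator-* i (λ j → π (g j)))))

        edge⊆tile : ∀ {x} → x ∈ Cell g γ (y (- σ)) × x ∈ Cell g γ (y σ) → ∀ t → 0# ≤ t → t ≤ 1# → K g γ (y (- σ)) +² t ∙ g i ∈ tileAt x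
        edge⊆tile {x} (x∈₋ , x∈₊) t 0≤t t≤1 = 2 , w , v , 0≤w , ring≈ (t ∷ []) , v∈ ,
          interpolate (proj₁ K-jump) , interpolate (proj₂ K-jump)
          where
          w : Fin 2 → ℝ
          w zero       = 1# - t
          w (suc zero) = t
          v : Fin 2 → ℝ²
          v zero       = K g γ (y (- σ))
          v (suc zero) = K g γ (y σ)
          0≤w : ∀ k → 0# ≤ w k
          0≤w zero       = ≤⇒0≤- t≤1
          0≤w (suc zero) = 0≤t
          v∈ : ∀ k → v k ∈ tileVertices g γ x
          v∈ zero       = y (- σ) , y-off (- σ) ∣-σ∣≤σ (proj₂ up-y₋) , x∈₋ , refl , refl
          v∈ (suc zero) = y σ , y-off σ ∣σ∣≤σ (proj₂ up-y₊) , x∈₊ , refl , refl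
          interpolate : ∀ {a b c} → b ≈ a + c → a + t * c ≈ (1# - t) * a + (t * b + 0#)
          interpolate {a} {b} {c} h = lin≈ (a ∷ b ∷ c ∷ t ∷ []) (t · eq (sym h))

        neighbours : ¬ LengthZero (tileAt p ∩ tileAt q)
        neighbours = unit-segment-positive (K g γ (y (- σ))) (g i) (unit i) λ t 0≤t t≤1 →
          edge⊆tile {p} (cells {p} refl (λ j i≢j → proj₁ (proj₂ (between j i≢j)))) t 0≤t t≤1 ,
          edge⊆tile {q} (cells {q} (sym pᵢ≈qᵢ) (λ j i≢j → proj₂ (proj₂ (between j i≢j)))) t 0≤t t≤1

      -- Chains along a grid line.

      Path : Vertex → Vertex → ℕ → Set₁
      Path = Chain (gridTiling g γ)

      path-transport : ∀ {u v w m} → tileAt (point u) ≐ tileAt (point v) → Path v w m → Path u w m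
      path-transport (u⊆v , v⊆u) (here (v⊆w , w⊆v)) = here ((λ z∈ → v⊆w (u⊆v z∈)) , (λ z∈ → v⊆u (w⊆v z∈)))
      path-transport (u⊆v , v⊆u) (advance neighbours path) =
        advance (λ lengthZero → neighbours (lengthZero-⊆ (λ { (z∈v , z∈x) → v⊆u z∈v , z∈x }) lengthZero)) path

      path-++ : ∀ {u v w m m′} → Path u v m → Path v w m′ → Path u w (m ℕ.+ m′)
      path-++ (here u≐v)                          path′ = path-transport u≐v path′
      path-++ (advance neighbours path) path′ = advance neighbours (path-++ path path′)

      ≈-path : ∀ u v → point u ≈² point v → Path u v 0
      ≈-path u v p = here (tileAt-cong {point u} {point v} p , tileAt-cong {point v} {point u} (≈²-sym p))

      Between : ℝ → ℝ → ℝ → Set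
      Between c s t = (s < c × c < t) ⊎ (t < c × c < s)

      E-additive : ∀ {a b c} → (a ≤ b × b ≤ c) ⊎ (c ≤ b × b ≤ a) → ∣ E b - E a ∣ + ∣ E c - E b ∣ ≤ ∣ E c - E a ∣
      E-additive {a} {b} {c} (inj₁ (a≤b , b≤c)) = sum-up (E-mono a≤b) (E-mono b≤c)
        where
        sum-up : ∀ {x y z} → x ≤ y → y ≤ z → ∣ y - x ∣ + ∣ z - y ∣ ≤ ∣ z - x ∣
        sum-up {x} {y} {z} h k = lin≤ (x ∷ y ∷ z ∷ ∣ y - x ∣ ∷ ∣ z - y ∣ ∷ ∣ z - x ∣ ∷ [])
          (eq (0≤⇒∣x∣≈x (≤⇒0≤- h)) ⊕ eq (0≤⇒∣x∣≈x (≤⇒0≤- k)) ⊕ le (x≤∣x∣ (z - x)))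
      E-additive {a} {b} {c} (inj₂ (c≤b , b≤a)) = sum-down (E-mono c≤b) (E-mono b≤a)
        where
        sum-down : ∀ {x y z} → z ≤ y → y ≤ x → ∣ y - x ∣ + ∣ z - y ∣ ≤ ∣ z - x ∣
        sum-down {x} {y} {z} h k = lin≤ (x ∷ y ∷ z ∷ ∣ y - x ∣ ∷ ∣ z - y ∣ ∷ ∣ z - x ∣ ∷ [])
          (eq (≤0⇒∣x∣≈-x {y - x} (lin≤ (x ∷ y ∷ []) (le k))) ⊕ eq (≤0⇒∣x∣≈-x {z - y} (lin≤ (y ∷ z ∷ []) (le h))) ⊕ le (-x≤∣x∣ (z - x)))

      1≤∣E∣ : ∀ {s t} → E s + 1# ≤ E t ⊎ E t + 1# ≤ E s → 1# ≤ ∣ E t - E s ∣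
      1≤∣E∣ {s} {t} (inj₁ h) = ≤-trans (lin≤ (E s ∷ E t ∷ []) (le h)) (x≤∣x∣ (E t - E s))
      1≤∣E∣ {s} {t} (inj₂ h) = ≤-trans (lin≤ (E s ∷ E t ∷ []) (le h)) (-x≤∣x∣ (E t - E s))

      integer-1≤∣E∣ : ∀ {s t} → IsInteger s ⊎ IsInteger t → ¬ s ≈ t → 1# ≤ ∣ E t - E s ∣
      integer-1≤∣E∣ {s} {t} int s≉t with trichotomy s t | int
      ... | equal h   | _        = ⊥-elim (s≉t h)
      ... | less h    | inj₁ is  = 1≤∣E∣ (inj₁ (E-strictʳ is ≤-refl h))
      ... | less h    | inj₂ it  = 1≤∣E∣ (inj₁ (E-strictˡ it h ≤-refl))
      ... | greater h | inj₁ is  = 1≤∣E∣ (inj₂ (E-strictˡ is h ≤-refl))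
      ... | greater h | inj₂ it  = 1≤∣E∣ (inj₂ (E-strictʳ it ≤-refl h))

      integers-2≤∣E∣ : ∀ {s t} → IsInteger s → IsInteger t → ¬ s ≈ t → 1# + 1# ≤ ∣ E t - E s ∣
      integers-2≤∣E∣ {s} {t} is it s≉t with trichotomy s t
      ... | equal h   = ⊥-elim (s≉t h)
      ... | less h    = ≤-trans (lin≤ (s ∷ t ∷ E s ∷ E t ∷ []) (eq (E-integer is) ⊕ eq (sym (E-integer it)) ⊕ le (integer-< is it h) ⊕ le (integer-< is it h))) (x≤∣x∣ (E t - E s))
      ... | greater h = ≤-trans (lin≤ (s ∷ t ∷ E s ∷ E t ∷ []) (eq (sym (E-integer is)) ⊕ eq (E-integer it) ⊕ le (integer-< it is h) ⊕ le (integer-< it is h))) (-x≤∣x∣ (E t - E s))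

      other-line : ∀ {p} (v : TwoLines p) i → ∃ λ a → i ≢ a × IsInteger (level p a)
      other-line v i with TwoLines.a v Fin.≟ i
      ... | yes ≡.refl = TwoLines.b v , TwoLines.a≢b v , TwoLines.int-b v
      ... | no a≢i     = TwoLines.a v , (λ i≡a → a≢i (≡.sym i≡a)) , TwoLines.int-a v

      -- Each crossing lies on a second line, which the other crossing misses: half a passage each.
      -- If the two lines are in one family, its levels are distinct integers and count 2 at once.
      2≤separation : ∀ (u v : Vertex) i → level (point u) i ≈ level (point v) i → ¬ point u ≈² point v → 1# + 1# ≤ separation (point u) (point v)
      2≤separation u v i pᵢ≈qᵢ p≉q with other-line (twoLines u) i | other-line (twoLines v) i
      ... | a , i≢a , int-a | b , i≢b , int-b = ≤-trans (≤-reflexive (sym (trans (∑-distrib-+ (indicator a) (indicator b)) (+-cong (sum-indicator a) (sum-indicator b)))))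
        (separation-≥ (point u) (point v) (λ j → indicator a j + indicator b j) term)
        where
        differ : ∀ j → i ≢ j → ¬ level (point u) j ≈ level (point v) j
        differ = distinct-levels {point u} {point v} i pᵢ≈qᵢ p≉q
        term : ∀ j → indicator a j + indicator b j ≤ ∣ E (level (point v) j) - E (level (point u) j) ∣
        term j with a Fin.≟ j | b Fin.≟ j
        ... | yes ≡.refl | yes ≡.refl = integers-2≤∣E∣ int-a int-b (differ a i≢a)
        ... | yes ≡.refl | no _       = ≤-trans (≤-reflexive (+-identityʳ 1#)) (integer-1≤∣E∣ (inj₁ int-a) (differ a i≢a))
        ... | no _       | yes ≡.refl = ≤-trans (≤-reflexive (+-identityˡ 1#)) (integer-1≤∣E∣ (inj₂ int-b) (differ b i≢b))
        ... | no _       | no _       = ≤-trans (≤-reflexive (+-identityʳ 0#)) 0≤∣ _ ∣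

      record Split (u v : Vertex) (i : Fin N) : Set where
        field
          middle   : Vertex
          on-line  : level (point u) i ≈ level (point middle) i
          additive : separation (point u) (point middle) + separation (point middle) (point v) ≤ separation (point u) (point v)
          left     : 1# ≤ separation (point u) (point middle)
          right    : 1# ≤ separation (point middle) (point v)

      -- The new crossing is where the separating line c of family j meets the common line. It lies
      -- on the segment, so every level moves monotonically and the separations add up.
      split : ∀ (u v : Vertex) i → IsInteger (level (point u) i) → level (point u) i ≈ level (point v) i →
        ∀ j c → IsInteger c → Between c (level (point u) j) (level (point v) j) → Split u v i
      split u v i int-i pᵢ≈qᵢ j c int-c between = record
        { middle   = vertex r i j i≢j (isInteger-resp (sym rᵢ≈pᵢ) int-i) (isInteger-resp (sym rⱼ≈c) int-c)
        ; on-line  = sym rᵢ≈pᵢ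
        ; additive = separation-additive p r q (λ l → E-additive (ordered l))
        ; left     = ≤-trans (integer-1≤∣E∣ (inj₂ (isInteger-resp (sym rⱼ≈c) int-c)) (λ h → pⱼ≉c (trans h rⱼ≈c))) (separation-term p r j)
        ; right    = ≤-trans (integer-1≤∣E∣ (inj₁ (isInteger-resp (sym rⱼ≈c) int-c)) (λ h → c≉qⱼ (trans (sym rⱼ≈c) h))) (separation-term r q j)
        }
        where
        p q : ℝ²
        p = point u
        q = point v
        d w τ : ℝ
        d = level q j - level p j
        w = d ⁻¹
        -- The parameter at which level j, affine along the segment, takes the value c.
        τ = (c - level p j) * w
        pⱼ≉c : ¬ level p j ≈ c
        pⱼ≉c h = case between of λ { (inj₁ (k , _)) → proj₂ k h ; (inj₂ (_ , k)) → proj₂ k (sym h) }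
        c≉qⱼ : ¬ c ≈ level q j
        c≉qⱼ h = case between of λ { (inj₁ (_ , k)) → proj₂ k h ; (inj₂ (k , _)) → proj₂ k (sym h) }
        d≉0 : ¬ d ≈ 0#
        d≉0 h = case between of λ
          { (inj₁ (k , l)) → contra k l h
          ; (inj₂ (k , l)) → contra′ k l h }
          where
          contra : ∀ {a b} → a < c → c < b → b - a ≈ 0# → ⊥
          contra {a} {b} k l h = refute (a ∷ b ∷ c ∷ []) (lt k ⊕ lt l ⊕ eq h)
          contra′ : ∀ {a b} → b < c → c < a → b - a ≈ 0# → ⊥
          contra′ {a} {b} k l h = refute (a ∷ b ∷ c ∷ []) (lt k ⊕ lt l ⊕ eq (sym h))
        dw≈1 : d * w ≈ 1#
        dw≈1 = ⁻¹-inverse d≉0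
        bounds : 0# ≤ τ × τ ≤ 1#
        bounds = go (level p j) (level q j) w between dw≈1
          where
          go : ∀ a b w → Between c a b → (b - a) * w ≈ 1# → 0# ≤ (c - a) * w × (c - a) * w ≤ 1#
          go a b w (inj₁ (a<c , c<b)) h = lin≤ (a ∷ c ∷ w ∷ []) (lt a<c ⊗ lt 0<w) , lin≤ (a ∷ b ∷ c ∷ w ∷ []) (lt c<b ⊗ lt 0<w ⊕ eq h)
            where
            0<w : 0# < w
            0<w = <-resp refl (⁻¹-unique h) (⁻¹-pos (lin< (a ∷ b ∷ c ∷ []) (lt a<c ⊕ lt c<b)))
          go a b w (inj₂ (b<c , c<a)) h = lin≤ (a ∷ c ∷ w ∷ []) (lt c<a ⊗ lt 0<-w) , lin≤ (a ∷ b ∷ c ∷ w ∷ []) (lt b<c ⊗ lt 0<-w ⊕ eq h)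
            where
            0<-w : 0# < - w
            0<-w = <-resp refl (⁻¹-unique (trans (ring≈ (a ∷ b ∷ w ∷ [])) h)) (⁻¹-pos {a - b} (lin< (a ∷ b ∷ c ∷ []) (lt b<c ⊕ lt c<a)))
        r : ℝ²
        r = segment p q τ
        rⱼ≈c : level r j ≈ c
        rⱼ≈c = trans (level-segment p q τ j) (solve (level p j) (level q j) w dw≈1)
          where
          solve : ∀ a b w → (b - a) * w ≈ 1# → a + (c - a) * w * (b - a) ≈ c
          solve a b w h = lin≈ (a ∷ b ∷ c ∷ w ∷ []) ((c - a) · eq h)
        rᵢ≈pᵢ : level r i ≈ level p i
        rᵢ≈pᵢ = trans (level-segment p q τ i) (trans (+-congˡ (trans (*-congˡ (trans (+-congʳ (sym pᵢ≈qᵢ)) (-‿inverseʳ _))) (zeroʳ τ))) (+-identityʳ _))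
        i≢j : i ≢ j
        i≢j ≡.refl = d≉0 (trans (+-congʳ (sym pᵢ≈qᵢ)) (-‿inverseʳ _))
        ordered : ∀ l → (level p l ≤ level r l × level r l ≤ level q l) ⊎ (level q l ≤ level r l × level r l ≤ level p l)
        ordered l = go (level p l) (level q l) (level r l) τ (proj₁ bounds) (proj₂ bounds) (level-segment p q τ l) (total (level p l) (level q l))
          where
          go : ∀ a b x τ → 0# ≤ τ → τ ≤ 1# → x ≈ a + τ * (b - a) → a ≤ b ⊎ b ≤ a → (a ≤ x × x ≤ b) ⊎ (b ≤ x × x ≤ a)
          go a b x τ 0≤τ τ≤1 h (inj₁ a≤b) = inj₁ (lin≤ (a ∷ b ∷ x ∷ τ ∷ []) (eq (sym h) ⊕ le 0≤τ ⊗ le a≤b) , lin≤ (a ∷ b ∷ x ∷ τ ∷ []) (eq h ⊕ le τ≤1 ⊗ le a≤b))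
          go a b x τ 0≤τ τ≤1 h (inj₂ b≤a) = inj₂ (lin≤ (a ∷ b ∷ x ∷ τ ∷ []) (eq (sym h) ⊕ le τ≤1 ⊗ le b≤a) , lin≤ (a ∷ b ∷ x ∷ τ ∷ []) (eq h ⊕ le 0≤τ ⊗ le b≤a))

      -- k is fuel: both parts of a split have separation at least 1, so each is smaller than the
      -- whole by 1. Crossings between which no line passes are equal or one step apart, and
      -- `2≤separation` pays for that step.
      line-path : ∀ k (u v : Vertex) i → IsInteger (level (point u) i) → level (point u) i ≈ level (point v) i →
        separation (point u) (point v) ≤ fromℕ k → ∃ λ m → Path u v m × fromℕ m + fromℕ m ≤ separation (point u) (point v)
      line-path k u v i int-i pᵢ≈qᵢ bound
        with decide (∃ λ j → ∃ λ c → IsInteger c × Between c (level (point u) j) (level (point v) j))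
      line-path zero    u v i int-i pᵢ≈qᵢ bound | yes (j , c , int-c , between) = refute (a ∷ b ∷ s ∷ []) (le left ⊕ le right ⊕ le additive ⊕ le bound)
        where
        open Split (split u v i int-i pᵢ≈qᵢ j c int-c between)
        a b s : ℝ
        a = separation (point u) (point middle)
        b = separation (point middle) (point v)
        s = separation (point u) (point v)
      line-path (suc k) u v i int-i pᵢ≈qᵢ bound | yes (j , c , int-c , between) =
        let m₁ , path₁ , h₁ = line-path k u middle i int-i on-line (first left right additive bound)
            m₂ , path₂ , h₂ = line-path k middle v i (isInteger-resp on-line int-i) (trans (sym on-line) pᵢ≈qᵢ) (second left right additive bound)
        in m₁ ℕ.+ m₂ , path-++ path₁ path₂ , combined (fromℕ-+ m₁ m₂) h₁ h₂ additive
        where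
        open Split (split u v i int-i pᵢ≈qᵢ j c int-c between)
        first : ∀ {a b s} → 1# ≤ a → 1# ≤ b → a + b ≤ s → s ≤ 1# + fromℕ k → a ≤ fromℕ k
        first {a} {b} {s} h₁ h₂ h₃ h₄ = lin≤ (a ∷ b ∷ s ∷ fromℕ k ∷ []) (le h₂ ⊕ le h₃ ⊕ le h₄)
        second : ∀ {a b s} → 1# ≤ a → 1# ≤ b → a + b ≤ s → s ≤ 1# + fromℕ k → b ≤ fromℕ k
        second {a} {b} {s} h₁ h₂ h₃ h₄ = lin≤ (a ∷ b ∷ s ∷ fromℕ k ∷ []) (le h₁ ⊕ le h₃ ⊕ le h₄)
        combined : ∀ {x y m a b s} → m ≈ x + y → x + x ≤ a → y + y ≤ b → a + b ≤ s → m + m ≤ s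
        combined {x} {y} {m} {a} {b} {s} h₁ h₂ h₃ h₄ = lin≤ (x ∷ y ∷ m ∷ a ∷ b ∷ s ∷ []) (eq h₁ ⊕ eq h₁ ⊕ le h₂ ⊕ le h₃ ⊕ le h₄)
      line-path k u v i int-i pᵢ≈qᵢ bound | no none with decide (point u ≈² point v)
      ... | yes p≈q = 0 , ≈-path u v p≈q , ≤-trans (≤-reflexive (+-identityʳ 0#)) (≤-trans 0≤∣ _ ∣ (separation-term (point u) (point v) zero))
      ... | no p≉q  = 1 , advance (CommonEdge.neighbours (point u) (point v) i int-i pᵢ≈qᵢ p≉q (λ j →
          (λ c int h → none (j , c , int , inj₁ h)) , (λ c int h → none (j , c , int , inj₂ h)))) (≈-path v v (refl , refl)) ,
        ≤-trans (≤-reflexive (+-cong (+-identityʳ 1#) (+-identityʳ 1#))) (2≤separation u v i pᵢ≈qᵢ p≉q)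

      straight-path : ∀ (u v : Vertex) i → IsInteger (level (point u) i) → level (point u) i ≈ level (point v) i →
        ∃ λ m → Path u v m × fromℕ m ≤ Z (point v -² point u) + #N
      straight-path u v i int-i pᵢ≈qᵢ =
        let k , bound = archimedean (separation (point u) (point v))
            m , path , h = line-path k u v i int-i pᵢ≈qᵢ bound
        in m , path , halve h (separation≤Z (point u) (point v))
        where
        halve : ∀ {a s b} → a + a ≤ s → s ≤ b + b → a ≤ b
        halve {a} {s} {b} h k = *-cancel-≤ {1# + 1#} (lin< [] 1+) (lin≤ (a ∷ s ∷ b ∷ []) (le h ⊕ le k))

      -- Upper bound: chains between arbitrary crossings.

      detour : Fin N → Fin N → ℝ
      detour a i = ∣ coord (e a) i ⁻¹ ∣ * Z (e a)

      abstract
        -- One constant above the Z-length of every move along a line of some family that changes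
        -- the level in another family by at most 1; the sum replaces a maximum.
        detours : ℝ
        detours = sum (λ a → sum (λ i → detour a i))

        detour≤detours : ∀ a i → detour a i ≤ detours
        detour≤detours a i = ≤-trans (term≤sum {f = detour a} (0≤detour a) i) (term≤sum {f = λ a → sum (λ i → detour a i)} (λ a → sum-nonNeg (0≤detour a)) a)
          where
          0≤detour : ∀ a i → 0# ≤ detour a i
          0≤detour a i = *-nonNeg 0≤∣ _ ∣ (<⇒≤ (0<Z-e a))

      0≤detours : 0# ≤ detours
      0≤detours = ≤-trans (*-nonNeg 0≤∣ _ ∣ (<⇒≤ (0<Z-e zero))) (detour≤detours zero zero)

      Z-zero : ∀ p → Z (p -² p) ≈ 0#
      Z-zero p = trans (Z-cong {y = 0²} (-‿inverseʳ _ , -‿inverseʳ _)) (UnitSphere.ν-zero Z Z-isNorm)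

      record Detour (u : Vertex) (i : Fin N) : Set where
        field
          target    : Vertex
          line      : Fin N
          integral  : IsInteger (level (point u) line)
          same      : level (point u) line ≈ level (point target) line
          arrived   : IsInteger (level (point target) i)
          short     : Z (point target -² point u) ≤ detours

      reach-family : ∀ (u : Vertex) i → Detour u i
      reach-family u i with TwoLines.a (twoLines u) Fin.≟ i
      ... | yes ≡.refl = record { target = u ; line = i ; integral = TwoLines.int-a (twoLines u) ; same = refl
                                ; arrived = TwoLines.int-a (twoLines u) ; short = ≤-trans (≤-reflexive (Z-zero (point u))) 0≤detours }
      ... | no a≢i     = record { target = vertex r a i a≢i (isInteger-resp (sym rₐ≈pₐ) int-a) (isInteger-resp (sym rᵢ≈up) (up-isInteger _))
                                ; line = a ; integral = int-a ; same = sym rₐ≈pₐ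
                                ; arrived = isInteger-resp (sym rᵢ≈up) (up-isInteger _) ; short = short }
        where
        open TwoLines (twoLines u) using (a; int-a)
        p : ℝ²
        p = point u
        s : ℝ
        -- Along e_a this leads to the next line of family i, a change of level of at most 1.
        s = (up (level p i) - level p i) * coord (e a) i ⁻¹
        r : ℝ²
        r = p +² s ∙ e a
        level-r : ∀ j → level r j ≈ level p j + s * coord (e a) j
        level-r j = trans (level-+ p (s ∙ e a) j) (+-congˡ (coord-∙ s (e a) j))
        rₐ≈pₐ : level r a ≈ level p a
        rₐ≈pₐ = trans (level-r a) (trans (+-congˡ (trans (*-congˡ (coord-e-self a)) (zeroʳ s))) (+-identityʳ _))
        rᵢ≈up : level r i ≈ up (level p i)
        rᵢ≈up = trans (level-r i) (solve (⁻¹-inverse (coord-e≉0 a≢i)))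
          where
          solve : ∀ {l v c w} → c * w ≈ 1# → l + (v - l) * w * c ≈ v
          solve {l} {v} {c} {w} h = lin≈ (l ∷ v ∷ c ∷ w ∷ []) ((v - l) · eq h)
        short : Z (r -² p) ≤ detours
        short = ≤-trans (≤-reflexive (trans (Z-cong {y = s ∙ e a} (cancel _ _ , cancel _ _)) (Z-homogeneous s (e a))))
          (≤-trans (scale (<⇒≤ (0<Z-e a)) (≤-trans (∣∣-*-≤ (∣∣-≤ (width₁ (<⇒≤ (up<t+1 (level p i)))) (width₂ (t≤up (level p i)))) ≤-refl) (≤-reflexive (*-identityˡ _))))
            (detour≤detours a i))
          where
          cancel : ∀ x y → (x + y) - x ≈ y
          cancel x y = ring≈ (x ∷ y ∷ [])
          width₁ : ∀ {v l} → v ≤ l + 1# → v - l ≤ 1#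
          width₁ {v} {l} h = lin≤ (v ∷ l ∷ []) (le h)
          width₂ : ∀ {v l} → l ≤ v → - (v - l) ≤ 1#
          width₂ {v} {l} h = lin≤ (v ∷ l ∷ []) (le h ⊕ 1+)
          scale : ∀ {x y z} → 0# ≤ z → x ≤ y → x * z ≤ y * z
          scale {x} {y} {z} h k = lin≤ (x ∷ y ∷ z ∷ []) (le h ⊗ le k)

      -- One bracket for each of the four legs of `path`. `#N` is the rounding error of a straight
      -- leg; `detours` bounds the first and last leg; twice it bounds their joint displacement, and
      -- the product bounds the effect of this displacement on the coefficient of e_i.
      slack : ℝ
      slack = (#N + detours) + ((#N + (detours + detours) * detours) + ((#N + (detours + detours + (detours + detours) * detours)) + (#N + detours)))

      -- From u to a nearby line of family i, along it to a line of family k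
      -- close to v, and along that line; for the cone of v - u spanned by the
      -- directions i and k this is optimal up to a bounded error.
      path : ∀ (u v : Vertex) → ∃ λ m → Path u v m × fromℕ m ≤ Z (point v -² point u) + slack
      path u v = go (coneDecomposition (q -² p))
        where
        p q : ℝ²
        p = point u
        q = point v
        go : ConeDecomposition (q -² p) → ∃ λ m → Path u v m × fromℕ m ≤ Z (q -² p) + slack
        go cone =
          let m₁ , path₁ , h₁ = straight-path u target₁ line₁ integral₁ same₁
              m₂ , path₂ , h₂ = straight-path target₁ r i arrived₁ (sym rᵢ≈)
              m₃ , path₃ , h₃ = straight-path r target₂ k (isInteger-resp (sym rₖ≈) arrived₂) rₖ≈
              m₄ , path₄ , h₄ = straight-path target₂ v line₂ (isInteger-resp same₂ integral₂) (sym same₂)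
          in m₁ ℕ.+ (m₂ ℕ.+ (m₃ ℕ.+ m₄)) , path-++ path₁ (path-++ path₂ (path-++ path₃ path₄)) ,
             ≤-trans (≤-reflexive (trans (fromℕ-+′ m₁ _) (+-congˡ (trans (fromℕ-+′ m₂ _) (+-congˡ (fromℕ-+′ m₃ m₄))))))
               (total-length h₁ h₂ h₃ h₄ short₁ second third (≤-trans (≤-reflexive (Z-flip q q₁)) short₂) (Z-cone cone))
          where
          open ConeDecomposition cone
          open Detour (reach-family u i) using () renaming (target to target₁; line to line₁; integral to integral₁; same to same₁; arrived to arrived₁; short to short₁)
          open Detour (reach-family v k) using () renaming (target to target₂; line to line₂; integral to integral₂; same to same₂; arrived to arrived₂; short to short₂)
          fromℕ-+′ : ∀ m n → fromℕ (m ℕ.+ n) ≈ fromℕ m + fromℕ n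
          fromℕ-+′ = fromℕ-+
          p₁ q₁ : ℝ²
          p₁ = point target₁
          q₁ = point target₂
          x x₁ : ℝ²
          x  = q -² p
          x₁ = q₁ -² p₁
          w s₁ : ℝ
          w  = coord (e i) k ⁻¹
          s₁ = coord x₁ k * w
          cw≈1 : coord (e i) k * w ≈ 1#
          cw≈1 = ⁻¹-inverse (coord-e≉0 i≢k)
          -- The turning point, where the line of family i through p₁ meets the line of family k
          -- through q₁.
          r-point : ℝ²
          r-point = p₁ +² s₁ ∙ e i
          level-r : ∀ j → level r-point j ≈ level p₁ j + s₁ * coord (e i) j
          level-r j = trans (level-+ p₁ (s₁ ∙ e i) j) (+-congˡ (coord-∙ s₁ (e i) j))
          rᵢ≈ : level r-point i ≈ level p₁ i
          rᵢ≈ = trans (level-r i) (trans (+-congˡ (trans (*-congˡ (coord-e-self i)) (zeroʳ s₁))) (+-identityʳ _))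
          rₖ≈ : level r-point k ≈ level q₁ k
          rₖ≈ = trans (level-r k) (solve (level-difference q₁ p₁ k) cw≈1)
            where
            solve : ∀ {a b c d w} → b - a ≈ d → c * w ≈ 1# → a + d * w * c ≈ b
            solve {a} {b} {c} {d} {w} h l = lin≈ (a ∷ b ∷ c ∷ d ∷ w ∷ []) (d · eq l ⊕ eq (sym h))
          r : Vertex
          r = vertex r-point i k i≢k (isInteger-resp (sym rᵢ≈) arrived₁) (isInteger-resp (sym rₖ≈) arrived₂)
          Z-flip : ∀ p q → Z (p -² q) ≈ Z (q -² p)
          Z-flip p q = trans (Z-cong {y = - 1# ∙ (q -² p)} (negate (proj₁ p) (proj₁ q) , negate (proj₂ p) (proj₂ q))) (UnitSphere.ν-neg Z Z-isNorm _)
            where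
            negate : ∀ a b → a - b ≈ - 1# * (b - a)
            negate a b = ring≈ (a ∷ b ∷ [])
          a b : ℝ²
          a = p₁ -² p
          b = q₁ -² q
          Z-b-a : Z (b -² a) ≤ detours + detours
          Z-b-a = ≤-trans (≤-reflexive (Z-cong {y = b +² - 1# ∙ a} (minus , minus))) (≤-trans (Z-triangle b (- 1# ∙ a))
            (+-mono short₂ (≤-trans (≤-reflexive (UnitSphere.ν-neg Z Z-isNorm a)) short₁)))
            where
            minus : ∀ {x y} → x - y ≈ x + - 1# * y
            minus {x} {y} = ring≈ (x ∷ y ∷ [])
            +-mono : ∀ {x y z w} → x ≤ z → y ≤ w → x + y ≤ z + w
            +-mono {x} {y} {z} {w} h k = lin≤ (x ∷ y ∷ z ∷ w ∷ []) (le h ⊕ le k)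
          x₁≈ : x₁ ≈² x +² (b -² a)
          x₁≈ = shift (proj₁ p) (proj₁ q) (proj₁ p₁) (proj₁ q₁) , shift (proj₂ p) (proj₂ q) (proj₂ p₁) (proj₂ q₁)
            where
            shift : ∀ p q p₁ q₁ → q₁ - p₁ ≈ (q - p) + ((q₁ - q) - (p₁ - p))
            shift p q p₁ q₁ = ring≈ (p ∷ q ∷ p₁ ∷ q₁ ∷ [])
          s₁≈ : s₁ ≈ s + coord (b -² a) k * w
          s₁≈ = solve (trans (coord-cong x₁≈ k) (coord-+ x (b -² a) k)) (trans (coord-cong sum-≈ k) (trans (coord-+ _ _ k)
            (+-cong (coord-∙ s (e i) k) (trans (coord-∙ t (e k) k) (trans (*-congˡ (coord-e-self k)) (zeroʳ t)))))) cw≈1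
            where
            solve : ∀ {y₁ y d c w s} → y₁ ≈ y + d → y ≈ s * c + 0# → c * w ≈ 1# → y₁ * w ≈ s + d * w
            solve {y₁} {y} {d} {c} {w} {s} h k l = lin≈ (y₁ ∷ y ∷ d ∷ c ∷ w ∷ s ∷ []) (w · eq h ⊕ w · eq k ⊕ s · eq l)
          error : ℝ
          error = coord (b -² a) k * w
          Z-error : Z (error ∙ e i) ≤ (detours + detours) * detours
          Z-error = ≤-trans (≤-reflexive (trans (Z-homogeneous error (e i)) (trans (*-congʳ (∣∣-* (coord (b -² a) k) w)) (*-assoc _ _ _))))
            (product 0≤∣ _ ∣ 0≤detours (≤-trans (∣coord∣≤Z (b -² a) k) Z-b-a) (detour≤detours i k))
            where
            product : ∀ {x y u v} → 0# ≤ x → 0# ≤ v → x ≤ u → y ≤ v → x * y ≤ u * v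
            product {x} {y} {u} {v} h₁ h₂ h₃ h₄ = lin≤ (x ∷ y ∷ u ∷ v ∷ []) (le h₁ ⊗ le h₄ ⊕ le h₂ ⊗ le h₃)
          second : Z (r-point -² p₁) ≤ ∣ s ∣ * Z (e i) + (detours + detours) * detours
          second = ≤-trans (≤-reflexive (Z-cong {y = s ∙ e i +² error ∙ e i} (step₁ , step₁))) (≤-trans (Z-triangle _ _)
            (add (≤-reflexive (Z-homogeneous s (e i))) Z-error))
            where
            step₁ : ∀ {x y} → (x + s₁ * y) - x ≈ s * y + error * y
            step₁ {x} {y} = expand s₁≈
              where
              expand : ∀ {a b c} → a ≈ b + c → (x + a * y) - x ≈ b * y + c * y
              expand {a} {b} {c} h = lin≈ (a ∷ b ∷ c ∷ x ∷ y ∷ []) (y · eq h)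
            add : ∀ {x y z w} → x ≤ z → y ≤ w → x + y ≤ z + w
            add {x} {y} {z} {w} h k = lin≤ (x ∷ y ∷ z ∷ w ∷ []) (le h ⊕ le k)
          third : Z (q₁ -² r-point) ≤ ∣ t ∣ * Z (e k) + (detours + detours + (detours + detours) * detours)
          third = ≤-trans (≤-reflexive (Z-cong {y = t ∙ e k +² ((b -² a) +² - 1# ∙ (error ∙ e i))}
              (component (proj₁ x₁≈) (proj₁ sum-≈) , component (proj₂ x₁≈) (proj₂ sum-≈))))
            (≤-trans (Z-triangle _ _) (add (≤-reflexive (Z-homogeneous t (e k))) (≤-trans (Z-triangle _ _)
              (add Z-b-a (≤-trans (≤-reflexive (UnitSphere.ν-neg Z Z-isNorm (error ∙ e i))) Z-error)))))
            where
            component : ∀ {y d f h p₁ q₁} → q₁ - p₁ ≈ y + d → y ≈ s * f + t * h → q₁ - (p₁ + s₁ * f) ≈ t * h + (d + - 1# * (error * f))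
            component {y} {d} {f} {h} {p₁} {q₁} l₁ l₂ = expand l₂ s₁≈
              where
              expand : ∀ {s₁ s c t : ℝ} → y ≈ s * f + t * h → s₁ ≈ s + c → q₁ - (p₁ + s₁ * f) ≈ t * h + (d + - 1# * (c * f))
              expand {s₁} {s} {c} {t} l k = lin≈ (q₁ ∷ p₁ ∷ y ∷ d ∷ f ∷ h ∷ s₁ ∷ s ∷ c ∷ t ∷ []) (eq l₁ ⊕ eq l ⊕ f · eq (sym k))
            add : ∀ {x y z w} → x ≤ z → y ≤ w → x + y ≤ z + w
            add {x} {y} {z} {w} h k = lin≤ (x ∷ y ∷ z ∷ w ∷ []) (le h ⊕ le k)
          total-length : ∀ {m₁ m₂ m₃ m₄ z₁ z₂ z₃ z₄ σ τ z c₁ c₂ c₃ N} → m₁ ≤ z₁ + N → m₂ ≤ z₂ + N → m₃ ≤ z₃ + N → m₄ ≤ z₄ + N →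
            z₁ ≤ c₁ → z₂ ≤ σ + c₂ → z₃ ≤ τ + c₃ → z₄ ≤ c₁ → z ≈ σ + τ →
            m₁ + (m₂ + (m₃ + m₄)) ≤ z + ((N + c₁) + ((N + c₂) + ((N + c₃) + (N + c₁))))
          total-length {m₁} {m₂} {m₃} {m₄} {z₁} {z₂} {z₃} {z₄} {σ} {τ} {z} {c₁} {c₂} {c₃} {N} h₁ h₂ h₃ h₄ l₁ l₂ l₃ l₄ e =
            ≤-trans (add h₁ l₁ (add h₂ l₂ (add h₃ l₃ (≤-trans h₄ (mono l₄))))) (≤-trans (regroup σ τ c₁ c₂ c₃ N) (mono (≤-reflexive (sym e))))
            where
            add : ∀ {m z c N m′ d} → m ≤ z + N → z ≤ c → m′ ≤ d → m + m′ ≤ (c + N) + d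
            add {m} {z} {c} {N} {m′} {d} h l k = lin≤ (m ∷ z ∷ c ∷ N ∷ m′ ∷ d ∷ []) (le h ⊕ le l ⊕ le k)
            mono : ∀ {x y c} → x ≤ y → x + c ≤ y + c
            mono {x} {y} {c} h = lin≤ (x ∷ y ∷ c ∷ []) (le h)
            regroup : ∀ σ τ c₁ c₂ c₃ N → (c₁ + N) + (((σ + c₂) + N) + (((τ + c₃) + N) + (c₁ + N))) ≤ (σ + τ) + ((N + c₁) + ((N + c₂) + ((N + c₃) + (N + c₁))))
            regroup σ τ c₁ c₂ c₃ N = lin≤ (σ ∷ τ ∷ c₁ ∷ c₂ ∷ c₃ ∷ N ∷ []) none

      -- Shells near the dilated sphere.

      distances-bounded : ∀ (o : Vertex) (us : List Vertex) → ∃ λ M → 0# ≤ M × (∀ u → u ∈ˡ us → Z (point u -² point o) ≤ M)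
      distances-bounded o []       = 0# , ≤-refl , λ _ ()
      distances-bounded o (v ∷ us) =
        let M , 0≤M , bound = distances-bounded o us
            0≤Z = UnitSphere.ν-nonNeg Z Z-isNorm (point v -² point o)
        in Z (point v -² point o) + M , +-nonNeg 0≤Z 0≤M , λ
          { u (here ≡.refl) → left 0≤M ; u (there u∈) → ≤-trans (bound u u∈) (right 0≤Z) }
        where
        left : ∀ {x y} → 0# ≤ y → x ≤ x + y
        left {x} {y} h = lin≤ (x ∷ y ∷ []) (le h)
        right : ∀ {x y} → 0# ≤ x → y ≤ x + y
        right {x} {y} h = lin≤ (x ∷ y ∷ []) (le h)

      ∣component∣≤1 : ∀ j → ∣ proj₁ (g j) ∣ ≤ 1# × ∣ proj₂ (g j) ∣ ≤ 1#
      ∣component∣≤1 j = go (unit j) , go (trans (+-comm _ _) (unit j))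
        where
        go : ∀ {a b} → a * a + b * b ≈ 1# → ∣ a ∣ ≤ 1#
        go {a} {b} h = square-cancel-≤ (<⇒≤ 0<1) (lin≤ (∣ a ∣ ∷ a ∷ b ∷ []) (eq (∣x∣*∣x∣ a) ⊕ eq h ⊕ sq b))

      combine-bound : ∀ κ → (∀ j → ∣ κ j ∣ ≤ 1#) → ∣ proj₁ (combine κ) ∣ ≤ #N × ∣ proj₂ (combine κ) ∣ ≤ #N
      combine-bound κ h = bound (λ j → proj₁ (g j)) (λ j → proj₁ (∣component∣≤1 j)) , bound (λ j → proj₂ (g j)) (λ j → proj₂ (∣component∣≤1 j))
        where
        bound : ∀ (f : Fin N → ℝ) → (∀ j → ∣ f j ∣ ≤ 1#) → ∣ sum (λ j → κ j * f j) ∣ ≤ #N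
        bound f k = ≤-trans (∣sum∣≤sum∣∣ (λ j → κ j * f j)) (≤-trans (sum-mono (λ j → ≤-trans (∣∣-*-≤ (h j) (k j)) (≤-reflexive (*-identityˡ 1#))))
          (≤-reflexive (trans (sum-const N 1#) (*-identityʳ #N))))

      sphere-bound : ∀ {f} → ν f ≈ 1# → ∣ proj₁ f ∣ ≤ #N × ∣ proj₂ f ∣ ≤ #N
      sphere-bound {f} νf≈1 = ≤-resp (∣∣-cong (sym (proj₁ f≈))) refl (proj₁ bounds) , ≤-resp (∣∣-cong (sym (proj₂ f≈))) refl (proj₂ bounds)
        where
        f≈ : f ≈² combine (coord (B f))
        f≈ = ≈²-trans (≈²-sym (A∘B f)) (A≈sum (B f))
        bounds : ∣ proj₁ (combine (coord (B f))) ∣ ≤ #N × ∣ proj₂ (combine (coord (B f))) ∣ ≤ #N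
        bounds = combine-bound (coord (B f)) (λ j → ≤-trans (∣coord∣≤Z (B f) j) (≤-reflexive νf≈1))

      polar : ∀ v → ∃ λ f → ν f ≈ 1# × v ≈² ν v ∙ f
      polar v with decide (ν v ≈ 0#)
      -- Here v = 0, so any point of the sphere will do.
      ... | yes νv≈0 = growthVertex g (s+ , zero) , trans (ν-cong (growthVertex≈ (s+ , zero))) (trans (ν∘A _) (Z-vertex (s+ , zero))) ,
        trans (proj₁ (definite νv≈0)) (sym (trans (*-congʳ νv≈0) (zeroˡ _))) , trans (proj₂ (definite νv≈0)) (sym (trans (*-congʳ νv≈0) (zeroˡ _)))
      ... | no νv≉0  = ν v ⁻¹ ∙ v , trans (ν-homogeneous _ v) (trans (*-congʳ (0≤⇒∣x∣≈x (<⇒≤ (⁻¹-pos 0<νv)))) (trans (*-comm _ _) (⁻¹-inverse νv≉0))) ,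
        scale (⁻¹-inverse νv≉0) , scale (⁻¹-inverse νv≉0)
        where
        0<νv : 0# < ν v
        0<νv = UnitSphere.ν-nonNeg ν ν-isNorm v , λ h → νv≉0 (sym h)
        scale : ∀ {a b c} → a * b ≈ 1# → c ≈ a * (b * c)
        scale {a} {b} {c} h = lin≈ (a ∷ b ∷ c ∷ []) (c · eq (sym h))

      -- Each weight of a point of the tile at p is within 1 of the level of p, and levels differ
      -- from those of o by the coordinates of p - o, which sum to A (p - o).
      tile-offset : ∀ {o p z} → z ∈ tileAt p → ∃ λ θ → (∀ j → ∣ θ j ∣ ≤ 1#) × z ≈² combine (level o) +² (A (p -² o) +² combine θ)
      tile-offset {o} {p} {z} z∈ = θ , θ≤1 , ≈²-trans z≈ (≈²-trans (spread proj₁ , spread proj₂) (+²-cong (refl , refl) (+²-cong (≈²-sym (A≈sum (p -² o))) (refl , refl))))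
        where
        open TilePoint (tilePoint z∈)
        θ : Fin N → ℝ
        θ j = κ j - level p j
        θ≤1 : ∀ j → ∣ θ j ∣ ≤ 1#
        θ≤1 j = ∣∣-≤ (upper (proj₂ (ceilings j)) (dn≤t (level p j))) (below (proj₁ (ceilings j)) (t≤up (level p j)))
          where
          upper : ∀ {k d l} → k ≤ d + 1# → d ≤ l → k - l ≤ 1#
          upper {k} {d} {l} h h′ = lin≤ (k ∷ d ∷ l ∷ []) (le h ⊕ le h′)
          below : ∀ {k u l} → u ≤ k → l ≤ u → - (k - l) ≤ 1#
          below {k} {u} {l} h h′ = lin≤ (k ∷ u ∷ l ∷ []) (le h ⊕ le h′ ⊕ 1+)
        spread : ∀ (π : ℝ² → ℝ) → sum (λ j → κ j * π (g j)) ≈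
          sum (λ j → level o j * π (g j)) +
            (sum (λ j → coord (p -² o) j * π (g j)) + sum (λ j → θ j * π (g j)))
        spread π = trans (sum-cong-≋ (λ j → expand (κ j) (level p j) (level o j) (coord (p -² o) j) (π (g j)) (level-difference p o j)))
          (trans (∑-distrib-+ (λ j → level o j * π (g j)) (λ j → coord (p -² o) j * π (g j) + θ j * π (g j)))
            (+-congˡ (∑-distrib-+ (λ j → coord (p -² o) j * π (g j)) (λ j → θ j * π (g j)))))
          where
          expand : ∀ k a b c f → a - b ≈ c → k * f ≈ b * f + (c * f + (k - a) * f)
          expand k a b c f h = lin≈ (k ∷ a ∷ b ∷ c ∷ f ∷ []) (f · eq h)

      module _ (regular : Regular g γ) where

        sphere-isGrowthForm : IsGrowthForm (gridTiling g γ) Sphere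
        sphere-isGrowthForm = record { closedCurve = sphere-closedCurve ; growth = growth }
          where
          growth : ∀ P₀ → ∃ λ x → ∃ λ C → ∀ m v → v ∈ Shell (gridTiling g γ) P₀ m → ∀ z → z ∈ tileAt (point v) →
            ∃ λ f → f ∈ Sphere × z ∈ ClosedBall (x +² fromℕ m ∙ f) C
          growth (o ∷⁺ us) = combine (level (point o)) , C , near
            where
            M₀ : ℝ
            M₀ = proj₁ (distances-bounded o (o ∷ us))
            0≤M₀ : 0# ≤ M₀
            0≤M₀ = proj₁ (proj₂ (distances-bounded o (o ∷ us)))
            M C : ℝ
            -- The bound for the difference between ν (A (v - o)) and m: 2 `#N` from comparing
            -- chains with Z, M₀ from the spread of P₀ around o, and `slack` from the constructed
            -- chain.
            M = (#N + #N) + (M₀ + slack)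
            -- Each component errs by at most M `#N` for the wrong radius plus `#N` for rounding;
            -- `components⇒ball` doubles this, and the 1 makes the radius positive.
            C = 1# + ((M * #N + #N) + (M * #N + #N))
            0≤#N : 0# ≤ #N
            0≤#N = fromℕ-nonNeg N
            0≤slack : 0# ≤ slack
            0≤slack = +-nonNeg (+-nonNeg 0≤#N 0≤detours) (+-nonNeg (+-nonNeg 0≤#N 0≤product) (+-nonNeg
              (+-nonNeg 0≤#N (+-nonNeg (+-nonNeg 0≤detours 0≤detours) 0≤product)) (+-nonNeg 0≤#N 0≤detours)))
              where
              0≤product : 0# ≤ (detours + detours) * detours
              0≤product = *-nonNeg (+-nonNeg 0≤detours 0≤detours) 0≤detours
            near : ∀ m v → v ∈ Shell (gridTiling g γ) (o ∷⁺ us) m → ∀ z → z ∈ tileAt (point v) →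
              ∃ λ f → f ∈ Sphere × z ∈ ClosedBall (combine (level (point o)) +² fromℕ m ∙ f) C
            near m v ((u , u∈ , path-uv) , minimal) z z∈ =
              let f , νf≈1 , A≈ = polar (A (point v -² point o))
                  θ , θ≤1 , z≈ = tile-offset {point o} {point v} z∈
                  f₁≤ , f₂≤ = sphere-bound νf≈1
                  θ₁≤ , θ₂≤ = combine-bound θ θ≤1
                  0≤C , d< = components⇒ball {combine (level (point o)) +² fromℕ m ∙ f} {z} (M * #N + #N) 0<C 2k≤C
                    (component (proj₁ z≈) (proj₁ A≈) f₁≤ θ₁≤) (component (proj₂ z≈) (proj₂ A≈) f₂≤ θ₂≤)
              in f , νf≈1 , 0≤C , proj₁ d<
              where
              ρ : ℝ
              ρ = ν (A (point v -² point o))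
              ρ≈Z : ρ ≈ Z (point v -² point o)
              ρ≈Z = ν∘A _
              upper-bound : ρ ≤ fromℕ m + M
              upper-bound = chain (chain⇒separation regular path-uv z∈) (Z≤separation (point u) (point v))
                (≤-trans (≤-reflexive (trans ρ≈Z (Z-cong (telescope , telescope)))) (Z-triangle (point v -² point u) (point u -² point o)))
                (proj₂ (proj₂ (distances-bounded o (o ∷ us))) u u∈) 0≤slack
                where
                telescope : ∀ {x y z} → x - z ≈ (x - y) + (y - z)
                telescope {x} {y} {z} = ring≈ (x ∷ y ∷ z ∷ [])
                chain : ∀ {s k c z z′ M s′ r} → s ≤ (k + k) + c * (1# + 1#) → z + z ≤ s + (c + c) → r ≤ z + z′ → z′ ≤ M → 0# ≤ s′ →
                  r ≤ k + ((c + c) + (M + s′))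
                chain {s} {k} {c} {z} {z′} {M} {s′} {r} h₁ h₂ h₃ h₄ h₅ = *-cancel-≤ {1# + 1#} (lin< [] 1+)
                  (lin≤ (s ∷ k ∷ c ∷ z ∷ z′ ∷ M ∷ s′ ∷ r ∷ []) (le h₁ ⊕ le h₂ ⊕ le h₃ ⊕ le h₃ ⊕ le h₄ ⊕ le h₄ ⊕ le h₅ ⊕ le h₅))
              lower-bound : fromℕ m ≤ ρ + M
              lower-bound = let m′ , path-ov , m′≤ = path o v in
                -- Minimality of m is used for a chain from the centre o, which itself belongs to
                -- P₀.
                widen (≤-trans (fromℕ-mono (minimal o m′ (here ≡.refl) path-ov)) m′≤) ρ≈Z 0≤#N 0≤M₀
                where
                fromℕ-mono : ∀ {i j} → i ℕ.≤ j → fromℕ i ≤ fromℕ j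
                fromℕ-mono {i} {j} i≤j = fromℤ-mono-≤ {+ i} {+ j} (ℤ.+≤+ i≤j)
                widen : ∀ {k z s r c M} → k ≤ z + s → r ≈ z → 0# ≤ c → 0# ≤ M → k ≤ r + ((c + c) + (M + s))
                widen {k} {z} {s} {r} {c} {M} h₁ h₂ h₃ h₄ = lin≤ (k ∷ z ∷ s ∷ r ∷ c ∷ M ∷ []) (le h₁ ⊕ eq (sym h₂) ⊕ le h₃ ⊕ le h₃ ⊕ le h₄)
              ∣ρ-m∣≤M : ∣ ρ - fromℕ m ∣ ≤ M
              ∣ρ-m∣≤M = ∣∣-≤ (subtract upper-bound) (subtract′ lower-bound)
                where
                subtract : ∀ {a b c} → a ≤ b + c → a - b ≤ c
                subtract {a} {b} {c} h = lin≤ (a ∷ b ∷ c ∷ []) (le h)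
                subtract′ : ∀ {a b c} → b ≤ a + c → - (a - b) ≤ c
                subtract′ {a} {b} {c} h = lin≤ (a ∷ b ∷ c ∷ []) (le h)
              0≤k : 0# ≤ M * #N + #N
              0≤k = +-nonNeg (*-nonNeg (≤-trans 0≤∣ _ ∣ ∣ρ-m∣≤M) 0≤#N) 0≤#N
              0<C : 0# < C
              0<C = +-pos-nonNeg 0<1 (+-nonNeg 0≤k 0≤k)
              2k≤C : (M * #N + #N) + (M * #N + #N) ≤ C
              2k≤C = grow ((M * #N + #N) + (M * #N + #N))
                where
                grow : ∀ x → x ≤ 1# + x
                grow x = lin≤ (x ∷ []) 1+
              component : ∀ {z o a f θ} → z ≈ o + (a + θ) → a ≈ ρ * f → ∣ f ∣ ≤ #N → ∣ θ ∣ ≤ #N → ∣ z - (o + fromℕ m * f) ∣ ≤ M * #N + #N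
              component {z} {o} {a} {f} {θ} h₁ h₂ h₃ h₄ = ≤-trans (≤-reflexive (∣∣-cong (expand ρ (fromℕ m) h₂)))
                (∣∣-+-≤ (∣∣-*-≤ ∣ρ-m∣≤M h₃) h₄)
                where
                expand : ∀ r m → a ≈ r * f → z - (o + m * f) ≈ (r - m) * f + θ
                expand r m h₂ = lin≈ (z ∷ o ∷ a ∷ f ∷ θ ∷ r ∷ m ∷ []) (eq h₁ ⊕ eq h₂)

theorem3 : (em : ExcludedMiddle (lsuc 0ℓ)) (realField : CompleteOrderedField) →
    let open GridTilings em realField in
    (N : ℕ) → 2 ℕ.≤ N →
    (g : Fin N → ℝ²) (γ : Fin N → ℝ) →
    (∀ i → IsUnit (g i)) →
    (∀ i j → i ≢ j → ¬ Parallel (g i) (g j)) →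
    Regular g γ →
    Σ (Pred ℝ² 0ℓ) λ F →
    IsPolygonWithVertices F (growthVertex g) × IsGrowthForm (gridTiling g γ) F
theorem3 em realField (suc (suc n)) (ℕ.s≤s (ℕ.s≤s ℕ.z≤n)) g γ unit ¬parallel regular =
  _ , sphere-isPolygon , Grid.sphere-isGrowthForm γ regular
  where
  open Proof.Tiling em realField n g unit ¬parallel
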